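{- Using the principal branch of the square root, for $|z|<\ln 2$, \[ \sqrt{2e^{ -z}-1}=\sum_{n=0}^{\infty}(-1)^{n+1}\Bigg[\sum_{k=0}^{n}(-1)^kS(n,k)(2k-3)!!\Bigg]\frac{z^n}{n!}, \] where $S(n,k)$ are the Stirling numbers of the second kind.
   Context: $S(n,k)$ is defined by $\frac{(e^x-1)^k}{k!}=\sum_{n\ge k}S(n,k)\frac{x^n}{n!}$, so $S(0,0)=1$ and $S(n,0)=0$ for $n\ge1$. Double factorials: $(2j-1)!!=1\cdot3\cdots(2j-1)$ for $j\ge1$. For negative odd integers, $[-(2k+1)]!!=\frac{(-1)^k}{(2k-1)!!}$ for $k\ge0$, so $(-1)!!=1$ and $(-3)!!=-1$. -}

module Defs where

open import Data.Nat.Base as ℕ using (ℕ; zero; suc; _!)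
import Data.Nat.Properties as ℕ
open import Data.Integer.Base as ℤ using (ℤ; +_; -[1+_])
import Data.Integer.Properties as ℤ
open import Data.Rational.Base
open import Data.Rational.Properties
open import Data.Rational.Solver using (module +-*-Solver)
import Data.Rational.Unnormalised.Base as ℚᵘ
import Data.Rational.Unnormalised.Properties as ℚᵘ
open import Data.Product.Base using (_×_; _,_; proj₁; proj₂; ∃)
open import Data.Sum.Base using (_⊎_; inj₁; inj₂; [_,_]′)
open import Relation.Nullary using (Dec; ¬_; yes; no; contradiction)
open import Relation.Binary.PropositionalEquality using (_≡_; refl; sym; trans; cong; cong₂; subst; module ≡-Reasoning)
open import Algebra.Definitions.RawSemiring +-*-rawSemiring using (_^_)

open +-*-Solver using (solve; _:=_; _:+_; _:*_; _:-_; :-_; con)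

ι : ℕ → ℚ
ι n = + n / 1

0≤ι : ∀ n → 0ℚ ≤ ι n
0≤ι n = nonNegative⁻¹ (ι n) ⦃ normalize-nonNeg n 1 ⦄

ι-+ : ∀ m n → ι (m ℕ.+ n) ≡ ι m + ι n
ι-+ m n = toℚᵘ-injective (begin
  toℚᵘ (ι (m ℕ.+ n))                     ≈⟨ toℚᵘ-fromℚᵘ (ℚᵘ.mkℚᵘ (+ (m ℕ.+ n)) 0) ⟩
  ℚᵘ.mkℚᵘ (+ (m ℕ.+ n)) 0                ≈⟨ ℚᵘ.*≡* (cong (ℤ._* + 1) (sym (cong₂ ℤ._+_ (ℤ.*-identityʳ (+ m)) (ℤ.*-identityʳ (+ n))))) ⟩
  ℚᵘ.mkℚᵘ (+ m) 0 ℚᵘ.+ ℚᵘ.mkℚᵘ (+ n) 0   ≈⟨ ℚᵘ.+-cong (toℚᵘ-fromℚᵘ (ℚᵘ.mkℚᵘ (+ m) 0)) (toℚᵘ-fromℚᵘ (ℚᵘ.mkℚᵘ (+ n) 0)) ⟨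
  toℚᵘ (ι m) ℚᵘ.+ toℚᵘ (ι n)             ≈⟨ toℚᵘ-homo-+ (ι m) (ι n) ⟨
  toℚᵘ (ι m + ι n)                       ∎)
  where open ℚᵘ.≃-Reasoning

ι-≤ : ∀ {m n} → m ℕ.≤ n → ι m ≤ ι n
ι-≤ {m} {n} m≤n = begin
  ι m                      ≡⟨ +-identityʳ (ι m) ⟨
  ι m + 0ℚ                 ≤⟨ +-monoʳ-≤ (ι m) (0≤ι (n ℕ.∸ m)) ⟩
  ι m + ι (n ℕ.∸ m)        ≡⟨ ι-+ m (n ℕ.∸ m) ⟨
  ι (m ℕ.+ (n ℕ.∸ m))      ≡⟨ cong ι (ℕ.m+[n∸m]≡n m≤n) ⟩
  ι n                      ∎
  where open ≤-Reasoning

/-ι : ∀ j d .⦃ _ : ℕ.NonZero d ⦄ → + j / d * ι d ≡ ι j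
/-ι j d@(suc d-1) = toℚᵘ-injective (begin
  toℚᵘ (+ j / d * ι d)                    ≈⟨ toℚᵘ-homo-* (+ j / d) (ι d) ⟩
  toℚᵘ (+ j / d) ℚᵘ.* toℚᵘ (ι d)          ≈⟨ ℚᵘ.*-cong (toℚᵘ-fromℚᵘ (ℚᵘ.mkℚᵘ (+ j) d-1)) (toℚᵘ-fromℚᵘ (ℚᵘ.mkℚᵘ (+ d) 0)) ⟩
  ℚᵘ.mkℚᵘ (+ j) d-1 ℚᵘ.* ℚᵘ.mkℚᵘ (+ d) 0  ≈⟨ ℚᵘ.*≡* (trans (ℤ.*-identityʳ _) (cong (+ j ℤ.*_) (cong +_ (sym (ℕ.*-identityʳ d))))) ⟩
  ℚᵘ.mkℚᵘ (+ j) 0                         ≈⟨ toℚᵘ-fromℚᵘ (ℚᵘ.mkℚᵘ (+ j) 0) ⟨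
  toℚᵘ (ι j)                              ∎)
  where open ℚᵘ.≃-Reasoning

p≤ι : ∀ p → p ≤ ι ℤ.∣ ↥ p ∣
p≤ι p = toℚᵘ-cancel-≤ (ℚᵘ.≤-respʳ-≃ (ℚᵘ.≃-sym (toℚᵘ-fromℚᵘ (ℚᵘ.mkℚᵘ (+ ℤ.∣ ↥ p ∣) 0))) (go p))
  where
  go : ∀ p → toℚᵘ p ℚᵘ.≤ ℚᵘ.mkℚᵘ (+ ℤ.∣ ↥ p ∣) 0
  go (mkℚ (+ n)    d c) = ℚᵘ.*≤* (ℤ.*-monoˡ-≤-nonNeg (+ n) (ℤ.+≤+ (ℕ.s≤s ℕ.z≤n)))
  go (mkℚ -[1+ n ] d c) = ℚᵘ.*≤* ℤ.-≤+

x+y-y : ∀ x y → x + (y - x) ≡ y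
x+y-y = solve 2 (λ x y → x :+ (y :- x) := y) refl

1/! : ℕ → ℚ
1/! n = (+ 1 / n !) ⦃ n ℕ.!≢0 ⦄

-- The upper limit is included: ∑ _∙_ n f is f 0 ∙ f 1 ∙ ⋯ ∙ f n.
∑ : ∀ {A : Set} → (A → A → A) → ℕ → (ℕ → A) → A
∑ _∙_ zero    f = f 0
∑ _∙_ (suc n) f = ∑ _∙_ n f ∙ f (suc n)

0<1 : 0ℚ < 1ℚ
0<1 = positive⁻¹ 1ℚ

*-nonNeg : ∀ {p q} → 0ℚ ≤ p → 0ℚ ≤ q → 0ℚ ≤ p * q
*-nonNeg {p} {q} 0≤p 0≤q =
  nonNegative⁻¹ (p * q) ⦃ nonNeg*nonNeg⇒nonNeg p ⦃ nonNegative 0≤p ⦄ q ⦃ nonNegative 0≤q ⦄ ⦄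

+-nonNeg : ∀ {p q} → 0ℚ ≤ p → 0ℚ ≤ q → 0ℚ ≤ p + q
+-nonNeg = +-mono-≤

*-monoˡ : ∀ {r p q} → 0ℚ ≤ r → p ≤ q → r * p ≤ r * q
*-monoˡ {r} 0≤r = *-monoˡ-≤-nonNeg r ⦃ nonNegative 0≤r ⦄

*-monoʳ : ∀ {r p q} → 0ℚ ≤ r → p ≤ q → p * r ≤ q * r
*-monoʳ {r} 0≤r = *-monoʳ-≤-nonNeg r ⦃ nonNegative 0≤r ⦄

*-mono : ∀ {p q r s} → 0ℚ ≤ q → 0ℚ ≤ r → p ≤ q → r ≤ s → p * r ≤ q * s
*-mono 0≤q 0≤r p≤q r≤s = ≤-trans (*-monoʳ 0≤r p≤q) (*-monoˡ 0≤q r≤s)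

p≤p+q : ∀ {p q} → 0ℚ ≤ q → p ≤ p + q
p≤p+q {p} {q} 0≤q = begin
  p       ≡⟨ +-identityʳ p ⟨
  p + 0ℚ  ≤⟨ +-monoʳ-≤ p 0≤q ⟩
  p + q   ∎
  where open ≤-Reasoning

p≤q+p : ∀ {p q} → 0ℚ ≤ q → p ≤ q + p
p≤q+p {p} {q} 0≤q = subst (p ≤_) (+-comm p q) (p≤p+q 0≤q)

p≤∣p∣ : ∀ p → p ≤ ∣ p ∣
p≤∣p∣ p = [ (λ 0≤p → ≤-reflexive (sym (0≤p⇒∣p∣≡p 0≤p))) , (λ p≤0 → ≤-trans p≤0 (0≤∣p∣ p)) ]′ (≤-total 0ℚ p)

∣p-q∣-comm : ∀ p q → ∣ p - q ∣ ≡ ∣ q - p ∣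
∣p-q∣-comm p q = trans (cong ∣_∣ (solve 2 (λ p q → p :- q := :- (q :- p)) refl p q)) (∣-p∣≡∣p∣ (q - p))

∣-∣≤ : ∀ {p q ε} → p ≤ q + ε → q ≤ p + ε → ∣ p - q ∣ ≤ ε
∣-∣≤ {p} {q} {ε} p≤q+ε q≤p+ε with ∣p∣≡p∨∣p∣≡-p (p - q)
... | inj₁ e = begin
  ∣ p - q ∣    ≡⟨ e ⟩
  p - q        ≤⟨ +-monoˡ-≤ (- q) p≤q+ε ⟩
  q + ε - q    ≡⟨ solve 2 (λ q ε → q :+ ε :- q := ε) refl q ε ⟩
  ε            ∎
  where open ≤-Reasoning
... | inj₂ e = begin
  ∣ p - q ∣    ≡⟨ e ⟩
  - (p - q)    ≡⟨ solve 2 (λ p q → :- (p :- q) := q :- p) refl p q ⟩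
  q - p        ≤⟨ +-monoˡ-≤ (- p) q≤p+ε ⟩
  p + ε - p    ≡⟨ solve 2 (λ q ε → q :+ ε :- q := ε) refl p ε ⟩
  ε            ∎
  where open ≤-Reasoning

≤+∣-∣ : ∀ p q → p ≤ q + ∣ p - q ∣
≤+∣-∣ p q = begin
  p                ≡⟨ x+y-y q p ⟨
  q + (p - q)      ≤⟨ +-monoʳ-≤ q (p≤∣p∣ (p - q)) ⟩
  q + ∣ p - q ∣    ∎
  where open ≤-Reasoning

triangle : ∀ p q r → ∣ p - r ∣ ≤ ∣ p - q ∣ + ∣ q - r ∣
triangle p q r = begin
  ∣ p - r ∣              ≡⟨ cong ∣_∣ (solve 3 (λ p q r → p :- r := (p :- q) :+ (q :- r)) refl p q r) ⟩
  ∣ (p - q) + (q - r) ∣  ≤⟨ ∣p+q∣≤∣p∣+∣q∣ (p - q) (q - r) ⟩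
  ∣ p - q ∣ + ∣ q - r ∣  ∎
  where open ≤-Reasoning

½-pos : ∀ {ε} → 0ℚ < ε → 0ℚ < ½ * ε
½-pos {ε} 0<ε = subst (_< ½ * ε) (*-zeroʳ ½) (*-monoʳ-<-pos ½ 0<ε)

½+½ : ∀ ε → ½ * ε + ½ * ε ≡ ε
½+½ = solve 1 (λ ε → con ½ :* ε :+ con ½ :* ε := ε) refl

shrink : ∀ C {ε} → 0ℚ < C → 0ℚ < ε → ∃ λ δ → 0ℚ < δ × C * δ ≤ ε
shrink C {ε} 0<C 0<ε = C⁻¹ * ε , 0<δ , ≤-reflexive eq
  where
  instance
    posC : Positive C
    posC = positive 0<C
    nzC : NonZero C
    nzC = pos⇒nonZero C
  C⁻¹ = 1/ C
  instance
    posC⁻¹ : Positive C⁻¹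
    posC⁻¹ = 1/pos⇒pos C
  0<δ : 0ℚ < C⁻¹ * ε
  0<δ = subst (_< C⁻¹ * ε) (*-zeroʳ C⁻¹) (*-monoʳ-<-pos C⁻¹ 0<ε)
  eq : C * (C⁻¹ * ε) ≡ ε
  eq = trans (sym (*-assoc C C⁻¹ ε)) (trans (cong (_* ε) (*-inverseʳ C)) (*-identityˡ ε))

-- Opaque because unfolding _/_ at an open numerator and denominator sends
-- the type checker into the computation of a gcd.
opaque
  infix 8 _/1+_
  _/1+_ : ℕ → ℕ → ℚ
  j /1+ n = + j / suc n

  /1+-def : ∀ j n → j /1+ n ≡ + j / suc n
  /1+-def j n = refl

1/1+-ι : ∀ n → 1 /1+ n * ι (suc n) ≡ 1ℚ
1/1+-ι n = trans (cong (_* ι (suc n)) (/1+-def 1 n)) (/-ι 1 (suc n))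

0≤/1+ : ∀ j n → 0ℚ ≤ j /1+ n
0≤/1+ j n = subst (0ℚ ≤_) (sym (/1+-def j n)) (nonNegative⁻¹ (+ j / suc n) ⦃ normalize-nonNeg j (suc n) ⦄)

archimedes : ∀ C {ε} → 0ℚ ≤ C → 0ℚ < ε → ∃ λ N → ∀ n → N ℕ.≤ n → C * 1 /1+ n ≤ ε
archimedes C {ε} 0≤C 0<ε = N , λ n N≤n → begin
  C * 1 /1+ n                     ≡⟨ cong (_* 1 /1+ n) eq ⟨
  ε * ε⁻¹C * 1 /1+ n              ≤⟨ *-monoʳ (0≤/1+ 1 n) (*-monoˡ 0≤ε (≤-trans (p≤ι ε⁻¹C) (ι-≤ (ℕ.≤-trans N≤n (ℕ.n≤1+n n))))) ⟩
  ε * ι (suc n) * 1 /1+ n         ≡⟨ solve 3 (λ a b c → a :* b :* c := a :* (c :* b)) refl ε (ι (suc n)) (1 /1+ n) ⟩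
  ε * (1 /1+ n * ι (suc n))         ≡⟨ cong (ε *_) (1/1+-ι n) ⟩
  ε * 1ℚ                                ≡⟨ *-identityʳ ε ⟩
  ε                                     ∎
  where
  open ≤-Reasoning
  0≤ε = <⇒≤ 0<ε
  instance
    posε : Positive ε
    posε = positive 0<ε
    nzε : NonZero ε
    nzε = pos⇒nonZero ε
  ε⁻¹C = 1/ ε * C
  N = ℤ.∣ ↥ ε⁻¹C ∣
  eq : ε * ε⁻¹C ≡ C
  eq = trans (sym (*-assoc ε (1/ ε) C)) (trans (cong (_* C) (*-inverseʳ ε)) (*-identityˡ C))

ι-* : ∀ m n → ι (m ℕ.* n) ≡ ι m * ι n
ι-* zero    n = sym (*-zeroˡ (ι n))
ι-* (suc m) n = begin
  ι (n ℕ.+ m ℕ.* n)       ≡⟨ ι-+ n (m ℕ.* n) ⟩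
  ι n + ι (m ℕ.* n)       ≡⟨ cong (λ u → ι n + u) (ι-* m n) ⟩
  ι n + ι m * ι n         ≡⟨ solve 2 (λ m n → n :+ m :* n := (con 1ℚ :+ m) :* n) refl (ι m) (ι n) ⟩
  (1ℚ + ι m) * ι n        ≡⟨ cong (_* ι n) (ι-+ 1 m) ⟨
  ι (suc m) * ι n         ∎
  where open ≡-Reasoning

/1+≡ι* : ∀ j d → j /1+ d ≡ ι j * 1 /1+ d
/1+≡ι* j d = begin
  j /1+ d                                     ≡⟨ *-identityʳ _ ⟨
  j /1+ d * 1ℚ                                ≡⟨ cong (j /1+ d *_) (1/1+-ι d) ⟨
  j /1+ d * (1 /1+ d * ι (suc d))             ≡⟨ solve 3 (λ a b c → a :* (b :* c) := a :* c :* b) refl (j /1+ d) (1 /1+ d) (ι (suc d)) ⟩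
  j /1+ d * ι (suc d) * 1 /1+ d               ≡⟨ cong (λ u → u * ι (suc d) * 1 /1+ d) (/1+-def j d) ⟩
  + j / suc d * ι (suc d) * 1 /1+ d           ≡⟨ cong (_* 1 /1+ d) (/-ι j (suc d)) ⟩
  ι j * 1 /1+ d                               ∎
  where open ≡-Reasoning

0/1+ : ∀ d → 0 /1+ d ≡ 0ℚ
0/1+ d = trans (/1+-def 0 d) (0/n≡0 (suc d))

suc/ : ∀ j d → suc j /1+ d ≡ j /1+ d + 1 /1+ d
suc/ j d = begin
  suc j /1+ d                                  ≡⟨ /1+≡ι* (suc j) d ⟩
  ι (suc j) * 1 /1+ d                        ≡⟨ cong (_* 1 /1+ d) (ι-+ 1 j) ⟩
  (1ℚ + ι j) * 1 /1+ d                       ≡⟨ solve 2 (λ a b → (con 1ℚ :+ a) :* b := a :* b :+ b) refl (ι j) (1 /1+ d) ⟩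
  ι j * 1 /1+ d + 1 /1+ d                ≡⟨ cong (λ u → u + 1 /1+ d) (/1+≡ι* j d) ⟨
  j /1+ d + 1 /1+ d                        ∎
  where open ≡-Reasoning

*/ : ∀ m d → (m ℕ.* suc d) /1+ d ≡ ι m
*/ m d = begin
  (m ℕ.* suc d) /1+ d                      ≡⟨ /1+≡ι* (m ℕ.* suc d) d ⟩
  ι (m ℕ.* suc d) * 1 /1+ d              ≡⟨ cong (_* 1 /1+ d) (ι-* m (suc d)) ⟩
  ι m * ι (suc d) * 1 /1+ d              ≡⟨ solve 3 (λ a b c → a :* b :* c := a :* (c :* b)) refl (ι m) (ι (suc d)) (1 /1+ d) ⟩
  ι m * (1 /1+ d * ι (suc d))              ≡⟨ cong (ι m *_) (1/1+-ι d) ⟩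
  ι m * 1ℚ                                     ≡⟨ *-identityʳ (ι m) ⟩
  ι m                                          ∎
  where open ≡-Reasoning

-- Real numbers are Cauchy sequences of rationals, taken up to _≃ᴿ_.
-- Arithmetic is termwise.
IsCauchy : (ℕ → ℚ) → Set
IsCauchy s = ∀ ε → 0ℚ < ε → ∃ λ N → ∀ m n → N ℕ.≤ m → N ℕ.≤ n → ∣ s m - s n ∣ ≤ ε

record ℝ : Set where
  constructor mkℝ
  field
    seq    : ℕ → ℚ
    cauchy : IsCauchy seq

open ℝ public

bounded : (x : ℝ) → ∃ λ B → 0ℚ < B × (∀ n → ∣ seq x n ∣ ≤ B)
bounded x with cauchy x 1ℚ 0<1
... | N , close = B , 0<B , bd
  where
  open ≤-Reasoning
  s = ∑ _+_ N (λ k → ∣ seq x k ∣)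
  B = s + 1ℚ
  sum-nonNeg : ∀ n → 0ℚ ≤ ∑ _+_ n (λ k → ∣ seq x k ∣)
  sum-nonNeg zero    = 0≤∣p∣ _
  sum-nonNeg (suc n) = +-nonNeg (sum-nonNeg n) (0≤∣p∣ (seq x (suc n)))
  0<B : 0ℚ < B
  0<B = +-mono-≤-< (sum-nonNeg N) 0<1
  summand : ∀ n j → n ℕ.≤ j → ∣ seq x n ∣ ≤ ∑ _+_ j (λ k → ∣ seq x k ∣)
  summand n zero    ℕ.z≤n = ≤-refl
  summand n (suc j) n≤1+j with ℕ.m≤n⇒m<n∨m≡n n≤1+j
  ... | inj₁ (ℕ.s≤s n≤j) = ≤-trans (summand n j n≤j) (p≤p+q (0≤∣p∣ (seq x (suc j))))
  ... | inj₂ refl        = p≤q+p (sum-nonNeg j)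
  bd : ∀ n → ∣ seq x n ∣ ≤ B
  bd n with ℕ.≤-total n N
  ... | inj₁ n≤N = ≤-trans (summand n N n≤N) (p≤p+q (<⇒≤ 0<1))
  ... | inj₂ N≤n = begin
    ∣ seq x n ∣                                ≡⟨ cong ∣_∣ (x+y-y (seq x N) (seq x n)) ⟨
    ∣ seq x N + (seq x n - seq x N) ∣          ≤⟨ ∣p+q∣≤∣p∣+∣q∣ (seq x N) _ ⟩
    ∣ seq x N ∣ + ∣ seq x n - seq x N ∣        ≤⟨ +-mono-≤ (summand N N ℕ.≤-refl) (close n N N≤n ℕ.≤-refl) ⟩
    B                                          ∎

-- t varies at most C times as much as x and y, up to a vanishing error.
lipschitz : ∀ (x y : ℝ) (t : ℕ → ℚ) C → 0ℚ < C →
  (∀ ε → 0ℚ < ε → ∃ λ N → ∀ m n → N ℕ.≤ m → N ℕ.≤ n →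
    ∣ t m - t n ∣ ≤ C * (∣ seq x m - seq x n ∣ + ∣ seq y m - seq y n ∣) + ε) →
  IsCauchy t
lipschitz x y t C 0<C h ε 0<ε
  with h (½ * ε) (½-pos 0<ε) | shrink C 0<C (½-pos 0<ε)
... | N , hN | δ , 0<δ , Cδ≤ with cauchy x (½ * δ) (½-pos 0<δ) | cauchy y (½ * δ) (½-pos 0<δ)
... | X , hX | Y , hY = N ℕ.⊔ (X ℕ.⊔ Y) , λ m n le-m le-n → begin
  ∣ t m - t n ∣                                                       ≤⟨ hN m n (≤N le-m) (≤N le-n) ⟩
  C * (∣ seq x m - seq x n ∣ + ∣ seq y m - seq y n ∣) + ½ * ε         ≤⟨ +-monoˡ-≤ (½ * ε) (*-monoˡ (<⇒≤ 0<C) (+-mono-≤ (hX m n (≤X le-m) (≤X le-n)) (hY m n (≤Y le-m) (≤Y le-n)))) ⟩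
  C * (½ * δ + ½ * δ) + ½ * ε                                         ≡⟨ cong (λ u → C * u + ½ * ε) (½+½ δ) ⟩
  C * δ + ½ * ε                                                       ≤⟨ +-monoˡ-≤ (½ * ε) Cδ≤ ⟩
  ½ * ε + ½ * ε                                                       ≡⟨ ½+½ ε ⟩
  ε                                                                   ∎
  where
  open ≤-Reasoning
  ≤N : ∀ {m} → N ℕ.⊔ (X ℕ.⊔ Y) ℕ.≤ m → N ℕ.≤ m
  ≤N = ℕ.m⊔n≤o⇒m≤o N _
  ≤X : ∀ {m} → N ℕ.⊔ (X ℕ.⊔ Y) ℕ.≤ m → X ℕ.≤ m
  ≤X h = ℕ.m⊔n≤o⇒m≤o X Y (ℕ.m⊔n≤o⇒n≤o N _ h)
  ≤Y : ∀ {m} → N ℕ.⊔ (X ℕ.⊔ Y) ℕ.≤ m → Y ℕ.≤ m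
  ≤Y h = ℕ.m⊔n≤o⇒n≤o X Y (ℕ.m⊔n≤o⇒n≤o N _ h)

infix  4 _<ᴿ_ _≤ᴿ_ _≃ᴿ_

_≃ᴿ_ _≤ᴿ_ _<ᴿ_ : ℝ → ℝ → Set
x ≃ᴿ y = ∀ ε → 0ℚ < ε → ∃ λ N → ∀ n → N ℕ.≤ n → ∣ seq x n - seq y n ∣ ≤ ε
x ≤ᴿ y = ∀ ε → 0ℚ < ε → ∃ λ N → ∀ n → N ℕ.≤ n → seq x n ≤ seq y n + ε
x <ᴿ y = ∃ λ ε → 0ℚ < ε × ∃ λ N → ∀ n → N ℕ.≤ n → seq x n + ε ≤ seq y n

fromℚᴿ : ℚ → ℝ
fromℚᴿ q = mkℝ (λ _ → q) λ ε 0<ε → 0 , λ _ _ _ _ → subst (λ r → ∣ r ∣ ≤ ε) (sym (+-inverseʳ q)) (<⇒≤ 0<ε)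

infixl 6 _+ᴿ_ _-ᴿ_
infixl 7 _*ᴿ_
infix  8 -ᴿ_

_+ᴿ_ : ℝ → ℝ → ℝ
x +ᴿ y = mkℝ (λ n → seq x n + seq y n) (lipschitz x y (λ n → seq x n + seq y n) 1ℚ 0<1 λ ε 0<ε → 0 , λ m n _ _ → begin
  ∣ (seq x m + seq y m) - (seq x n + seq y n) ∣                    ≡⟨ cong ∣_∣ (solve 4 (λ a b c d → (a :+ b) :- (c :+ d) := (a :- c) :+ (b :- d)) refl (seq x m) (seq y m) (seq x n) (seq y n)) ⟩
  ∣ (seq x m - seq x n) + (seq y m - seq y n) ∣                    ≤⟨ ∣p+q∣≤∣p∣+∣q∣ (seq x m - seq x n) _ ⟩
  ∣ seq x m - seq x n ∣ + ∣ seq y m - seq y n ∣                    ≡⟨ *-identityˡ _ ⟨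
  1ℚ * (∣ seq x m - seq x n ∣ + ∣ seq y m - seq y n ∣)             ≤⟨ p≤p+q (<⇒≤ 0<ε) ⟩
  1ℚ * (∣ seq x m - seq x n ∣ + ∣ seq y m - seq y n ∣) + ε         ∎)
  where open ≤-Reasoning

-ᴿ_ : ℝ → ℝ
-ᴿ x = mkℝ (λ n → - seq x n) λ ε 0<ε → proj₁ (cauchy x ε 0<ε) , λ m n N≤m N≤n →
  subst (_≤ ε) (eq m n) (proj₂ (cauchy x ε 0<ε) m n N≤m N≤n)
  where
  eq : ∀ m n → ∣ seq x m - seq x n ∣ ≡ ∣ - seq x m - - seq x n ∣
  eq m n = trans (∣p-q∣-comm (seq x m) (seq x n)) (cong ∣_∣ (solve 2 (λ a b → b :- a := :- a :- :- b) refl (seq x m) (seq x n)))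

_-ᴿ_ : ℝ → ℝ → ℝ
x -ᴿ y = x +ᴿ -ᴿ y

*-cauchy : ∀ x y → IsCauchy (λ n → seq x n * seq y n)
*-cauchy x y with bounded x | bounded y
... | B , 0<B , x≤B | C , 0<C , y≤C = lipschitz x y (λ n → seq x n * seq y n) (B + C) (+-mono-< 0<B 0<C) λ ε 0<ε → 0 , λ m n _ _ → begin
  ∣ seq x m * seq y m - seq x n * seq y n ∣                                        ≡⟨ cong ∣_∣ (solve 4 (λ a b c d → a :* b :- c :* d := a :* (b :- d) :+ (a :- c) :* d) refl (seq x m) (seq y m) (seq x n) (seq y n)) ⟩
  ∣ seq x m * (seq y m - seq y n) + (seq x m - seq x n) * seq y n ∣                ≤⟨ ∣p+q∣≤∣p∣+∣q∣ (seq x m * (seq y m - seq y n)) _ ⟩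
  ∣ seq x m * (seq y m - seq y n) ∣ + ∣ (seq x m - seq x n) * seq y n ∣            ≡⟨ cong₂ _+_ (∣p*q∣≡∣p∣*∣q∣ (seq x m) _) (∣p*q∣≡∣p∣*∣q∣ (seq x m - seq x n) (seq y n)) ⟩
  ∣ seq x m ∣ * ∣ seq y m - seq y n ∣ + ∣ seq x m - seq x n ∣ * ∣ seq y n ∣        ≤⟨ +-mono-≤ (*-monoʳ (0≤∣p∣ (seq y m - seq y n)) (x≤B m)) (*-monoˡ (0≤∣p∣ (seq x m - seq x n)) (y≤C n)) ⟩
  B * ∣ seq y m - seq y n ∣ + ∣ seq x m - seq x n ∣ * C                            ≤⟨ +-mono-≤ {B * ∣ seq y m - seq y n ∣} (p≤p+q (*-nonNeg (<⇒≤ 0<C) (0≤∣p∣ (seq y m - seq y n)))) (p≤p+q {∣ seq x m - seq x n ∣ * C} (*-nonNeg (<⇒≤ 0<B) (0≤∣p∣ (seq x m - seq x n)))) ⟩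
  B * ∣ seq y m - seq y n ∣ + C * ∣ seq y m - seq y n ∣ + (∣ seq x m - seq x n ∣ * C + B * ∣ seq x m - seq x n ∣) ≡⟨ solve 4 (λ b c v u → b :* v :+ c :* v :+ (u :* c :+ b :* u) := (b :+ c) :* (u :+ v)) refl B C ∣ seq y m - seq y n ∣ ∣ seq x m - seq x n ∣ ⟩
  (B + C) * (∣ seq x m - seq x n ∣ + ∣ seq y m - seq y n ∣)                        ≤⟨ p≤p+q (<⇒≤ 0<ε) ⟩
  (B + C) * (∣ seq x m - seq x n ∣ + ∣ seq y m - seq y n ∣) + ε                    ∎
  where open ≤-Reasoning

_*ᴿ_ : ℝ → ℝ → ℝ
x *ᴿ y = mkℝ (λ n → seq x n * seq y n) (*-cauchy x y)

-- The greatest j ≤ J satisfying P (or 0 if there is none).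
greatest : {P : ℕ → Set} → (∀ j → Dec (P j)) → ℕ → ℕ
greatest P? zero    = zero
greatest P? (suc J) with P? (suc J)
... | yes _ = suc J
... | no  _ = greatest P? J

greatest-holds : ∀ {P : ℕ → Set} (P? : ∀ j → Dec (P j)) J → P 0 → P (greatest P? J)
greatest-holds P? zero    h = h
greatest-holds P? (suc J) h with P? (suc J)
... | yes h′ = h′
... | no  _  = greatest-holds P? J h

greatest-fails : ∀ {P : ℕ → Set} (P? : ∀ j → Dec (P j)) J → ¬ P (suc J) → ¬ P (suc (greatest P? J))
greatest-fails P? zero    h = h
greatest-fails P? (suc J) h with P? (suc J)
... | yes _  = h
... | no  h′ = greatest-fails P? J h′

-- The greatest multiple s of 1/(n+1), up to a bound, with f s ≤ b.
grid : (ℚ → ℚ) → ℚ → ℕ → ℕ → ℕ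
grid f b n J = greatest (λ j → f (j /1+ n) ≤? b) J

grid-lower : ∀ (f : ℚ → ℚ) b n J → f 0ℚ ≤ b → f (grid f b n J /1+ n) ≤ b
grid-lower f b n J h = greatest-holds (λ j → f (j /1+ n) ≤? b) J (subst (λ q → f q ≤ b) (sym (0/1+ n)) h)

grid-upper : ∀ (f : ℚ → ℚ) b n J → b < f (suc J /1+ n) → b < f (suc (grid f b n J) /1+ n)
grid-upper f b n J h = ≰⇒> (greatest-fails (λ j → f (j /1+ n) ≤? b) J (λ le → <-irrefl refl (<-≤-trans h le)))

-- The greatest multiple s of 1/(n+1) with s² ≤ max(0, q).
√approx : ℕ → ℚ → ℚ
√approx n q = grid (λ s → s * s) (0ℚ ⊔ q) n ((ℤ.∣ ↥ (0ℚ ⊔ q) ∣ ℕ.+ 1) ℕ.* suc n) /1+ n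

0≤√approx : ∀ n q → 0ℚ ≤ √approx n q
0≤√approx n q = 0≤/1+ (grid (λ s → s * s) (0ℚ ⊔ q) n ((ℤ.∣ ↥ (0ℚ ⊔ q) ∣ ℕ.+ 1) ℕ.* suc n)) n

√approx-lower : ∀ n q → √approx n q * √approx n q ≤ 0ℚ ⊔ q
√approx-lower n q = grid-lower (λ s → s * s) (0ℚ ⊔ q) n ((ℤ.∣ ↥ (0ℚ ⊔ q) ∣ ℕ.+ 1) ℕ.* suc n) (p≤p⊔q 0ℚ q)

√approx-upper : ∀ n q → q ≤ (√approx n q + 1 /1+ n) * (√approx n q + 1 /1+ n)
√approx-upper n q = ≤-trans (p≤q⊔p 0ℚ q) (<⇒≤ (subst (λ s → 0ℚ ⊔ q < s * s) (suc/ g n) (grid-upper (λ s → s * s) b n ((c ℕ.+ 1) ℕ.* suc n) (begin-strict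
  b                                                                  ≤⟨ p≤ι b ⟩
  ι c                                                                ≡⟨ +-identityˡ (ι c) ⟨
  0ℚ + ι c                                                           <⟨ +-monoˡ-< (ι c) 0<1 ⟩
  1ℚ + ι c                                                           ≡⟨ +-comm 1ℚ (ι c) ⟩
  ι c + 1ℚ                                                           ≡⟨ ι-+ c 1 ⟨
  ι (c ℕ.+ 1)                                                          ≡⟨ *-identityˡ (ι (c ℕ.+ 1)) ⟨
  1ℚ * ι (c ℕ.+ 1)                                                     ≤⟨ *-mono (≤-trans (0≤ι (c ℕ.+ 1)) c≤) (0≤ι (c ℕ.+ 1)) (≤-trans (ι-≤ (ℕ.m≤n+m 1 c)) c≤) c≤ ⟩
  suc ((c ℕ.+ 1) ℕ.* suc n) /1+ n * (suc ((c ℕ.+ 1) ℕ.* suc n) /1+ n)  ∎))))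
  where
  open ≤-Reasoning
  b = 0ℚ ⊔ q
  c = ℤ.∣ ↥ b ∣
  g = grid (λ s → s * s) b n ((c ℕ.+ 1) ℕ.* suc n)
  c≤ : ι (c ℕ.+ 1) ≤ suc ((c ℕ.+ 1) ℕ.* suc n) /1+ n
  c≤ = begin
    ι (c ℕ.+ 1)                                             ≡⟨ */ (c ℕ.+ 1) n ⟨
    ((c ℕ.+ 1) ℕ.* suc n) /1+ n                           ≤⟨ p≤p+q (0≤/1+ 1 n) ⟩
    ((c ℕ.+ 1) ℕ.* suc n) /1+ n + 1 /1+ n             ≡⟨ suc/ ((c ℕ.+ 1) ℕ.* suc n) n ⟨
    suc ((c ℕ.+ 1) ℕ.* suc n) /1+ n                       ∎

square-cancel : ∀ {p q} → 0ℚ ≤ p → 0ℚ ≤ q → p * p ≤ q * q → p ≤ q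
square-cancel {p} {q} 0≤p 0≤q h with p ≤? q
... | yes p≤q = p≤q
... | no  p≰q = contradiction (≤-<-trans h (begin-strict
  q * q  ≤⟨ *-monoˡ 0≤q (<⇒≤ q<p) ⟩
  q * p  <⟨ *-monoˡ-<-pos p ⦃ positive (≤-<-trans 0≤q q<p) ⦄ q<p ⟩
  p * p  ∎)) (<-irrefl refl)
  where
  open ≤-Reasoning
  q<p = ≰⇒> p≰q

√-step : ∀ {s s′ r a a′ η ε} → 0ℚ ≤ s → 0ℚ ≤ s′ → 0ℚ ≤ r → 0ℚ ≤ η →
         s * s ≤ 0ℚ ⊔ a → a′ ≤ (s′ + r) * (s′ + r) → ∣ a - a′ ∣ ≤ η * η →
         r ≤ η → η + η ≡ ε → s ≤ s′ + ε
√-step {s} {s′} {r} {a} {a′} {η} {ε} 0≤s 0≤s′ 0≤r 0≤η lower upper close r≤η η+η = ≤-trans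
  (square-cancel 0≤s 0≤t+η (begin
    s * s                  ≤⟨ lower ⟩
    0ℚ ⊔ a                 ≤⟨ ⊔-lub (*-nonNeg 0≤t+η 0≤t+η) (begin
      a                                  ≤⟨ ≤+∣-∣ a a′ ⟩
      a′ + ∣ a - a′ ∣                    ≤⟨ +-mono-≤ upper close ⟩
      t * t + η * η                      ≤⟨ p≤p+q (*-nonNeg {t * η} {1ℚ + 1ℚ} (*-nonNeg 0≤t 0≤η) (+-nonNeg (<⇒≤ 0<1) (<⇒≤ 0<1))) ⟩
      t * t + η * η + t * η * (1ℚ + 1ℚ)  ≡⟨ solve 2 (λ t η → t :* t :+ η :* η :+ t :* η :* (con 1ℚ :+ con 1ℚ) := (t :+ η) :* (t :+ η)) refl t η ⟩
      (t + η) * (t + η)                  ∎) ⟩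
    (t + η) * (t + η)      ∎))
  (begin
    s′ + r + η      ≤⟨ +-monoˡ-≤ η (+-monoʳ-≤ s′ r≤η) ⟩
    s′ + η + η      ≡⟨ +-assoc s′ η η ⟩
    s′ + (η + η)    ≡⟨ cong (λ u → s′ + u) η+η ⟩
    s′ + ε          ∎)
  where
  open ≤-Reasoning
  t = s′ + r
  0≤t : 0ℚ ≤ t
  0≤t = +-nonNeg 0≤s′ 0≤r
  0≤t+η : 0ℚ ≤ t + η
  0≤t+η = +-nonNeg 0≤t 0≤η

1/1+-small : ∀ {ε} → 0ℚ < ε → ∃ λ N → ∀ n → N ℕ.≤ n → 1 /1+ n ≤ ε
1/1+-small {ε} 0<ε = proj₁ h , λ n N≤n → subst (_≤ ε) (*-identityˡ (1 /1+ n)) (proj₂ h n N≤n)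
  where h = archimedes 1ℚ (<⇒≤ 0<1) 0<ε

1/1+≤1 : ∀ n → 1 /1+ n ≤ 1ℚ
1/1+≤1 n = begin
  1 /1+ n                ≡⟨ *-identityʳ (1 /1+ n) ⟨
  1 /1+ n * 1ℚ           ≤⟨ *-monoˡ (0≤/1+ 1 n) (ι-≤ {1} {suc n} (ℕ.s≤s ℕ.z≤n)) ⟩
  1 /1+ n * ι (suc n)    ≡⟨ 1/1+-ι n ⟩
  1ℚ                     ∎
  where open ≤-Reasoning

√-cauchy : ∀ x → IsCauchy (λ n → √approx n (seq x n))
√-cauchy x ε 0<ε = M ℕ.⊔ N , λ m n le-m le-n → ∣-∣≤
    (half m n (≤M le-n) (hN m n (≤N le-m) (≤N le-n)))
    (half n m (≤M le-m) (hN n m (≤N le-n) (≤N le-m)))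
  where
  η = ½ * ε
  0<η = ½-pos 0<ε
  0<η² : 0ℚ < η * η
  0<η² = positive⁻¹ (η * η) ⦃ pos*pos⇒pos η ⦃ positive 0<η ⦄ η ⦃ positive 0<η ⦄ ⦄
  M  = proj₁ (1/1+-small 0<η)
  hM = proj₂ (1/1+-small 0<η)
  N  = proj₁ (cauchy x (η * η) 0<η²)
  hN = proj₂ (cauchy x (η * η) 0<η²)
  ≤M : ∀ {m} → M ℕ.⊔ N ℕ.≤ m → M ℕ.≤ m
  ≤M = ℕ.m⊔n≤o⇒m≤o M N
  ≤N : ∀ {m} → M ℕ.⊔ N ℕ.≤ m → N ℕ.≤ m
  ≤N = ℕ.m⊔n≤o⇒n≤o M N
  half : ∀ m n → M ℕ.≤ n → ∣ seq x m - seq x n ∣ ≤ η * η →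
         √approx m (seq x m) ≤ √approx n (seq x n) + ε
  half m n M≤n close = √-step {a = seq x m} {a′ = seq x n} (0≤√approx m (seq x m)) (0≤√approx n (seq x n)) (0≤/1+ 1 n) (<⇒≤ 0<η)
    (√approx-lower m (seq x m)) (√approx-upper n (seq x n)) close (hM n M≤n) (½+½ ε)

-- Extended by 0 to negative arguments; see √-square below.
√ : ℝ → ℝ
√ x = mkℝ (λ n → √approx n (seq x n)) (√-cauchy x)

√-square : ∀ x → (∀ n → 0ℚ ≤ seq x n) → √ x *ᴿ √ x ≃ᴿ x
√-square x 0≤x ε 0<ε = proj₁ N , λ n N≤n → √-square-step (0≤√approx n (seq x n)) (≤B n) (0≤/1+ 1 n) (1/1+≤1 n)
  (≤-trans (√approx-lower n (seq x n)) (≤-reflexive (p≤q⇒p⊔q≡q (0≤x n)))) (√approx-upper n (seq x n)) (proj₂ N n N≤n) (<⇒≤ 0<ε)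
  where
  B   = proj₁ (bounded (√ x))
  0<B = proj₁ (proj₂ (bounded (√ x)))
  ≤B : ∀ n → √approx n (seq x n) ≤ B
  ≤B n = ≤-trans (p≤∣p∣ (√approx n (seq x n))) (proj₂ (proj₂ (bounded (√ x))) n)
  N = archimedes (B + B + 1ℚ) (+-nonNeg (+-nonNeg (<⇒≤ 0<B) (<⇒≤ 0<B)) (<⇒≤ 0<1)) 0<ε
  √-square-step : ∀ {s B r a ε} → 0ℚ ≤ s → s ≤ B → 0ℚ ≤ r → r ≤ 1ℚ → s * s ≤ a → a ≤ (s + r) * (s + r) →
                  (B + B + 1ℚ) * r ≤ ε → 0ℚ ≤ ε → ∣ s * s - a ∣ ≤ ε
  √-square-step {s} {B} {r} {a} {ε} 0≤s s≤B 0≤r r≤1 lower upper small 0≤ε = ∣-∣≤ (≤-trans lower (p≤p+q 0≤ε)) (begin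
    a                              ≤⟨ upper ⟩
    (s + r) * (s + r)              ≡⟨ solve 2 (λ s r → (s :+ r) :* (s :+ r) := s :* s :+ (s :+ s :+ r) :* r) refl s r ⟩
    s * s + (s + s + r) * r        ≤⟨ +-monoʳ-≤ (s * s) (≤-trans (*-monoʳ 0≤r (+-mono-≤ (+-mono-≤ s≤B s≤B) r≤1)) small) ⟩
    s * s + ε                      ∎)
    where open ≤-Reasoning

infix  4 _≃ᶜ_
infixl 6 _+ᶜ_ _-ᶜ_
infixl 7 _*ᶜ_
infix  8 -ᶜ_
infixr 8 _^ᶜ_

record ℂ : Set where
  constructor _+i_
  field
    re im : ℝ

open ℂ public

0ᴿ : ℝ
0ᴿ = fromℚᴿ 0ℚ

fromℚᶜ : ℚ → ℂ
fromℚᶜ q = fromℚᴿ q +i 0ᴿ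

_≃ᶜ_ : ℂ → ℂ → Set
z ≃ᶜ w = re z ≃ᴿ re w × im z ≃ᴿ im w

_+ᶜ_ _-ᶜ_ _*ᶜ_ : ℂ → ℂ → ℂ
z +ᶜ w = (re z +ᴿ re w) +i (im z +ᴿ im w)
z -ᶜ w = (re z -ᴿ re w) +i (im z -ᴿ im w)
z *ᶜ w = (re z *ᴿ re w -ᴿ im z *ᴿ im w) +i (re z *ᴿ im w +ᴿ im z *ᴿ re w)

-ᶜ_ : ℂ → ℂ
-ᶜ z = (-ᴿ re z) +i (-ᴿ im z)

_^ᶜ_ : ℂ → ℕ → ℂ
z ^ᶜ zero  = fromℚᶜ 1ℚ
z ^ᶜ suc n = z *ᶜ z ^ᶜ n

∣_∣ᶜ : ℂ → ℝ
∣ z ∣ᶜ = √ (re z *ᴿ re z +ᴿ im z *ᴿ im z)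


-- D q k = qᵏ / k! and E n q = Σ_{k ≤ n} qᵏ / k!; Dᴳ and Eᴳ are the same over
-- 𝔾 = ℚ(i), whose elements a + b i are written (a , b).
D : ℚ → ℕ → ℚ
D q k = 1/! k * q ^ k

E : ℕ → ℚ → ℚ
E n q = ∑ _+_ n (D q)

𝔾 : Set
𝔾 = ℚ × ℚ

infixl 6 _+ᴳ_ _-ᴳ_
infixl 7 _*ᴳ_ _•_
infixr 8 _^ᴳ_

_+ᴳ_ _-ᴳ_ _*ᴳ_ : 𝔾 → 𝔾 → 𝔾
(a , b) +ᴳ (c , d) = a + c , b + d
(a , b) -ᴳ (c , d) = a - c , b - d
(a , b) *ᴳ (c , d) = a * c - b * d , a * d + b * c

_•_ : ℚ → 𝔾 → 𝔾
q • (a , b) = q * a , q * b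

_^ᴳ_ : 𝔾 → ℕ → 𝔾
u ^ᴳ zero  = 1ℚ , 0ℚ
u ^ᴳ suc k = u *ᴳ u ^ᴳ k

Dᴳ : 𝔾 → ℕ → 𝔾
Dᴳ u k = 1/! k • u ^ᴳ k

Eᴳ : ℕ → 𝔾 → 𝔾
Eᴳ n u = ∑ _+ᴳ_ n (Dᴳ u)

1/!-ι : ∀ k → 1/! k * ι (k !) ≡ 1ℚ
1/!-ι k = /-ι 1 (k !) ⦃ k ℕ.!≢0 ⦄

0≤1/! : ∀ k → 0ℚ ≤ 1/! k
0≤1/! k = nonNegative⁻¹ (1/! k) ⦃ normalize-nonNeg 1 (k !) ⦃ k ℕ.!≢0 ⦄ ⦄

1/!-suc : ∀ k → 1/! (suc k) ≡ 1 /1+ k * 1/! k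
1/!-suc k = lemma (1/! (suc k)) (1 /1+ k) (1/! k) (ι (suc k)) (ι (k !))
                  (trans (cong (1/! (suc k) *_) (sym (ι-* (suc k) (k !)))) (1/!-ι (suc k))) (1/1+-ι k) (1/!-ι k)
  where
  lemma : ∀ a b c m f → a * (m * f) ≡ 1ℚ → b * m ≡ 1ℚ → c * f ≡ 1ℚ → a ≡ b * c
  lemma a b c m f h₁ h₂ h₃ = begin
    a                            ≡⟨ solve 1 (λ a → a := a :* con 1ℚ :* con 1ℚ) refl a ⟩
    a * 1ℚ * 1ℚ                  ≡⟨ cong₂ (λ u v → a * u * v) h₂ h₃ ⟨
    a * (b * m) * (c * f)        ≡⟨ solve 5 (λ a b c m f → a :* (b :* m) :* (c :* f) := a :* (m :* f) :* (b :* c)) refl a b c m f ⟩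
    a * (m * f) * (b * c)        ≡⟨ cong (_* (b * c)) h₁ ⟩
    1ℚ * (b * c)                 ≡⟨ *-identityˡ (b * c) ⟩
    b * c                        ∎
    where open ≡-Reasoning

D-suc : ∀ q k → D q (suc k) ≡ 1 /1+ k * (q * D q k)
D-suc q k = trans (cong (_* (q * q ^ k)) (1/!-suc k))
  (solve 4 (λ a b q p → a :* b :* (q :* p) := a :* (q :* (b :* p))) refl (1 /1+ k) (1/! k) q (q ^ k))

0≤^ : ∀ {q} → 0ℚ ≤ q → ∀ k → 0ℚ ≤ q ^ k
0≤^ 0≤q zero    = <⇒≤ 0<1
0≤^ 0≤q (suc k) = *-nonNeg 0≤q (0≤^ 0≤q k)

0≤D : ∀ {q} → 0ℚ ≤ q → ∀ k → 0ℚ ≤ D q k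
0≤D 0≤q k = *-nonNeg (0≤1/! k) (0≤^ 0≤q k)

^-mono : ∀ {p q} → 0ℚ ≤ p → p ≤ q → ∀ k → p ^ k ≤ q ^ k
^-mono 0≤p p≤q zero    = ≤-refl
^-mono 0≤p p≤q (suc k) = *-mono (≤-trans 0≤p p≤q) (0≤^ 0≤p k) p≤q (^-mono 0≤p p≤q k)

D-mono : ∀ {p q} → 0ℚ ≤ p → p ≤ q → ∀ k → D p k ≤ D q k
D-mono 0≤p p≤q k = *-monoˡ (0≤1/! k) (^-mono 0≤p p≤q k)

≤-induction : ∀ {n} (P : ℕ → Set) → P n → (∀ m → n ℕ.≤ m → P m → P (suc m)) → ∀ m → n ℕ.≤ m → P m
≤-induction {n} P base step m n≤m = go (ℕ.≤⇒≤′ n≤m)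
  where
  go : ∀ {m} → n ℕ.≤′ m → P m
  go (ℕ.≤′-reflexive refl) = base
  go (ℕ.≤′-step h)         = step _ (ℕ.≤′⇒≤ h) (go h)

E-mono-n : ∀ {q} → 0ℚ ≤ q → ∀ {n m} → n ℕ.≤ m → E n q ≤ E m q
E-mono-n {q} 0≤q {n} {m} n≤m = ≤-induction (λ m → E n q ≤ E m q) ≤-refl
  (λ m _ h → ≤-trans h (p≤p+q (0≤D 0≤q (suc m)))) m n≤m

0≤E : ∀ {q} → 0ℚ ≤ q → ∀ n → 0ℚ ≤ E n q
0≤E 0≤q n = ≤-trans (0≤D 0≤q 0) (E-mono-n 0≤q {0} {n} ℕ.z≤n)

module Tail (R : ℚ) (0≤R : 0ℚ ≤ R) where
  open ≤-Reasoning

  K : ℕ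
  K = ℤ.∣ ↥ (R + R) ∣

  R/ : ∀ k → K ℕ.≤ k → 1 /1+ k * R ≤ ½
  R/ k K≤k = begin
    1 /1+ k * R                         ≡⟨ solve 2 (λ a r → a :* r := con ½ :* (a :* (r :+ r))) refl (1 /1+ k) R ⟩
    ½ * (1 /1+ k * (R + R))             ≤⟨ *-monoˡ (nonNegative⁻¹ ½) (*-monoˡ (0≤/1+ 1 k) (≤-trans (p≤ι (R + R)) (ι-≤ (ℕ.≤-trans K≤k (ℕ.n≤1+n k))))) ⟩
    ½ * (1 /1+ k * ι (suc k))           ≡⟨ cong (½ *_) (1/1+-ι k) ⟩
    ½ * 1ℚ                              ≡⟨ *-identityʳ ½ ⟩
    ½                                   ∎

  D-half : ∀ k → K ℕ.≤ k → D R (suc k) ≤ ½ * D R k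
  D-half k K≤k = begin
    D R (suc k)                 ≡⟨ D-suc R k ⟩
    1 /1+ k * (R * D R k)       ≡⟨ *-assoc (1 /1+ k) R (D R k) ⟨
    1 /1+ k * R * D R k         ≤⟨ *-monoʳ (0≤D 0≤R k) (R/ k K≤k) ⟩
    ½ * D R k                   ∎

  D-double : ∀ k → K ℕ.≤ k → D R (suc k) + D R (suc k) ≤ D R k
  D-double k K≤k = ≤-trans (+-mono-≤ (D-half k K≤k) (D-half k K≤k)) (≤-reflexive (½+½ (D R k)))

  G : ℕ → ℚ
  G n = E n R + D R n

  G-anti : ∀ {n} m → K ℕ.≤ n → n ℕ.≤ m → G m ≤ G n
  G-anti {n} m K≤n n≤m = ≤-induction (λ m → G m ≤ G n) ≤-refl (λ m n≤m h → begin
    E m R + D R (suc m) + D R (suc m)    ≡⟨ +-assoc (E m R) (D R (suc m)) (D R (suc m)) ⟩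
    E m R + (D R (suc m) + D R (suc m))  ≤⟨ +-monoʳ-≤ (E m R) (D-double m (ℕ.≤-trans K≤n n≤m)) ⟩
    E m R + D R m                        ≤⟨ h ⟩
    G n                                  ∎) m n≤m

  C : ℚ
  C = G K

  E≤C : ∀ m → E m R ≤ C
  E≤C m = begin
    E m R          ≤⟨ E-mono-n 0≤R (ℕ.m≤n⊔m K m) ⟩
    E (K ℕ.⊔ m) R  ≤⟨ p≤p+q (0≤D 0≤R (K ℕ.⊔ m)) ⟩
    G (K ℕ.⊔ m)    ≤⟨ G-anti (K ℕ.⊔ m) ℕ.≤-refl (ℕ.m≤m⊔n K m) ⟩
    C              ∎

  0<C : 0ℚ < C
  0<C = <-≤-trans 0<1 (E≤C 0)

  ιD≤ : ∀ k → K ℕ.≤ k → ι (suc k) * D R k ≤ ι (suc K) * D R K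
  ιD≤ = ≤-induction (λ k → ι (suc k) * D R k ≤ ι (suc K) * D R K) ≤-refl (λ k K≤k h → begin
    ι (suc (suc k)) * D R (suc k)                     ≤⟨ *-monoʳ (0≤D 0≤R (suc k)) (ι-2+ k) ⟩
    (ι (suc k) + ι (suc k)) * D R (suc k)             ≡⟨ solve 2 (λ a b → (a :+ a) :* b := a :* (b :+ b)) refl (ι (suc k)) (D R (suc k)) ⟩
    ι (suc k) * (D R (suc k) + D R (suc k))           ≤⟨ *-monoˡ (0≤ι (suc k)) (D-double k K≤k) ⟩
    ι (suc k) * D R k                                 ≤⟨ h ⟩
    ι (suc K) * D R K                                 ∎)
    where
    ι-2+ : ∀ k → ι (suc (suc k)) ≤ ι (suc k) + ι (suc k)
    ι-2+ k = ≤-trans (ι-≤ (ℕ.s≤s (ℕ.m≤n+m (suc k) k))) (≤-reflexive (ι-+ (suc k) (suc k)))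

  D≤ : ∀ k → K ℕ.≤ k → D R k ≤ ι (suc K) * D R K * 1 /1+ k
  D≤ k K≤k = begin
    D R k                              ≡⟨ *-identityˡ (D R k) ⟨
    1ℚ * D R k                         ≡⟨ cong (_* D R k) (1/1+-ι k) ⟨
    1 /1+ k * ι (suc k) * D R k        ≡⟨ solve 3 (λ a b c → a :* b :* c := (b :* c) :* a) refl (1 /1+ k) (ι (suc k)) (D R k) ⟩
    ι (suc k) * D R k * 1 /1+ k        ≤⟨ *-monoʳ (0≤/1+ 1 k) (ιD≤ k K≤k) ⟩
    ι (suc K) * D R K * 1 /1+ k        ∎

  D-small : ∀ {ε} → 0ℚ < ε → ∃ λ N → ∀ n → N ℕ.≤ n → D R n ≤ ε
  D-small {ε} 0<ε = K ℕ.⊔ proj₁ h , λ n le → ≤-trans (D≤ n (ℕ.m⊔n≤o⇒m≤o K (proj₁ h) le)) (proj₂ h n (ℕ.m⊔n≤o⇒n≤o K (proj₁ h) le))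
    where h = archimedes (ι (suc K) * D R K) (*-nonNeg (0≤ι (suc K)) (0≤D 0≤R K)) 0<ε

  E-tail : ∀ {ε} → 0ℚ < ε → ∃ λ N → ∀ {n m} → N ℕ.≤ n → n ℕ.≤ m → E m R ≤ E n R + ε
  E-tail {ε} 0<ε = K ℕ.⊔ proj₁ h , λ {n} {m} le n≤m → begin
    E m R          ≤⟨ p≤p+q (0≤D 0≤R m) ⟩
    G m            ≤⟨ G-anti m (ℕ.m⊔n≤o⇒m≤o K (proj₁ h) le) n≤m ⟩
    E n R + D R n  ≤⟨ +-monoʳ-≤ (E n R) (proj₂ h n (ℕ.m⊔n≤o⇒n≤o K (proj₁ h) le)) ⟩
    E n R + ε      ∎
    where h = D-small 0<ε
‖_‖ : 𝔾 → ℚ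
‖ a , b ‖ = ∣ a ∣ + ∣ b ∣

0≤‖‖ : ∀ u → 0ℚ ≤ ‖ u ‖
0≤‖‖ (a , b) = +-nonNeg (0≤∣p∣ a) (0≤∣p∣ b)

‖+‖ : ∀ u v → ‖ u +ᴳ v ‖ ≤ ‖ u ‖ + ‖ v ‖
‖+‖ (a , b) (c , d) = ≤-trans (+-mono-≤ (∣p+q∣≤∣p∣+∣q∣ a c) (∣p+q∣≤∣p∣+∣q∣ b d))
  (≤-reflexive (solve 4 (λ a b c d → a :+ c :+ (b :+ d) := a :+ b :+ (c :+ d)) refl (∣ a ∣) (∣ b ∣) (∣ c ∣) (∣ d ∣)))

‖•‖ : ∀ {q} → 0ℚ ≤ q → ∀ u → ‖ q • u ‖ ≡ q * ‖ u ‖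
‖•‖ {q} 0≤q (a , b) = begin
  ∣ q * a ∣ + ∣ q * b ∣            ≡⟨ cong₂ _+_ (∣p*q∣≡∣p∣*∣q∣ q a) (∣p*q∣≡∣p∣*∣q∣ q b) ⟩
  ∣ q ∣ * ∣ a ∣ + ∣ q ∣ * ∣ b ∣    ≡⟨ cong (λ r → r * ∣ a ∣ + r * ∣ b ∣) (0≤p⇒∣p∣≡p 0≤q) ⟩
  q * ∣ a ∣ + q * ∣ b ∣            ≡⟨ *-distribˡ-+ q (∣ a ∣) (∣ b ∣) ⟨
  q * (∣ a ∣ + ∣ b ∣)              ∎
  where open ≡-Reasoning

‖*‖ : ∀ u v → ‖ u *ᴳ v ‖ ≤ ‖ u ‖ * ‖ v ‖
‖*‖ (a , b) (c , d) = begin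
  ∣ a * c - b * d ∣ + ∣ a * d + b * c ∣                              ≤⟨ +-mono-≤ (∣p-q∣≤∣p∣+∣q∣ (a * c) (b * d)) (∣p+q∣≤∣p∣+∣q∣ (a * d) (b * c)) ⟩
  ∣ a * c ∣ + ∣ b * d ∣ + (∣ a * d ∣ + ∣ b * c ∣)                    ≡⟨ cong₂ _+_ (cong₂ _+_ (∣p*q∣≡∣p∣*∣q∣ a c) (∣p*q∣≡∣p∣*∣q∣ b d)) (cong₂ _+_ (∣p*q∣≡∣p∣*∣q∣ a d) (∣p*q∣≡∣p∣*∣q∣ b c)) ⟩
  ∣ a ∣ * ∣ c ∣ + ∣ b ∣ * ∣ d ∣ + (∣ a ∣ * ∣ d ∣ + ∣ b ∣ * ∣ c ∣)    ≡⟨ solve 4 (λ a b c d → a :* c :+ b :* d :+ (a :* d :+ b :* c) := (a :+ b) :* (c :+ d)) refl (∣ a ∣) (∣ b ∣) (∣ c ∣) (∣ d ∣) ⟩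
  (∣ a ∣ + ∣ b ∣) * (∣ c ∣ + ∣ d ∣)                                  ∎
  where open ≤-Reasoning

*ᴳ-telescope : ∀ u u′ v v′ → u *ᴳ v -ᴳ u′ *ᴳ v′ ≡ u *ᴳ (v -ᴳ v′) +ᴳ (u -ᴳ u′) *ᴳ v′
*ᴳ-telescope (a , b) (a′ , b′) (c , d) (c′ , d′) = cong₂ _,_
  (solve 8 (λ a b a′ b′ c d c′ d′ → (a :* c :- b :* d) :- (a′ :* c′ :- b′ :* d′) := (a :* (c :- c′) :- b :* (d :- d′)) :+ ((a :- a′) :* c′ :- (b :- b′) :* d′)) refl a b a′ b′ c d c′ d′)
  (solve 8 (λ a b a′ b′ c d c′ d′ → (a :* d :+ b :* c) :- (a′ :* d′ :+ b′ :* c′) := (a :* (d :- d′) :+ b :* (c :- c′)) :+ ((a :- a′) :* d′ :+ (b :- b′) :* c′)) refl a b a′ b′ c d c′ d′)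

Dᴳ-suc : ∀ u k → Dᴳ u (suc k) ≡ 1 /1+ k • (u *ᴳ Dᴳ u k)
Dᴳ-suc u@(a , b) k = trans (cong (_• (u *ᴳ u ^ᴳ k)) (1/!-suc k)) (lemma (1 /1+ k) (1/! k) (u ^ᴳ k))
  where
  lemma : ∀ p q v → (p * q) • (u *ᴳ v) ≡ p • (u *ᴳ (q • v))
  lemma p q (c , d) = cong₂ _,_
    (solve 6 (λ p q a b c d → p :* q :* (a :* c :- b :* d) := p :* (a :* (q :* c) :- b :* (q :* d))) refl p q a b c d)
    (solve 6 (λ p q a b c d → p :* q :* (a :* d :+ b :* c) := p :* (a :* (q :* d) :+ b :* (q :* c))) refl p q a b c d)

‖Dᴳ‖≤ : ∀ u {B} → ‖ u ‖ ≤ B → ∀ k → ‖ Dᴳ u k ‖ ≤ D B k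
‖Dᴳ‖≤ u {B} u≤B zero = ≤-refl
‖Dᴳ‖≤ u {B} u≤B (suc k) = begin
  ‖ Dᴳ u (suc k) ‖                 ≡⟨ cong ‖_‖ (Dᴳ-suc u k) ⟩
  ‖ 1 /1+ k • (u *ᴳ Dᴳ u k) ‖      ≡⟨ ‖•‖ (0≤/1+ 1 k) (u *ᴳ Dᴳ u k) ⟩
  1 /1+ k * ‖ u *ᴳ Dᴳ u k ‖        ≤⟨ *-monoˡ (0≤/1+ 1 k) (‖*‖ u (Dᴳ u k)) ⟩
  1 /1+ k * (‖ u ‖ * ‖ Dᴳ u k ‖)   ≤⟨ *-monoˡ (0≤/1+ 1 k) (*-mono (≤-trans (0≤‖‖ u) u≤B) (0≤‖‖ (Dᴳ u k)) u≤B (‖Dᴳ‖≤ u u≤B k)) ⟩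
  1 /1+ k * (B * D B k)            ≡⟨ D-suc B k ⟨
  D B (suc k)                      ∎
  where open ≤-Reasoning

-- The constant is not optimal: k Bᵏ⁻¹ / k! is bounded by (2B)ᵏ / k!.
‖Dᴳ-Dᴳ‖≤ : ∀ u v {B} → 1ℚ ≤ B → ‖ u ‖ ≤ B → ‖ v ‖ ≤ B → ∀ k →
            ‖ Dᴳ u k -ᴳ Dᴳ v k ‖ ≤ D (B + B) k * ‖ u -ᴳ v ‖
‖Dᴳ-Dᴳ‖≤ u v {B} 1≤B u≤B v≤B zero = *-nonNeg (0≤D {B + B} (+-nonNeg 0≤B 0≤B) 0) (0≤‖‖ (u -ᴳ v))
  where 0≤B = ≤-trans (<⇒≤ 0<1) 1≤B
‖Dᴳ-Dᴳ‖≤ u v {B} 1≤B u≤B v≤B (suc k) = begin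
  ‖ Dᴳ u (suc k) -ᴳ Dᴳ v (suc k) ‖                                          ≡⟨ cong ‖_‖ (trans (cong₂ _-ᴳ_ (Dᴳ-suc u k) (Dᴳ-suc v k)) (•-distrib r (u *ᴳ Dᴳ u k) (v *ᴳ Dᴳ v k))) ⟩
  ‖ r • (u *ᴳ Dᴳ u k -ᴳ v *ᴳ Dᴳ v k) ‖                                      ≡⟨ ‖•‖ 0≤r (u *ᴳ Dᴳ u k -ᴳ v *ᴳ Dᴳ v k) ⟩
  r * ‖ u *ᴳ Dᴳ u k -ᴳ v *ᴳ Dᴳ v k ‖                                        ≡⟨ cong (λ w → r * ‖ w ‖) (*ᴳ-telescope u v (Dᴳ u k) (Dᴳ v k)) ⟩
  r * ‖ u *ᴳ (Dᴳ u k -ᴳ Dᴳ v k) +ᴳ (u -ᴳ v) *ᴳ Dᴳ v k ‖                     ≤⟨ *-monoˡ 0≤r (‖+‖ (u *ᴳ (Dᴳ u k -ᴳ Dᴳ v k)) ((u -ᴳ v) *ᴳ Dᴳ v k)) ⟩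
  r * (‖ u *ᴳ (Dᴳ u k -ᴳ Dᴳ v k) ‖ + ‖ (u -ᴳ v) *ᴳ Dᴳ v k ‖)                ≤⟨ *-monoˡ 0≤r (+-mono-≤ (‖*‖ u (Dᴳ u k -ᴳ Dᴳ v k)) (‖*‖ (u -ᴳ v) (Dᴳ v k))) ⟩
  r * (‖ u ‖ * ‖ Dᴳ u k -ᴳ Dᴳ v k ‖ + δ * ‖ Dᴳ v k ‖)                       ≤⟨ *-monoˡ 0≤r (+-mono-≤ (*-mono 0≤B (0≤‖‖ (Dᴳ u k -ᴳ Dᴳ v k)) u≤B (‖Dᴳ-Dᴳ‖≤ u v 1≤B u≤B v≤B k)) (*-monoˡ 0≤δ (≤-trans (‖Dᴳ‖≤ v v≤B k) (D-mono 0≤B (p≤p+q 0≤B) k)))) ⟩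
  r * (B * (D (B + B) k * δ) + δ * D (B + B) k)                             ≡⟨ cong (λ x → r * (B * (D (B + B) k * δ) + x)) (trans (*-comm δ (D (B + B) k)) (sym (*-identityˡ _))) ⟩
  r * (B * (D (B + B) k * δ) + 1ℚ * (D (B + B) k * δ))                      ≤⟨ *-monoˡ 0≤r (+-monoʳ-≤ (B * (D (B + B) k * δ)) (*-monoʳ (*-nonNeg (0≤D (+-nonNeg 0≤B 0≤B) k) 0≤δ) 1≤B)) ⟩
  r * (B * (D (B + B) k * δ) + B * (D (B + B) k * δ))                       ≡⟨ solve 4 (λ r b d e → r :* (b :* (d :* e) :+ b :* (d :* e)) := r :* ((b :+ b) :* d) :* e) refl r B (D (B + B) k) δ ⟩
  r * ((B + B) * D (B + B) k) * δ                                           ≡⟨ cong (_* δ) (D-suc (B + B) k) ⟨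
  D (B + B) (suc k) * δ                                                     ∎
  where
  open ≤-Reasoning
  r = 1 /1+ k
  0≤r = 0≤/1+ 1 k
  δ = ‖ u -ᴳ v ‖
  0≤δ = 0≤‖‖ (u -ᴳ v)
  0≤B = ≤-trans (<⇒≤ 0<1) 1≤B
  •-distrib : ∀ r x y → r • x -ᴳ r • y ≡ r • (x -ᴳ y)
  •-distrib r (a , b) (c , d) = cong₂ _,_ (eq r a c) (eq r b d)
    where eq = solve 3 (λ r a c → r :* a :- r :* c := r :* (a :- c)) refl

‖Eᴳ-Eᴳ‖≤ : ∀ u v {B} → 1ℚ ≤ B → ‖ u ‖ ≤ B → ‖ v ‖ ≤ B → ∀ n →
            ‖ Eᴳ n u -ᴳ Eᴳ n v ‖ ≤ E n (B + B) * ‖ u -ᴳ v ‖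
‖Eᴳ-Eᴳ‖≤ u v 1≤B u≤B v≤B zero = ‖Dᴳ-Dᴳ‖≤ u v 1≤B u≤B v≤B 0
‖Eᴳ-Eᴳ‖≤ u v {B} 1≤B u≤B v≤B (suc n) = begin
  ‖ (Eᴳ n u +ᴳ Dᴳ u (suc n)) -ᴳ (Eᴳ n v +ᴳ Dᴳ v (suc n)) ‖     ≡⟨ cong ‖_‖ (rearrange (Eᴳ n u) (Dᴳ u (suc n)) (Eᴳ n v) (Dᴳ v (suc n))) ⟩
  ‖ (Eᴳ n u -ᴳ Eᴳ n v) +ᴳ (Dᴳ u (suc n) -ᴳ Dᴳ v (suc n)) ‖     ≤⟨ ‖+‖ (Eᴳ n u -ᴳ Eᴳ n v) (Dᴳ u (suc n) -ᴳ Dᴳ v (suc n)) ⟩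
  ‖ Eᴳ n u -ᴳ Eᴳ n v ‖ + ‖ Dᴳ u (suc n) -ᴳ Dᴳ v (suc n) ‖      ≤⟨ +-mono-≤ (‖Eᴳ-Eᴳ‖≤ u v 1≤B u≤B v≤B n) (‖Dᴳ-Dᴳ‖≤ u v 1≤B u≤B v≤B (suc n)) ⟩
  E n (B + B) * δ + D (B + B) (suc n) * δ                      ≡⟨ *-distribʳ-+ δ (E n (B + B)) (D (B + B) (suc n)) ⟨
  E (suc n) (B + B) * δ                                        ∎
  where
  open ≤-Reasoning
  δ = ‖ u -ᴳ v ‖
  rearrange : ∀ a b c d → (a +ᴳ b) -ᴳ (c +ᴳ d) ≡ (a -ᴳ c) +ᴳ (b -ᴳ d)
  rearrange (a , a′) (b , b′) (c , c′) (d , d′) = cong₂ _,_ (eq a b c d) (eq a′ b′ c′ d′)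
    where eq = solve 4 (λ a b c d → (a :+ b) :- (c :+ d) := (a :- c) :+ (b :- d)) refl

‖Eᴳ-tail‖ : ∀ u {B} → ‖ u ‖ ≤ B → ∀ {n} m → n ℕ.≤ m → ‖ Eᴳ m u -ᴳ Eᴳ n u ‖ + E n B ≤ E m B
‖Eᴳ-tail‖ u {B} u≤B {n} m n≤m = ≤-induction (λ m → ‖ Eᴳ m u -ᴳ Eᴳ n u ‖ + E n B ≤ E m B)
  (≤-reflexive (trans (cong (λ w → ‖ w ‖ + E n B) (cancel (Eᴳ n u))) (+-identityˡ (E n B))))
  (λ m _ h → begin
    ‖ (Eᴳ m u +ᴳ Dᴳ u (suc m)) -ᴳ Eᴳ n u ‖ + E n B           ≡⟨ cong (λ w → ‖ w ‖ + E n B) (swap (Eᴳ m u) (Dᴳ u (suc m)) (Eᴳ n u)) ⟩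
    ‖ (Eᴳ m u -ᴳ Eᴳ n u) +ᴳ Dᴳ u (suc m) ‖ + E n B           ≤⟨ +-monoˡ-≤ (E n B) (‖+‖ (Eᴳ m u -ᴳ Eᴳ n u) (Dᴳ u (suc m))) ⟩
    ‖ Eᴳ m u -ᴳ Eᴳ n u ‖ + ‖ Dᴳ u (suc m) ‖ + E n B          ≡⟨ solve 3 (λ a b c → a :+ b :+ c := a :+ c :+ b) refl (‖ Eᴳ m u -ᴳ Eᴳ n u ‖) (‖ Dᴳ u (suc m) ‖) (E n B) ⟩
    ‖ Eᴳ m u -ᴳ Eᴳ n u ‖ + E n B + ‖ Dᴳ u (suc m) ‖          ≤⟨ +-mono-≤ h (‖Dᴳ‖≤ u u≤B (suc m)) ⟩
    E m B + D B (suc m)                                      ∎) m n≤m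
  where
  open ≤-Reasoning
  cancel : ∀ x → x -ᴳ x ≡ (0ℚ , 0ℚ)
  cancel (a , b) = cong₂ _,_ (+-inverseʳ a) (+-inverseʳ b)
  swap : ∀ x y z → (x +ᴳ y) -ᴳ z ≡ (x -ᴳ z) +ᴳ y
  swap (a , a′) (b , b′) (c , c′) = cong₂ _,_ (eq a b c) (eq a′ b′ c′)
    where eq = solve 3 (λ a b c → a :+ b :- c := (a :- c) :+ b) refl

at : ℂ → ℕ → 𝔾
at z n = seq (re z) n , seq (im z) n

module Exp (z : ℂ) where
  open ≤-Reasoning

  B : ℚ
  B = proj₁ (bounded (re z)) + proj₁ (bounded (im z)) + 1ℚ

  0<Bx = proj₁ (proj₂ (bounded (re z)))
  0<By = proj₁ (proj₂ (bounded (im z)))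

  1≤B : 1ℚ ≤ B
  1≤B = p≤q+p (+-nonNeg (<⇒≤ 0<Bx) (<⇒≤ 0<By))

  0≤B : 0ℚ ≤ B
  0≤B = ≤-trans (<⇒≤ 0<1) 1≤B

  at≤B : ∀ n → ‖ at z n ‖ ≤ B
  at≤B n = ≤-trans (+-mono-≤ (proj₂ (proj₂ (bounded (re z))) n) (proj₂ (proj₂ (bounded (im z))) n)) (p≤p+q (<⇒≤ 0<1))

  open Tail (B + B) (+-nonNeg 0≤B 0≤B) using (C; 0<C; E≤C)
  open Tail B 0≤B using (E-tail)

  cancel : ∀ {x y c} → x + c ≤ y + c → x ≤ y
  cancel {x} {y} {c} h = begin
    x            ≡⟨ solve 2 (λ x c → x := x :+ c :- c) refl x c ⟩
    x + c - c    ≤⟨ +-monoˡ-≤ (- c) h ⟩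
    y + c - c    ≡⟨ solve 2 (λ x c → x :+ c :- c := x) refl y c ⟩
    y            ∎

  gap : ∀ {n m ε} → n ℕ.≤ m → E m B ≤ E n B + ε →
        ‖ Eᴳ m (at z m) -ᴳ Eᴳ n (at z n) ‖ ≤ C * ‖ at z m -ᴳ at z n ‖ + ε
  gap {n} {m} {ε} n≤m small = begin
    ‖ Eᴳ m (at z m) -ᴳ Eᴳ n (at z n) ‖                                                     ≡⟨ cong ‖_‖ (split (Eᴳ m (at z m)) (Eᴳ m (at z n)) (Eᴳ n (at z n))) ⟩
    ‖ (Eᴳ m (at z m) -ᴳ Eᴳ m (at z n)) +ᴳ (Eᴳ m (at z n) -ᴳ Eᴳ n (at z n)) ‖               ≤⟨ ‖+‖ (Eᴳ m (at z m) -ᴳ Eᴳ m (at z n)) (Eᴳ m (at z n) -ᴳ Eᴳ n (at z n)) ⟩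
    ‖ Eᴳ m (at z m) -ᴳ Eᴳ m (at z n) ‖ + ‖ Eᴳ m (at z n) -ᴳ Eᴳ n (at z n) ‖                ≤⟨ +-mono-≤ (≤-trans (‖Eᴳ-Eᴳ‖≤ (at z m) (at z n) 1≤B (at≤B m) (at≤B n) m) (*-monoʳ (0≤‖‖ (at z m -ᴳ at z n)) (E≤C m))) tail ⟩
    C * ‖ at z m -ᴳ at z n ‖ + ε                                                           ∎
    where
    split : ∀ x y z → x -ᴳ z ≡ (x -ᴳ y) +ᴳ (y -ᴳ z)
    split (a , a′) (b , b′) (c , c′) = cong₂ _,_ (eq a b c) (eq a′ b′ c′)
      where eq = solve 3 (λ a b c → a :- c := (a :- b) :+ (b :- c)) refl
    tail : ‖ Eᴳ m (at z n) -ᴳ Eᴳ n (at z n) ‖ ≤ ε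
    tail = cancel (≤-trans (‖Eᴳ-tail‖ (at z n) (at≤B n) m n≤m) (≤-trans small (≤-reflexive (+-comm (E n B) ε))))

  ‖-‖-comm : ∀ x y → ‖ x -ᴳ y ‖ ≡ ‖ y -ᴳ x ‖
  ‖-‖-comm (a , b) (c , d) = cong₂ _+_ (∣p-q∣-comm a c) (∣p-q∣-comm b d)

  gap-sym : ∀ ε → 0ℚ < ε → ∃ λ N → ∀ m n → N ℕ.≤ m → N ℕ.≤ n →
            ‖ Eᴳ m (at z m) -ᴳ Eᴳ n (at z n) ‖ ≤ C * ‖ at z m -ᴳ at z n ‖ + ε
  gap-sym ε 0<ε = proj₁ (E-tail 0<ε) , λ m n N≤m N≤n → [
    (λ m≤n → begin
      ‖ Eᴳ m (at z m) -ᴳ Eᴳ n (at z n) ‖  ≡⟨ ‖-‖-comm (Eᴳ m (at z m)) (Eᴳ n (at z n)) ⟩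
      ‖ Eᴳ n (at z n) -ᴳ Eᴳ m (at z m) ‖  ≤⟨ gap m≤n (proj₂ (E-tail 0<ε) N≤m m≤n) ⟩
      C * ‖ at z n -ᴳ at z m ‖ + ε        ≡⟨ cong (λ x → C * x + ε) (‖-‖-comm (at z n) (at z m)) ⟩
      C * ‖ at z m -ᴳ at z n ‖ + ε        ∎)
    , (λ n≤m → gap n≤m (proj₂ (E-tail 0<ε) N≤n n≤m)) ]′ (ℕ.≤-total m n)

  re-cauchy : IsCauchy (λ n → proj₁ (Eᴳ n (at z n)))
  re-cauchy = lipschitz (re z) (im z) (λ n → proj₁ (Eᴳ n (at z n))) C 0<C λ ε 0<ε →
    proj₁ (gap-sym ε 0<ε) , λ m n N≤m N≤n → ≤-trans (p≤p+q (0≤∣p∣ (proj₂ (Eᴳ m (at z m)) - proj₂ (Eᴳ n (at z n))))) (proj₂ (gap-sym ε 0<ε) m n N≤m N≤n)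

  im-cauchy : IsCauchy (λ n → proj₂ (Eᴳ n (at z n)))
  im-cauchy = lipschitz (re z) (im z) (λ n → proj₂ (Eᴳ n (at z n))) C 0<C λ ε 0<ε →
    proj₁ (gap-sym ε 0<ε) , λ m n N≤m N≤n → ≤-trans (p≤q+p (0≤∣p∣ (proj₁ (Eᴳ m (at z m)) - proj₁ (Eᴳ n (at z n))))) (proj₂ (gap-sym ε 0<ε) m n N≤m N≤n)

-- The n-th approximation of exp z is Σ_{k ≤ n} zₙᵏ / k!, where zₙ is the n-th
-- approximation of z. That this is the sum of the exponential series is
-- exp-HasSum below.
exp : ℂ → ℂ
exp z = mkℝ (λ n → proj₁ (Eᴳ n (at z n))) (Exp.re-cauchy z) +i mkℝ (λ n → proj₂ (Eᴳ n (at z n))) (Exp.im-cauchy z)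

2ℚ : ℚ
2ℚ = + 2 / 1

D-0 : ∀ k → D 0ℚ (suc k) ≡ 0ℚ
D-0 k = trans (cong (1/! (suc k) *_) (*-zeroˡ (0ℚ ^ k))) (*-zeroʳ (1/! (suc k)))

E-0 : ∀ n → E n 0ℚ ≡ 1ℚ
E-0 zero    = refl
E-0 (suc n) = trans (cong₂ _+_ (E-0 n) (D-0 n)) (+-identityʳ 1ℚ)

E-1 : ∀ q → E 1 q ≡ 1ℚ + q
E-1 = solve 1 (λ q → con 1ℚ :* con 1ℚ :+ con 1ℚ :* (q :* con 1ℚ) := con 1ℚ :+ q) refl

E-expanding : ∀ {a b} → 0ℚ ≤ a → a ≤ b → ∀ n → 1 ℕ.≤ n → E n a + (b - a) ≤ E n b
E-expanding {a} {b} 0≤a a≤b = ≤-induction (λ n → E n a + (b - a) ≤ E n b)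
  (≤-reflexive (trans (cong (_+ (b - a)) (E-1 a)) (trans (solve 2 (λ a b → con 1ℚ :+ a :+ (b :- a) := con 1ℚ :+ b) refl a b) (sym (E-1 b)))))
  (λ n _ h → begin
    E n a + D a (suc n) + (b - a)    ≡⟨ solve 3 (λ x y z → x :+ y :+ z := x :+ z :+ y) refl (E n a) (D a (suc n)) (b - a) ⟩
    E n a + (b - a) + D a (suc n)    ≤⟨ +-mono-≤ h (D-mono 0≤a a≤b (suc n)) ⟩
    E n b + D b (suc n)              ∎)
  where open ≤-Reasoning

E-mono-q : ∀ {a b} → 0ℚ ≤ a → a ≤ b → ∀ n → E n a ≤ E n b
E-mono-q 0≤a a≤b zero    = D-mono 0≤a a≤b 0
E-mono-q 0≤a a≤b (suc n) = +-mono-≤ (E-mono-q 0≤a a≤b n) (D-mono 0≤a a≤b (suc n))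

E-tail-mono : ∀ {a b ε n m} → 0ℚ ≤ a → a ≤ b → n ℕ.≤ m → E m b ≤ E n b + ε → E m a ≤ E n a + ε
E-tail-mono {a} {b} {ε} {n} {m} 0≤a a≤b n≤m h = begin
  E m a                          ≡⟨ x+y-y (E n b) (E m a) ⟨
  E n b + (E m a - E n b)        ≡⟨ solve 2 (λ u v → u :+ (v :- u) := v :+ u :- u) refl (E n b) (E m a) ⟩
  E m a + E n b - E n b          ≤⟨ +-monoˡ-≤ (- E n b) (lemma m n≤m) ⟩
  E m b + E n a - E n b          ≤⟨ +-monoˡ-≤ (- E n b) (+-monoˡ-≤ (E n a) h) ⟩
  E n b + ε + E n a - E n b      ≡⟨ solve 3 (λ u v e → u :+ e :+ v :- u := v :+ e) refl (E n b) (E n a) ε ⟩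
  E n a + ε                      ∎
  where
  open ≤-Reasoning
  lemma : ∀ m → n ℕ.≤ m → E m a + E n b ≤ E m b + E n a
  lemma = ≤-induction (λ m → E m a + E n b ≤ E m b + E n a) (≤-reflexive (+-comm (E n a) (E n b))) λ m _ h → begin
    E m a + D a (suc m) + E n b    ≡⟨ solve 3 (λ x y z → x :+ y :+ z := x :+ z :+ y) refl (E m a) (D a (suc m)) (E n b) ⟩
    E m a + E n b + D a (suc m)    ≤⟨ +-mono-≤ h (D-mono 0≤a a≤b (suc m)) ⟩
    E m b + E n a + D b (suc m)    ≡⟨ solve 3 (λ x y z → x :+ y :+ z := x :+ z :+ y) refl (E m b) (E n a) (D b (suc m)) ⟩
    E m b + D b (suc m) + E n a    ∎

-- The greatest multiple q of 1/(n+1) with E n q ≤ 2.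
ln2-approx : ℕ → ℚ
ln2-approx n = grid (E n) 2ℚ n (n ℕ.* 2 ℕ.+ 2) /1+ n

0≤ln2-approx : ∀ n → 0ℚ ≤ ln2-approx n
0≤ln2-approx n = 0≤/1+ (grid (E n) 2ℚ n (n ℕ.* 2 ℕ.+ 2)) n

ln2-lower : ∀ n → E n (ln2-approx n) ≤ 2ℚ
ln2-lower n = grid-lower (E n) 2ℚ n (n ℕ.* 2 ℕ.+ 2) (≤-trans (≤-reflexive (E-0 n)) (p≤p+q {1ℚ} {1ℚ} (<⇒≤ 0<1)))

E-exceeds-2 : ∀ {q n} → 2ℚ ≤ q → 1 ℕ.≤ n → 2ℚ < E n q
E-exceeds-2 {q} {n} 2≤q 1≤n = begin-strict
  2ℚ          ≡⟨ +-identityˡ 2ℚ ⟨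
  0ℚ + 2ℚ     <⟨ +-monoˡ-< 2ℚ 0<1 ⟩
  1ℚ + 2ℚ     ≤⟨ +-monoʳ-≤ 1ℚ 2≤q ⟩
  1ℚ + q      ≡⟨ E-1 q ⟨
  E 1 q       ≤⟨ E-mono-n (≤-trans (0≤ι 2) 2≤q) 1≤n ⟩
  E n q       ∎
  where open ≤-Reasoning

ln2-upper : ∀ n → 1 ℕ.≤ n → 2ℚ < E n (ln2-approx n + 1 /1+ n)
ln2-upper n 1≤n = subst (λ q → 2ℚ < E n q) (suc/ (grid (E n) 2ℚ n (n ℕ.* 2 ℕ.+ 2)) n)
  (grid-upper (E n) 2ℚ n (n ℕ.* 2 ℕ.+ 2) (E-exceeds-2 {n = n} bound 1≤n))
  where
  open ≤-Reasoning
  bound : 2ℚ ≤ suc (n ℕ.* 2 ℕ.+ 2) /1+ n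
  bound = begin
    2ℚ                                   ≡⟨ */ 2 n ⟨
    (2 ℕ.* suc n) /1+ n                  ≡⟨ cong (_/1+ n) (trans (ℕ.*-comm 2 (suc n)) (ℕ.+-comm 2 (n ℕ.* 2))) ⟩
    (n ℕ.* 2 ℕ.+ 2) /1+ n                ≤⟨ p≤p+q (0≤/1+ 1 n) ⟩
    (n ℕ.* 2 ℕ.+ 2) /1+ n + 1 /1+ n      ≡⟨ suc/ (n ℕ.* 2 ℕ.+ 2) n ⟨
    suc (n ℕ.* 2 ℕ.+ 2) /1+ n            ∎

E≤2⇒≤1 : ∀ {q n} → 0ℚ ≤ q → 1 ℕ.≤ n → E n q ≤ 2ℚ → q ≤ 1ℚ
E≤2⇒≤1 {q} {n} 0≤q 1≤n h = begin
  q                ≡⟨ solve 1 (λ q → q := con 1ℚ :+ q :- con 1ℚ) refl q ⟩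
  1ℚ + q - 1ℚ      ≡⟨ cong (λ u → u - 1ℚ) (E-1 q) ⟨
  E 1 q - 1ℚ       ≤⟨ +-monoˡ-≤ (- 1ℚ) (≤-trans (E-mono-n 0≤q 1≤n) h) ⟩
  1ℚ               ∎
  where open ≤-Reasoning

ln2-approx≤1 : ∀ n → 1 ℕ.≤ n → ln2-approx n ≤ 1ℚ
ln2-approx≤1 n 1≤n = E≤2⇒≤1 {n = n} (0≤ln2-approx n) 1≤n (ln2-lower n)

-- L and L′ stand for the approximations number m and n.
ln2-step : ∀ {L L′ r m ε} → 0ℚ ≤ L → 0ℚ ≤ L′ → 0ℚ ≤ r → 0ℚ ≤ ε → 1 ℕ.≤ m →
           E m L ≤ 2ℚ + ½ * ε → 2ℚ ≤ E m (L′ + r) → r ≤ ½ * ε → L ≤ L′ + ε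
ln2-step {L} {L′} {r} {m} {ε} 0≤L 0≤L′ 0≤r 0≤ε 1≤m EL≤ 2≤ r≤ = [ small , large ]′ (≤-total L (L′ + r))
  where
  open ≤-Reasoning
  finish : L ≤ L′ + r + ½ * ε → L ≤ L′ + ε
  finish h = begin
    L                          ≤⟨ h ⟩
    L′ + r + ½ * ε             ≤⟨ +-monoˡ-≤ (½ * ε) (+-monoʳ-≤ L′ r≤) ⟩
    L′ + ½ * ε + ½ * ε         ≡⟨ +-assoc L′ (½ * ε) (½ * ε) ⟩
    L′ + (½ * ε + ½ * ε)       ≡⟨ cong (λ u → L′ + u) (½+½ ε) ⟩
    L′ + ε                     ∎
  small : L ≤ L′ + r → L ≤ L′ + ε
  small h = finish (≤-trans h (p≤p+q (*-nonNeg (nonNegative⁻¹ ½) 0≤ε)))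
  large : L′ + r ≤ L → L ≤ L′ + ε
  large h = finish (begin
    L                                              ≡⟨ solve 3 (λ l t e → l := t :+ (e :+ (l :- t) :- e)) refl L (L′ + r) (E m (L′ + r)) ⟩
    L′ + r + (E m (L′ + r) + (L - (L′ + r)) - E m (L′ + r)) ≤⟨ +-monoʳ-≤ (L′ + r) (+-mono-≤ (≤-trans (E-expanding (+-nonNeg 0≤L′ 0≤r) h m 1≤m) EL≤) (neg-antimono-≤ 2≤)) ⟩
    L′ + r + (2ℚ + ½ * ε - 2ℚ)                     ≡⟨ solve 3 (λ t a e → t :+ (a :+ e :- a) := t :+ e) refl (L′ + r) 2ℚ (½ * ε) ⟩
    L′ + r + ½ * ε                                 ∎)

ln2-cauchy : IsCauchy ln2-approx
ln2-cauchy ε 0<ε = bound , λ m n le-m le-n → ∣-∣≤ (half m n le-m le-n) (half n m le-n le-m)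
  where
  0<η = ½-pos 0<ε
  0≤η = <⇒≤ 0<η
  module T = Tail 1ℚ (<⇒≤ 0<1)
  M  = proj₁ (1/1+-small 0<η)
  hM = proj₂ (1/1+-small 0<η)
  N  = proj₁ (T.E-tail 0<η)
  hN = proj₂ (T.E-tail 0<η)
  bound = suc (M ℕ.+ N)
  1≤ : ∀ {m} → bound ℕ.≤ m → 1 ℕ.≤ m
  1≤ = ℕ.≤-trans (ℕ.s≤s ℕ.z≤n)
  M≤ : ∀ {m} → bound ℕ.≤ m → M ℕ.≤ m
  M≤ = ℕ.≤-trans (ℕ.≤-trans (ℕ.m≤m+n M N) (ℕ.n≤1+n (M ℕ.+ N)))
  N≤ : ∀ {m} → bound ℕ.≤ m → N ℕ.≤ m
  N≤ = ℕ.≤-trans (ℕ.≤-trans (ℕ.m≤n+m N M) (ℕ.n≤1+n (M ℕ.+ N)))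
  half : ∀ m n → bound ℕ.≤ m → bound ℕ.≤ n → ln2-approx m ≤ ln2-approx n + ε
  half m n le-m le-n = [
      (λ m≤n → ln2-step {m = n} (0≤ln2-approx m) (0≤ln2-approx n) (0≤/1+ 1 n) (<⇒≤ 0<ε) (1≤ le-n)
        (≤-trans (E-tail-mono {n = m} {m = n} (0≤ln2-approx m) (ln2-approx≤1 m (1≤ le-m)) m≤n (hN (N≤ le-m) m≤n)) (+-monoˡ-≤ (½ * ε) (ln2-lower m)))
        (<⇒≤ (ln2-upper n (1≤ le-n))) (hM n (M≤ le-n)))
    , (λ n≤m → ln2-step {m = m} (0≤ln2-approx m) (0≤ln2-approx n) (0≤/1+ 1 n) (<⇒≤ 0<ε) (1≤ le-m)
        (≤-trans (ln2-lower m) (p≤p+q 0≤η))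
        (≤-trans (<⇒≤ (ln2-upper n (1≤ le-n))) (E-mono-n (+-nonNeg (0≤ln2-approx n) (0≤/1+ 1 n)) n≤m)) (hM n (M≤ le-n)))
    ]′ (ℕ.≤-total m n)

-- Characterised by exp-ln2 below.
ln2 : ℝ
ln2 = mkℝ ln2-approx ln2-cauchy

^ᴳ-real : ∀ q k → (q , 0ℚ) ^ᴳ k ≡ (q ^ k , 0ℚ)
^ᴳ-real q zero    = refl
^ᴳ-real q (suc k) = trans (cong ((q , 0ℚ) *ᴳ_) (^ᴳ-real q k)) (cong₂ _,_
  (solve 2 (λ q p → q :* p :- con 0ℚ :* con 0ℚ := q :* p) refl q (q ^ k))
  (solve 2 (λ q p → q :* con 0ℚ :+ con 0ℚ :* p := con 0ℚ) refl q (q ^ k)))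

Dᴳ-real : ∀ q k → Dᴳ (q , 0ℚ) k ≡ (D q k , 0ℚ)
Dᴳ-real q k = trans (cong (1/! k •_) (^ᴳ-real q k)) (cong (D q k ,_) (*-zeroʳ (1/! k)))

Eᴳ-real : ∀ n q → Eᴳ n (q , 0ℚ) ≡ (E n q , 0ℚ)
Eᴳ-real zero    q = Dᴳ-real q 0
Eᴳ-real (suc n) q = cong₂ _+ᴳ_ (Eᴳ-real n q) (Dᴳ-real q (suc n))

E-lipschitz : ∀ {p q B} → 1ℚ ≤ B → ∣ p ∣ ≤ B → ∣ q ∣ ≤ B → ∀ n →
              ∣ E n p - E n q ∣ ≤ E n (B + B) * ∣ p - q ∣
E-lipschitz {p} {q} {B} 1≤B p≤B q≤B n = begin
  ∣ E n p - E n q ∣                              ≡⟨ +-identityʳ _ ⟨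
  ‖ (E n p , 0ℚ) -ᴳ (E n q , 0ℚ) ‖               ≡⟨ cong₂ (λ u v → ‖ u -ᴳ v ‖) (Eᴳ-real n p) (Eᴳ-real n q) ⟨
  ‖ Eᴳ n (p , 0ℚ) -ᴳ Eᴳ n (q , 0ℚ) ‖             ≤⟨ ‖Eᴳ-Eᴳ‖≤ (p , 0ℚ) (q , 0ℚ) 1≤B (≤-trans (≤-reflexive (+-identityʳ _)) p≤B) (≤-trans (≤-reflexive (+-identityʳ _)) q≤B) n ⟩
  E n (B + B) * (∣ p - q ∣ + 0ℚ)                 ≡⟨ cong (E n (B + B) *_) (+-identityʳ _) ⟩
  E n (B + B) * ∣ p - q ∣                        ∎
  where open ≤-Reasoning

exp-ln2-step : ∀ {L r C ε} n → 0ℚ ≤ L → L ≤ 1ℚ → 0ℚ ≤ r → r ≤ 1ℚ → 0ℚ ≤ ε →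
               E n L ≤ 2ℚ → 2ℚ ≤ E n (L + r) → E n (2ℚ + 2ℚ) ≤ C → C * r ≤ ε → ∣ E n L - 2ℚ ∣ ≤ ε
exp-ln2-step {L} {r} {C} {ε} n 0≤L L≤1 0≤r r≤1 0≤ε lower upper E≤C Cr≤ε = ∣-∣≤ (≤-trans lower (p≤p+q 0≤ε)) (begin
  2ℚ                                                ≤⟨ upper ⟩
  E n (L + r)                                       ≤⟨ ≤+∣-∣ (E n (L + r)) (E n L) ⟩
  E n L + ∣ E n (L + r) - E n L ∣                   ≤⟨ +-monoʳ-≤ (E n L) (E-lipschitz {L + r} {L} {2ℚ} (p≤p+q {1ℚ} {1ℚ} (<⇒≤ 0<1)) (≤-trans (≤-reflexive (0≤p⇒∣p∣≡p (+-nonNeg 0≤L 0≤r))) (+-mono-≤ L≤1 r≤1)) (≤-trans (≤-reflexive (0≤p⇒∣p∣≡p 0≤L)) (≤-trans L≤1 (p≤p+q {1ℚ} {1ℚ} (<⇒≤ 0<1)))) n) ⟩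
  E n L + E n (2ℚ + 2ℚ) * ∣ L + r - L ∣             ≡⟨ cong (λ u → E n L + E n (2ℚ + 2ℚ) * u) (trans (cong ∣_∣ (solve 2 (λ l r → l :+ r :- l := r) refl L r)) (0≤p⇒∣p∣≡p 0≤r)) ⟩
  E n L + E n (2ℚ + 2ℚ) * r                         ≤⟨ +-monoʳ-≤ (E n L) (≤-trans (*-monoʳ 0≤r E≤C) Cr≤ε) ⟩
  E n L + ε                                         ∎)
  where open ≤-Reasoning

exp-ln2 : exp (ln2 +i 0ᴿ) ≃ᶜ fromℚᶜ 2ℚ
exp-ln2 = (λ ε 0<ε → bound ε 0<ε , λ n le → subst (λ u → ∣ proj₁ u - 2ℚ ∣ ≤ ε) (sym (Eᴳ-real n (ln2-approx n))) (main ε 0<ε n le))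
        , (λ ε 0<ε → 0 , λ n _ → subst (λ u → ∣ proj₂ u - 0ℚ ∣ ≤ ε) (sym (Eᴳ-real n (ln2-approx n))) (<⇒≤ 0<ε))
  where
  module T = Tail (2ℚ + 2ℚ) (0≤ι 4)
  N : ∀ ε → 0ℚ < ε → ℕ
  N ε 0<ε = proj₁ (archimedes T.C (<⇒≤ T.0<C) 0<ε)
  bound : ∀ ε → 0ℚ < ε → ℕ
  bound ε 0<ε = suc (N ε 0<ε)
  main : ∀ ε (0<ε : 0ℚ < ε) n → bound ε 0<ε ℕ.≤ n → ∣ E n (ln2-approx n) - 2ℚ ∣ ≤ ε
  main ε 0<ε n le = exp-ln2-step n (0≤ln2-approx n) (ln2-approx≤1 n 1≤n) (0≤/1+ 1 n) (1/1+≤1 n) (<⇒≤ 0<ε)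
    (ln2-lower n) (<⇒≤ (ln2-upper n 1≤n)) (T.E≤C n) (proj₂ (archimedes T.C (<⇒≤ T.0<C) 0<ε) n (ℕ.≤-trans (ℕ.n≤1+n (N ε 0<ε)) le))
    where
    1≤n : 1 ℕ.≤ n
    1≤n = ℕ.≤-trans (ℕ.s≤s ℕ.z≤n) le


-- w² = v and -π/2 < arg w ≤ π/2 (or w = 0).
_IsPrincipal√Of_ : ℂ → ℂ → Set
w IsPrincipal√Of v = w *ᶜ w ≃ᶜ v × (0ᴿ <ᴿ re w ⊎ (re w ≃ᴿ 0ᴿ × 0ᴿ ≤ᴿ im w))

-- Convergence of the partial sums. Rational ε suffice, as ℚ is dense in ℝ.
_HasSum_ : (ℕ → ℂ) → ℂ → Set
f HasSum w = ∀ ε → 0ℚ < ε → ∃ λ N → ∀ n → N ℕ.≤ n → ∣ ∑ _+ᶜ_ n f -ᶜ w ∣ᶜ <ᴿ fromℚᴿ ε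

modulus-small : ∀ {s x y r ε} → 0ℚ ≤ s → 0ℚ ≤ r → s * s ≤ 0ℚ ⊔ (x * x + y * y) → ∣ x ∣ + ∣ y ∣ ≤ r → r + r ≤ ε → s + r ≤ ε
modulus-small {s} {x} {y} {r} {ε} 0≤s 0≤r lower xy≤r r+r≤ε = ≤-trans (+-monoˡ-≤ r (square-cancel 0≤s 0≤r (begin
  s * s                       ≤⟨ lower ⟩
  0ℚ ⊔ (x * x + y * y)        ≤⟨ ⊔-lub (*-nonNeg 0≤r 0≤r) (begin
    x * x + y * y                                                    ≤⟨ +-mono-≤ (square≤ x) (square≤ y) ⟩
    ∣ x ∣ * ∣ x ∣ + ∣ y ∣ * ∣ y ∣                                    ≤⟨ p≤p+q (*-nonNeg (+-nonNeg (<⇒≤ 0<1) (<⇒≤ 0<1)) (*-nonNeg (0≤∣p∣ x) (0≤∣p∣ y))) ⟩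
    ∣ x ∣ * ∣ x ∣ + ∣ y ∣ * ∣ y ∣ + (1ℚ + 1ℚ) * (∣ x ∣ * ∣ y ∣)      ≡⟨ solve 2 (λ x y → x :* x :+ y :* y :+ (con 1ℚ :+ con 1ℚ) :* (x :* y) := (x :+ y) :* (x :+ y)) refl (∣ x ∣) (∣ y ∣) ⟩
    (∣ x ∣ + ∣ y ∣) * (∣ x ∣ + ∣ y ∣)                                ≤⟨ *-mono 0≤r (0≤‖‖ (x , y)) xy≤r xy≤r ⟩
    r * r                                                            ∎) ⟩
  r * r                       ∎))) r+r≤ε
  where
  open ≤-Reasoning
  square≤ : ∀ x → x * x ≤ ∣ x ∣ * ∣ x ∣
  square≤ x = ≤-trans (p≤∣p∣ (x * x)) (≤-reflexive (∣p*q∣≡∣p∣*∣q∣ x x))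

at-^ : ∀ z k j → at (z ^ᶜ k) j ≡ at z j ^ᴳ k
at-^ z zero    j = refl
at-^ z (suc k) j = cong (at z j *ᴳ_) (at-^ z k j)

at-term : ∀ z k j → at (fromℚᶜ (1/! k) *ᶜ z ^ᶜ k) j ≡ Dᴳ (at z j) k
at-term z k j = trans (lemma (1/! k) (at (z ^ᶜ k) j)) (cong (1/! k •_) (at-^ z k j))
  where
  lemma : ∀ q u → (q , 0ℚ) *ᴳ u ≡ q • u
  lemma q (a , b) = cong₂ _,_
    (solve 3 (λ q a b → q :* a :- con 0ℚ :* b := q :* a) refl q a b)
    (solve 3 (λ q a b → q :* b :+ con 0ℚ :* a := q :* b) refl q a b)

at-sum : ∀ z n j → at (∑ _+ᶜ_ n (λ k → fromℚᶜ (1/! k) *ᶜ z ^ᶜ k)) j ≡ Eᴳ n (at z j)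
at-sum z zero    j = at-term z 0 j
at-sum z (suc n) j = cong₂ _+ᴳ_ (at-sum z n j) (at-term z (suc n) j)

exp-HasSum : ∀ z → (λ k → fromℚᶜ (1/! k) *ᶜ z ^ᶜ k) HasSum exp z
exp-HasSum z ε 0<ε = N , λ n N≤n → η , 0<η , n , λ j n≤j →
  modulus-small {x = x n j} {y = y n j} (0≤√approx j (x n j * x n j + y n j * y n j)) (<⇒≤ 0<η) (√approx-lower j (x n j * x n j + y n j * y n j)) (close n j N≤n n≤j) (≤-reflexive (½+½ ε))
  where
  open Exp z
  open ≤-Reasoning
  η = ½ * ε
  0<η = ½-pos 0<ε
  open Tail B 0≤B using (E-tail)
  N = proj₁ (E-tail 0<η)
  partial : ℕ → ℂ
  partial n = ∑ _+ᶜ_ n (λ k → fromℚᶜ (1/! k) *ᶜ z ^ᶜ k)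
  x y : ℕ → ℕ → ℚ
  x n j = proj₁ (at (partial n -ᶜ exp z) j)
  y n j = proj₂ (at (partial n -ᶜ exp z) j)
  close : ∀ n j → N ℕ.≤ n → n ℕ.≤ j → ‖ at (partial n -ᶜ exp z) j ‖ ≤ η
  close n j N≤n n≤j = begin
    ‖ at (partial n) j -ᴳ Eᴳ j (at z j) ‖      ≡⟨ cong (λ u → ‖ u -ᴳ Eᴳ j (at z j) ‖) (at-sum z n j) ⟩
    ‖ Eᴳ n (at z j) -ᴳ Eᴳ j (at z j) ‖         ≡⟨ ‖-‖-comm (Eᴳ n (at z j)) (Eᴳ j (at z j)) ⟩
    ‖ Eᴳ j (at z j) -ᴳ Eᴳ n (at z j) ‖         ≤⟨ cancel (≤-trans (‖Eᴳ-tail‖ (at z j) (at≤B j) j n≤j) (≤-trans (proj₂ (E-tail 0<η) N≤n n≤j) (≤-reflexive (+-comm (E n B) η)))) ⟩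
    η                                          ∎

-- Formal power series over ℚ, as coefficient sequences.
Series : Set
Series = ℕ → ℚ

_⊛_ : Series → Series → Series
(f ⊛ g) n = ∑ _+_ n (λ i → f i * g (n ℕ.∸ i))

_^ˢ_ : Series → ℕ → Series
(f ^ˢ zero) zero    = 1ℚ
(f ^ˢ zero) (suc _) = 0ℚ
f ^ˢ suc k          = f ⊛ (f ^ˢ k)

expˢ-1 : Series
expˢ-1 zero    = 0ℚ
expˢ-1 (suc n) = 1/! (suc n)

-- Stirling numbers of the second kind: S n k is the coefficient of xⁿ / n! in
-- (eˣ - 1)ᵏ / k!.
S : ℕ → ℕ → ℚ
S n k = ι (n !) * (1/! k * (expˢ-1 ^ˢ k) n)

-- oddProduct j = 1 · 3 ⋯ (2j - 1)
oddProduct : ℕ → ℕ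
oddProduct zero    = 1
oddProduct (suc j) = oddProduct j ℕ.* suc (2 ℕ.* j)

oddProduct≢0 : ∀ j → ℕ.NonZero (oddProduct j)
oddProduct≢0 zero    = _
oddProduct≢0 (suc j) = ℕ.m*n≢0 (oddProduct j) (suc (2 ℕ.* j)) ⦃ oddProduct≢0 j ⦄

-- [2 j -1]!! is (2j - 1)!!; for j = -k it is [-(2k + 1)]!! = (-1)ᵏ / (2k - 1)!!.
[2_-1]!! : ℤ → ℚ
[2 + j      -1]!! = ι (oddProduct j)
[2 -[1+ k ] -1]!! = (- 1ℚ) ^ suc k * (+ 1 / oddProduct (suc k)) ⦃ oddProduct≢0 (suc k) ⦄

{-# OPTIONS --safe #-}
-- Put q = eˣ - 1 and g = √(1 + 2q) = Σ bₖ qᵏ, so that f(x) = g(-x) is the series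
-- in question. With θ = x d/dx, the recurrence of the bₖ gives
-- (1 + 2q) θg = g θq. Uniqueness for such linear equations gives g² = 1 + 2q, and
-- reflecting x gives, for v = -θf,
--     v = x f + q v.
-- This recurrence makes all coefficients of v nonnegative, so those of f are
-- nonpositive after the first, f(0) = 1. For 0 < R < ln 2 we have q(R) ≤ 1 - η
-- with η > 0, and the same equation, read for partial sums at R, gives
-- η v(R) ≤ R f(R) and η ≤ f(R). The bound on v(R) = Σ n |fₙ| Rⁿ controls at once
-- the tails of f on the disk ∣z∣ ≤ R, its Lipschitz constant and the error in
-- squaring partial sums; the bound on f(R) gives re f(z) ≥ f(R) ≥ η there, so the
-- root is the principal one.
module Submission where

open import Level using (0ℓ)
open import Algebra.Bundles using (CommutativeRing)
open import Data.Nat.Base as ℕ using (ℕ; zero; suc; z≤n; s≤s; _!)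
import Data.Nat.Properties as ℕ
open import Data.Integer.Base as ℤ using (+_)
open import Data.Product.Base using (_×_; _,_; proj₁; proj₂; ∃)
open import Data.Sum.Base using (inj₁; inj₂; [_,_]′)
import Relation.Binary.PropositionalEquality as ≡
open import Defs

-- Formal power series

-- The series of √(1 + 2x) has radius of convergence 1/2, whereas e⁻ᶻ - 1 comes arbitrarily close to
-- 1 on the disk |z| < ln 2. So Σ bₖ qᵏ cannot be summed there as an analytic composition: the
-- identities are proved formally, and convergence up to ln 2 comes from the signs of the
-- coefficients. The number ln 2 appears when the reflected equation is multiplied by eˣ: as eˣ
-- (2e⁻ˣ - 1) = 2 - eˣ = 1 - q, it becomes (1 - q) θf = -x f, and 1 - q has its positive zero at ln
-- 2. The operator θ is used instead of d/dx because it preserves degrees: it commutes with x ↦ c x,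
-- and its weights n are those needed to bound tails. The complex part uses only finite sums at
-- Gaussian rationals. The n-th approximation of the root is the n-th partial sum of f at the n-th
-- approximation of z. As `exp` has the same diagonal form, the square of the root and 2e⁻ᶻ - 1
-- differ at index n only by the terms of degree above n in the square of a partial sum.

module PowerSeries (R : CommutativeRing 0ℓ 0ℓ) where
  open CommutativeRing R
  open import Relation.Binary.Reasoning.Setoid setoid
  open import Algebra.Properties.CommutativeSemigroup +-commutativeSemigroup using (interchange)

  Σ[_] : ℕ → (ℕ → Carrier) → Carrier
  Σ[ n ] f = ∑ _+_ n f

  Σ-cong-≤ : ∀ n {f g} → (∀ i → i ℕ.≤ n → f i ≈ g i) → Σ[ n ] f ≈ Σ[ n ] g
  Σ-cong-≤ zero    h = h 0 z≤n
  Σ-cong-≤ (suc n) h = +-cong (Σ-cong-≤ n λ i i≤n → h i (ℕ.m≤n⇒m≤1+n i≤n)) (h (suc n) ℕ.≤-refl)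

  Σ-cong : ∀ n {f g} → (∀ i → f i ≈ g i) → Σ[ n ] f ≈ Σ[ n ] g
  Σ-cong n h = Σ-cong-≤ n λ i _ → h i

  Σ-+ : ∀ n f g → Σ[ n ] (λ i → f i + g i) ≈ Σ[ n ] f + Σ[ n ] g
  Σ-+ zero    f g = refl
  Σ-+ (suc n) f g = trans (+-congʳ (Σ-+ n f g)) (interchange _ _ _ _)

  Σ-*ˡ : ∀ n c f → Σ[ n ] (λ i → c * f i) ≈ c * Σ[ n ] f
  Σ-*ˡ zero    c f = refl
  Σ-*ˡ (suc n) c f = trans (+-congʳ (Σ-*ˡ n c f)) (sym (distribˡ c _ _))

  Σ-0 : ∀ n → Σ[ n ] (λ _ → 0#) ≈ 0#
  Σ-0 zero    = refl
  Σ-0 (suc n) = trans (+-identityʳ _) (Σ-0 n)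

  Σ-head : ∀ n f → Σ[ suc n ] f ≈ f 0 + Σ[ n ] (λ i → f (suc i))
  Σ-head zero    f = refl
  Σ-head (suc n) f = trans (+-congʳ (Σ-head n f)) (+-assoc _ _ _)

  Power : Set
  Power = ℕ → Carrier

  infix  4 _≋_
  infixl 6 _⊞_
  infixl 7 _⋆_

  _≋_ : Power → Power → Set
  f ≋ g = ∀ n → f n ≈ g n

  _⊞_ _⋆_ : Power → Power → Power
  (f ⊞ g) n = f n + g n
  (f ⋆ g) n = Σ[ n ] λ i → f i * g (n ℕ.∸ i)

  ⊟_ tail : Power → Power
  (⊟ f) n = - f n
  tail f n = f (suc n)

  𝟘 𝟙 : Power
  𝟘 _       = 0#
  𝟙 zero    = 1#
  𝟙 (suc _) = 0#

  ⋆-cong-≤ : ∀ n {f f′ g g′} → (∀ i → i ℕ.≤ n → f i ≈ f′ i) → (∀ i → i ℕ.≤ n → g i ≈ g′ i) → (f ⋆ g) n ≈ (f′ ⋆ g′) n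
  ⋆-cong-≤ n h h′ = Σ-cong-≤ n λ i i≤n → *-cong (h i i≤n) (h′ (n ℕ.∸ i) (ℕ.m∸n≤m n i))

  ⋆-cong : ∀ {f f′ g g′} → f ≋ f′ → g ≋ g′ → f ⋆ g ≋ f′ ⋆ g′
  ⋆-cong h h′ n = ⋆-cong-≤ n (λ i _ → h i) (λ i _ → h′ i)

  ⋆-suc : ∀ f g n → (f ⋆ g) (suc n) ≈ f 0 * g (suc n) + (tail f ⋆ g) n
  ⋆-suc f g n = Σ-head n (λ i → f i * g (suc n ℕ.∸ i))

  ⋆-sucʳ : ∀ f g n → (f ⋆ g) (suc n) ≈ (f ⋆ tail g) n + f (suc n) * g 0
  ⋆-sucʳ f g n = +-cong
    (Σ-cong-≤ n λ i i≤n → *-congˡ (reflexive (≡.cong g (ℕ.+-∸-assoc 1 i≤n))))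
    (*-congˡ (reflexive (≡.cong g (ℕ.n∸n≡0 n))))

  ⋆-comm : ∀ f g → f ⋆ g ≋ g ⋆ f
  ⋆-comm f g zero    = *-comm _ _
  ⋆-comm f g (suc n) = begin
    (f ⋆ g) (suc n)                       ≈⟨ ⋆-suc f g n ⟩
    f 0 * g (suc n) + (tail f ⋆ g) n      ≈⟨ +-cong (*-comm _ _) (⋆-comm (tail f) g n) ⟩
    g (suc n) * f 0 + (g ⋆ tail f) n      ≈⟨ +-comm _ _ ⟩
    (g ⋆ tail f) n + g (suc n) * f 0      ≈⟨ ⋆-sucʳ g f n ⟨
    (g ⋆ f) (suc n)                       ∎

  ⋆-distribʳ : ∀ h f g → (f ⊞ g) ⋆ h ≋ f ⋆ h ⊞ g ⋆ h
  ⋆-distribʳ h f g n = trans (Σ-cong n λ i → distribʳ _ (f i) (g i)) (Σ-+ n _ _)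

  ⋆-scaleˡ : ∀ c f g → (λ i → c * f i) ⋆ g ≋ λ n → c * (f ⋆ g) n
  ⋆-scaleˡ c f g n = trans (Σ-cong n λ i → *-assoc c (f i) _) (Σ-*ˡ n c _)

  ⋆-zeroˡ : ∀ f → 𝟘 ⋆ f ≋ 𝟘
  ⋆-zeroˡ f n = trans (Σ-cong n λ i → zeroˡ _) (Σ-0 n)

  ⋆-identityˡ : ∀ f → 𝟙 ⋆ f ≋ f
  ⋆-identityˡ f zero    = *-identityˡ _
  ⋆-identityˡ f (suc n) = trans (⋆-suc 𝟙 f n) (trans (+-cong (*-identityˡ _) (⋆-zeroˡ f n)) (+-identityʳ _))

  ⋆-assoc : ∀ f g h → (f ⋆ g) ⋆ h ≋ f ⋆ (g ⋆ h)
  ⋆-assoc f g h zero    = *-assoc _ _ _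
  ⋆-assoc f g h (suc n) = begin
    ((f ⋆ g) ⋆ h) (suc n)                                                 ≈⟨ ⋆-suc (f ⋆ g) h n ⟩
    f 0 * g 0 * h (suc n) + (tail (f ⋆ g) ⋆ h) n                          ≈⟨ +-cong (*-assoc _ _ _) (⋆-cong {g = h} {h} (⋆-suc f g) (λ _ → refl) n) ⟩
    f 0 * (g 0 * h (suc n)) + (((λ i → f 0 * tail g i) ⊞ tail f ⋆ g) ⋆ h) n   ≈⟨ +-congˡ (trans (⋆-distribʳ h _ _ n) (+-cong (⋆-scaleˡ (f 0) (tail g) h n) (⋆-assoc (tail f) g h n))) ⟩
    f 0 * (g 0 * h (suc n)) + (f 0 * (tail g ⋆ h) n + (tail f ⋆ (g ⋆ h)) n)   ≈⟨ +-assoc _ _ _ ⟨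
    f 0 * (g 0 * h (suc n)) + f 0 * (tail g ⋆ h) n + (tail f ⋆ (g ⋆ h)) n     ≈⟨ +-congʳ (trans (*-congˡ (⋆-suc g h n)) (distribˡ _ _ _)) ⟨
    f 0 * (g ⋆ h) (suc n) + (tail f ⋆ (g ⋆ h)) n                          ≈⟨ ⋆-suc f (g ⋆ h) n ⟨
    (f ⋆ (g ⋆ h)) (suc n)                                                 ∎

  powerSeriesRing : CommutativeRing 0ℓ 0ℓ
  powerSeriesRing = record
    { Carrier = Power ; _≈_ = _≋_ ; _+_ = _⊞_ ; _*_ = _⋆_ ; -_ = ⊟_ ; 0# = 𝟘 ; 1# = 𝟙
    ; isCommutativeRing = record
      { isRing = record
        { +-isAbelianGroup = record
          { isGroup = record
            { isMonoid = record
              { isSemigroup = record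
                { isMagma = record
                  { isEquivalence = record { refl = λ _ → refl ; sym = λ h n → sym (h n) ; trans = λ h h′ n → trans (h n) (h′ n) }
                  ; ∙-cong = λ h h′ n → +-cong (h n) (h′ n) }
                ; assoc = λ f g h n → +-assoc (f n) (g n) (h n) }
              ; identity = (λ f n → +-identityˡ (f n)) , (λ f n → +-identityʳ (f n)) }
            ; inverse = (λ f n → -‿inverseˡ (f n)) , (λ f n → -‿inverseʳ (f n))
            ; ⁻¹-cong = λ h n → -‿cong (h n) }
          ; comm = λ f g n → +-comm (f n) (g n) }
        ; *-cong = ⋆-cong
        ; *-assoc = ⋆-assoc
        ; *-identity = ⋆-identityˡ , λ f n → trans (⋆-comm f 𝟙 n) (⋆-identityˡ f n)
        ; distrib = (λ h f g n → trans (⋆-comm h (f ⊞ g) n) (trans (⋆-distribʳ h f g n) (+-cong (⋆-comm f h n) (⋆-comm g h n)))) , ⋆-distribʳ }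
      ; *-comm = ⋆-comm } }

  -- Both sides add up `f i * g j` over the triangle i + j ≤ n, by diagonals on the left and by rows
  -- on the right.
  Σ-⋆ : ∀ n f g → Σ[ n ] (f ⋆ g) ≈ Σ[ n ] λ i → f i * Σ[ n ℕ.∸ i ] g
  Σ-⋆ zero    f g = refl
  Σ-⋆ (suc n) f g = begin
    Σ[ n ] (f ⋆ g) + (f ⋆ g) (suc n)                                                             ≈⟨ +-congʳ (Σ-⋆ n f g) ⟩
    Σ[ n ] (λ i → f i * Σ[ n ℕ.∸ i ] g) + (Σ[ n ] (λ i → f i * g (suc n ℕ.∸ i)) + f (suc n) * g (n ℕ.∸ n))   ≈⟨ +-assoc _ _ _ ⟨
    Σ[ n ] (λ i → f i * Σ[ n ℕ.∸ i ] g) + Σ[ n ] (λ i → f i * g (suc n ℕ.∸ i)) + f (suc n) * g (n ℕ.∸ n)     ≈⟨ +-cong (trans (sym (Σ-+ n _ _)) (Σ-cong-≤ n merge)) (*-congˡ last) ⟩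
    Σ[ n ] (λ i → f i * Σ[ suc n ℕ.∸ i ] g) + f (suc n) * Σ[ n ℕ.∸ n ] g                          ∎
    where
    merge : ∀ i → i ℕ.≤ n → f i * Σ[ n ℕ.∸ i ] g + f i * g (suc n ℕ.∸ i) ≈ f i * Σ[ suc n ℕ.∸ i ] g
    merge i i≤n = trans (sym (distribˡ _ _ _)) (*-congˡ (reflexive
      (≡.trans (≡.cong (λ k → Σ[ n ℕ.∸ i ] g + g k) (ℕ.+-∸-assoc 1 i≤n)) (≡.cong (λ k → Σ[ k ] g) (≡.sym (ℕ.+-∸-assoc 1 i≤n))))))
    last : g (n ℕ.∸ n) ≈ Σ[ n ℕ.∸ n ] g
    last = reflexive (≡.trans (≡.cong g (ℕ.n∸n≡0 n)) (≡.cong (λ k → Σ[ k ] g) (≡.sym (ℕ.n∸n≡0 n))))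

open import Data.Rational.Base as ℚ
open import Data.Rational.Properties
open import Data.Rational.Solver using (module +-*-Solver)
open import Relation.Binary.PropositionalEquality using (isEquivalence; _≡_; refl; sym; trans; cong; cong₂; subst; module ≡-Reasoning)
open import Algebra.Definitions.RawSemiring +-*-rawSemiring using (_^_)
open import Algebra.Properties.Group +-0-group using (∙-cancelʳ)
open import Algebra.Properties.Semiring.Exp (CommutativeRing.semiring +-*-commutativeRing) using (^-homo-*)
open PowerSeries +-*-commutativeRing
open +-*-Solver using (solve; _:=_; _:+_; _:*_; _:-_; :-_; con)

-- Rational series: constants, θ and the substitution x ↦ c x

module Ps where
  open CommutativeRing powerSeriesRing public using (commutativeSemiring; setoid; +-cong; +-congˡ; +-congʳ; *-cong; *-congˡ; *-congʳ; +-identityˡ; *-identityˡ; *-assoc; *-comm; zeroˡ; -‿inverseˡ)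
    renaming (refl to reflˢ; sym to symˢ; trans to transˢ)
  open import Algebra.Solver.Ring.NaturalCoefficients.Default commutativeSemiring public
  open import Algebra.Properties.Ring (CommutativeRing.ring powerSeriesRing) public using (+-cancelʳ)
open Ps using (reflˢ; symˢ; transˢ)

module ≋-Reasoning where
  open import Relation.Binary.Reasoning.Setoid Ps.setoid public

-- Scalars as series, so that they become atoms of the ring solver `Ps.solve`.
const : ℚ → Power
const c zero    = c
const c (suc _) = 0ℚ

const-⋆ : ∀ c f n → (const c ⋆ f) n ≡ c * f n
const-⋆ c f zero    = refl
const-⋆ c f (suc n) = begin
  (const c ⋆ f) (suc n)              ≡⟨ ⋆-suc (const c) f n ⟩
  c * f (suc n) + (𝟘 ⋆ f) n          ≡⟨ cong (λ y → c * f (suc n) + y) (⋆-zeroˡ f n) ⟩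
  c * f (suc n) + 0ℚ                 ≡⟨ +-identityʳ _ ⟩
  c * f (suc n)                      ∎
  where open ≡-Reasoning

const-+ : ∀ c d → const (c + d) ≋ const c ⊞ const d
const-+ c d zero    = refl
const-+ c d (suc _) = refl

const-0 : const 0ℚ ≋ 𝟘
const-0 zero    = refl
const-0 (suc _) = refl

const-1 : const 1ℚ ≋ 𝟙
const-1 zero    = refl
const-1 (suc _) = refl

X : Power
X zero    = 0ℚ
X (suc n) = 𝟙 n

X-⋆ : ∀ f n → (X ⋆ f) (suc n) ≡ f n
X-⋆ f n = begin
  (X ⋆ f) (suc n)                  ≡⟨ ⋆-suc X f n ⟩
  0ℚ * f (suc n) + (𝟙 ⋆ f) n       ≡⟨ cong₂ _+_ (*-zeroˡ (f (suc n))) (⋆-identityˡ f n) ⟩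
  0ℚ + f n                         ≡⟨ +-identityˡ _ ⟩
  f n                              ∎
  where open ≡-Reasoning

-- θ = x d/dx
θ : Power → Power
θ f n = ι n * f n

θ-cong : ∀ {f g} → f ≋ g → θ f ≋ θ g
θ-cong h n = cong (ι n *_) (h n)

θ-⊞ : ∀ f g → θ (f ⊞ g) ≋ θ f ⊞ θ g
θ-⊞ f g n = *-distribˡ-+ (ι n) (f n) (g n)

θ-const : ∀ c → θ (const c) ≋ 𝟘
θ-const c zero    = *-zeroˡ c
θ-const c (suc n) = *-zeroʳ (ι (suc n))

θ-⋆ : ∀ f g → θ (f ⋆ g) ≋ θ f ⋆ g ⊞ f ⋆ θ g
θ-⋆ f g n = begin
  ι n * (f ⋆ g) n                                                       ≡⟨ Σ-*ˡ n (ι n) (λ i → f i * g (n ℕ.∸ i)) ⟨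
  Σ[ n ] (λ i → ι n * (f i * g (n ℕ.∸ i)))                              ≡⟨ Σ-cong-≤ n split ⟩
  Σ[ n ] (λ i → θ f i * g (n ℕ.∸ i) + f i * θ g (n ℕ.∸ i))              ≡⟨ Σ-+ n _ _ ⟩
  (θ f ⋆ g) n + (f ⋆ θ g) n                                             ∎
  where
  open ≡-Reasoning
  split : ∀ i → i ℕ.≤ n → ι n * (f i * g (n ℕ.∸ i)) ≡ θ f i * g (n ℕ.∸ i) + f i * θ g (n ℕ.∸ i)
  split i i≤n = trans
    (cong (λ m → m * (f i * g (n ℕ.∸ i))) (trans (cong ι (sym (ℕ.m+[n∸m]≡n i≤n))) (ι-+ i (n ℕ.∸ i))))
    (solve 4 (λ a b f g → (a :+ b) :* (f :* g) := a :* f :* g :+ f :* (b :* g)) refl (ι i) (ι (n ℕ.∸ i)) (f i) (g (n ℕ.∸ i)))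

θ-const-⋆ : ∀ c f → θ (const c ⋆ f) ≋ const c ⋆ θ f
θ-const-⋆ c f n = begin
  ι n * (const c ⋆ f) n        ≡⟨ cong (ι n *_) (const-⋆ c f n) ⟩
  ι n * (c * f n)              ≡⟨ solve 3 (λ a b c → a :* (b :* c) := b :* (a :* c)) refl (ι n) c (f n) ⟩
  c * (ι n * f n)              ≡⟨ const-⋆ c (θ f) n ⟨
  (const c ⋆ θ f) n            ∎
  where open ≡-Reasoning

ι-cancel : ∀ n {a b} → ι (suc n) * a ≡ ι (suc n) * b → a ≡ b
ι-cancel n {a} {b} h = trans (expand a) (trans (cong (1 /1+ n *_) h) (sym (expand b)))
  where
  expand : ∀ a → a ≡ 1 /1+ n * (ι (suc n) * a)
  expand a = trans (sym (*-identityˡ a)) (trans (cong (_* a) (sym (1/1+-ι n))) (*-assoc (1 /1+ n) (ι (suc n)) a))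

-- In degree n + 1 the conditions on `p 0` and `s 0` leave n + 1 times the top coefficient and terms
-- in the coefficients up to n, so each coefficient is determined by the earlier ones. An identity
-- of series then needs only a common equation and a common constant term.
linear-ode-unique : ∀ {p s f g} → p 0 ≡ 1ℚ → s 0 ≡ 0ℚ → f 0 ≡ g 0 →
                    p ⋆ θ f ≋ s ⋆ f → p ⋆ θ g ≋ s ⋆ g → f ≋ g
linear-ode-unique {p} {s} {f} {g} p₀ s₀ start odef odeg n = below n n ℕ.≤-refl
  where
  open ≡-Reasoning
  top : ∀ h n → p ⋆ θ h ≋ s ⋆ h → ι (suc n) * h (suc n) + (tail p ⋆ θ h) n ≡ (tail s ⋆ h) n
  top h n ode = begin
    ι (suc n) * h (suc n) + (tail p ⋆ θ h) n           ≡⟨ cong (λ y → y + (tail p ⋆ θ h) n) (trans (cong (_* θ h (suc n)) p₀) (*-identityˡ (θ h (suc n)))) ⟨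
    p 0 * θ h (suc n) + (tail p ⋆ θ h) n               ≡⟨ ⋆-suc p (θ h) n ⟨
    (p ⋆ θ h) (suc n)                                  ≡⟨ ode (suc n) ⟩
    (s ⋆ h) (suc n)                                    ≡⟨ ⋆-suc s h n ⟩
    s 0 * h (suc n) + (tail s ⋆ h) n                   ≡⟨ cong (λ y → y + (tail s ⋆ h) n) (trans (cong (_* h (suc n)) s₀) (*-zeroˡ (h (suc n)))) ⟩
    0ℚ + (tail s ⋆ h) n                                ≡⟨ +-identityˡ _ ⟩
    (tail s ⋆ h) n                                     ∎
  below : ∀ n i → i ℕ.≤ n → f i ≡ g i
  below zero    .zero z≤n = start
  below (suc n) i     i≤ with ℕ.m≤n⇒m<n∨m≡n i≤
  ... | inj₁ (s≤s i≤n) = below n i i≤n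
  ... | inj₂ refl      = ι-cancel n (∙-cancelʳ ((tail p ⋆ θ f) n) (ι (suc n) * f (suc n)) (ι (suc n) * g (suc n)) (begin
    ι (suc n) * f (suc n) + (tail p ⋆ θ f) n           ≡⟨ top f n odef ⟩
    (tail s ⋆ f) n                                     ≡⟨ ⋆-cong-≤ n {tail s} (λ _ _ → refl) (below n) ⟩
    (tail s ⋆ g) n                                     ≡⟨ top g n odeg ⟨
    ι (suc n) * g (suc n) + (tail p ⋆ θ g) n           ≡⟨ cong (λ y → ι (suc n) * g (suc n) + y) (⋆-cong-≤ n {tail p} (λ _ _ → refl) λ j j≤n → cong (ι j *_) (below n j j≤n)) ⟨
    ι (suc n) * g (suc n) + (tail p ⋆ θ f) n           ∎))

-- The substitution x ↦ c x. For c = -1 it is the reflection, and the partial sums of `scale R a`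
-- are those of the series `a` at x = R.
scale : ℚ → Power → Power
scale c f n = f n * c ^ n

scale-⋆ : ∀ c f g → scale c (f ⋆ g) ≋ scale c f ⋆ scale c g
scale-⋆ c f g n = begin
  (f ⋆ g) n * c ^ n                                            ≡⟨ *-comm _ (c ^ n) ⟩
  c ^ n * (f ⋆ g) n                                            ≡⟨ Σ-*ˡ n (c ^ n) (λ i → f i * g (n ℕ.∸ i)) ⟨
  Σ[ n ] (λ i → c ^ n * (f i * g (n ℕ.∸ i)))                   ≡⟨ Σ-cong-≤ n split ⟩
  (scale c f ⋆ scale c g) n                                    ∎
  where
  open ≡-Reasoning
  split : ∀ i → i ℕ.≤ n → c ^ n * (f i * g (n ℕ.∸ i)) ≡ scale c f i * scale c g (n ℕ.∸ i)
  split i i≤n = trans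
    (cong (λ m → m * (f i * g (n ℕ.∸ i))) (trans (cong (c ^_) (sym (ℕ.m+[n∸m]≡n i≤n))) (^-homo-* c i (n ℕ.∸ i))))
    (solve 4 (λ a b f g → (a :* b) :* (f :* g) := f :* a :* (g :* b)) refl (c ^ i) (c ^ (n ℕ.∸ i)) (f i) (g (n ℕ.∸ i)))

scale-⊞ : ∀ c f g → scale c (f ⊞ g) ≋ scale c f ⊞ scale c g
scale-⊞ c f g n = *-distribʳ-+ (c ^ n) (f n) (g n)

scale-θ : ∀ c f → scale c (θ f) ≋ θ (scale c f)
scale-θ c f n = *-assoc (ι n) (f n) (c ^ n)

scale-𝟙 : ∀ c → scale c 𝟙 ≋ 𝟙
scale-𝟙 c zero    = refl
scale-𝟙 c (suc n) = *-zeroˡ (c ^ suc n)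

e : Power
e = 𝟙 ⊞ expˢ-1

e≡1/! : ∀ n → e n ≡ 1/! n
e≡1/! zero    = refl
e≡1/! (suc n) = +-identityˡ _

θ-expˢ-1 : θ expˢ-1 ≋ X ⋆ e
θ-expˢ-1 zero    = refl
θ-expˢ-1 (suc n) = begin
  ι (suc n) * 1/! (suc n)              ≡⟨ cong (ι (suc n) *_) (1/!-suc n) ⟩
  ι (suc n) * (1 /1+ n * 1/! n)        ≡⟨ solve 3 (λ a b c → a :* (b :* c) := b :* a :* c) refl (ι (suc n)) (1 /1+ n) (1/! n) ⟩
  1 /1+ n * ι (suc n) * 1/! n          ≡⟨ cong (_* 1/! n) (1/1+-ι n) ⟩
  1ℚ * 1/! n                           ≡⟨ *-identityˡ _ ⟩
  1/! n                                ≡⟨ e≡1/! n ⟨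
  e n                                  ≡⟨ X-⋆ e n ⟨
  (X ⋆ e) (suc n)                      ∎
  where open ≡-Reasoning

-- The series of √(2eˣ - 1) and √(2e⁻ˣ - 1)

-- The coefficient of xᵏ in √(1 + 2x), namely -(-1)ᵏ (2k - 3)!! / k!.
coeff : ℕ → ℚ
coeff k = - 1ℚ * ((- 1ℚ) ^ k * 1/! k * [2 + k ℤ.- + 1 -1]!!)

-- The coefficient of xᵏ in (1 + 2x) y′ = y for y = √(1 + 2x).
coeff-suc : ∀ k → (ι 2 * ι k - 1ℚ) * coeff k + ι (suc k) * coeff (suc k) ≡ 0ℚ
coeff-suc k = begin
  (ι 2 * ι k - 1ℚ) * coeff k + ι (suc k) * coeff (suc k)      ≡⟨ cong (λ y → (ι 2 * ι k - 1ℚ) * coeff k + ι (suc k) * (- 1ℚ * ((- 1ℚ) ^ suc k * y * d (suc k)))) (1/!-suc k) ⟩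
  (ι 2 * ι k - 1ℚ) * (- 1ℚ * (s * r * d k)) + ι (suc k) * (- 1ℚ * ((- 1ℚ * s) * (1 /1+ k * r) * d (suc k)))
    ≡⟨ solve 7 (λ k2 s r dk m i dk′ → k2 :* (con (- 1ℚ) :* (s :* r :* dk)) :+ m :* (con (- 1ℚ) :* ((con (- 1ℚ) :* s) :* (i :* r) :* dk′)) := s :* r :* (i :* m :* dk′ :- k2 :* dk)) refl (ι 2 * ι k - 1ℚ) s r (d k) (ι (suc k)) (1 /1+ k) (d (suc k)) ⟩
  s * r * (1 /1+ k * ι (suc k) * d (suc k) - (ι 2 * ι k - 1ℚ) * d k)      ≡⟨ cong (s * r *_) (trans (cong₂ (λ x y → x * y - (ι 2 * ι k - 1ℚ) * d k) (1/1+-ι k) (d-suc k)) (solve 1 (λ x → con 1ℚ :* x :- x := con 0ℚ) refl ((ι 2 * ι k - 1ℚ) * d k))) ⟩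
  s * r * 0ℚ                                                  ≡⟨ *-zeroʳ (s * r) ⟩
  0ℚ                                                          ∎
  where
  open ≡-Reasoning
  s = (- 1ℚ) ^ k
  r = 1/! k
  d : ℕ → ℚ
  d k = [2 + k ℤ.- + 1 -1]!!
  d-suc : ∀ k → d (suc k) ≡ (ι 2 * ι k - 1ℚ) * d k
  -- The only case that meets (-3)!!: it reads (-1)!! = -(-3)!!.
  d-suc zero    = refl
  d-suc (suc j) = begin
    ι (oddProduct j ℕ.* suc (2 ℕ.* j))                   ≡⟨ trans (ι-* (oddProduct j) (suc (2 ℕ.* j))) (cong (ι (oddProduct j) *_) (trans (ι-+ 1 (2 ℕ.* j)) (cong (λ y → 1ℚ + y) (ι-* 2 j)))) ⟩
    ι (oddProduct j) * (1ℚ + ι 2 * ι j)                  ≡⟨ solve 2 (λ p j → p :* (con 1ℚ :+ con (ι 2) :* j) := (con (ι 2) :* (con 1ℚ :+ j) :- con 1ℚ) :* p) refl (ι (oddProduct j)) (ι j) ⟩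
    (ι 2 * (1ℚ + ι j) - 1ℚ) * ι (oddProduct j)           ≡⟨ cong (λ y → (ι 2 * y - 1ℚ) * ι (oddProduct j)) (ι-+ 1 j) ⟨
    (ι 2 * ι (suc j) - 1ℚ) * ι (oddProduct j)            ∎

q : Power
q = expˢ-1

-- The composition Σ bₖ qᵏ and its differential equation

Vanishes : ℕ → Power → Set
Vanishes k f = ∀ n → n ℕ.< k → f n ≡ 0ℚ

⋆-vanishes : ∀ {f g k} → f 0 ≡ 0ℚ → Vanishes k g → Vanishes (suc k) (f ⋆ g)
⋆-vanishes {f} {g} f₀ h zero    _         = trans (cong (_* g 0) f₀) (*-zeroˡ (g 0))
⋆-vanishes {f} {g} f₀ h (suc n) (s≤s n<k) = begin
  (f ⋆ g) (suc n)                          ≡⟨ ⋆-suc f g n ⟩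
  f 0 * g (suc n) + (tail f ⋆ g) n         ≡⟨ cong₂ _+_ (trans (cong (_* g (suc n)) f₀) (*-zeroˡ (g (suc n)))) (⋆-cong-≤ n {tail f} (λ _ _ → refl) λ i i≤n → h i (ℕ.≤-<-trans i≤n n<k)) ⟩
  0ℚ + (tail f ⋆ 𝟘) n                      ≡⟨ trans (+-identityˡ ((tail f ⋆ 𝟘) n)) (trans (⋆-comm (tail f) 𝟘 n) (⋆-zeroˡ (tail f) n)) ⟩
  0ℚ                                       ∎
  where open ≡-Reasoning

^ˢ-vanishes : ∀ k → Vanishes k (q ^ˢ k)
^ˢ-vanishes zero    n ()
^ˢ-vanishes (suc k) = ⋆-vanishes {q} refl (^ˢ-vanishes k)

^ˢ-zero : q ^ˢ 0 ≋ 𝟙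
^ˢ-zero zero    = refl
^ˢ-zero (suc _) = refl

θ-^ˢ : ∀ k → θ (q ^ˢ suc k) ≋ const (ι (suc k)) ⋆ (q ^ˢ k) ⋆ θ q
θ-^ˢ zero    = begin
  θ (q ⋆ q ^ˢ 0)                                 ≈⟨ θ-cong (transˢ (Ps.*-congˡ {q} ^ˢ-zero) (transˢ (Ps.*-comm q 𝟙) (Ps.*-identityˡ q))) ⟩
  θ q                                            ≈⟨ transˢ (Ps.*-identityˡ (𝟙 ⋆ θ q)) (Ps.*-identityˡ (θ q)) ⟨
  𝟙 ⋆ (𝟙 ⋆ θ q)                                  ≈⟨ Ps.*-assoc 𝟙 𝟙 (θ q) ⟨
  𝟙 ⋆ 𝟙 ⋆ θ q                                    ≈⟨ Ps.*-congʳ {θ q} (Ps.*-cong const-1 ^ˢ-zero) ⟨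
  const (ι 1) ⋆ (q ^ˢ 0) ⋆ θ q                   ∎
  where open ≋-Reasoning
θ-^ˢ (suc k) = begin
  θ (q ⋆ A)                                                          ≈⟨ θ-⋆ q A ⟩
  θ q ⋆ A ⊞ q ⋆ θ A                                                  ≈⟨ Ps.+-congˡ {θ q ⋆ A} (Ps.*-congˡ {q} (θ-^ˢ k)) ⟩
  θ q ⋆ (q ⋆ B) ⊞ q ⋆ (const (ι (suc k)) ⋆ B ⋆ θ q)                  ≈⟨ Ps.solve 4 (λ t q b c → t Ps.:* (q Ps.:* b) Ps.:+ q Ps.:* (c Ps.:* b Ps.:* t) Ps.:= (Ps.con 1 Ps.:+ c) Ps.:* (q Ps.:* b) Ps.:* t) reflˢ (θ q) q B (const (ι (suc k))) ⟩
  (𝟙 ⊞ const (ι (suc k))) ⋆ A ⋆ θ q                                  ≈⟨ Ps.*-congʳ {θ q} (Ps.*-congʳ {A} (transˢ (Ps.+-congʳ {const (ι (suc k))} (symˢ const-1)) (symˢ (const-+ 1ℚ (ι (suc k)))))) ⟩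
  const (1ℚ + ι (suc k)) ⋆ A ⋆ θ q                                   ≈⟨ Ps.*-congʳ {θ q} (Ps.*-congʳ {A} λ n → cong (λ c → const c n) (ι-+ 1 (suc k))) ⟨
  const (ι (suc (suc k))) ⋆ A ⋆ θ q                                  ∎
  where
  open ≋-Reasoning
  A = q ^ˢ suc k
  B = q ^ˢ k

-- Formed with the operations of the series ring so that `Ps.solve` applies; `partial-Σ` gives the
-- coefficients.
partial : ℕ → Power
partial zero    = const (coeff 0) ⋆ q ^ˢ 0
partial (suc M) = partial M ⊞ const (coeff (suc M)) ⋆ q ^ˢ suc M

p : Power
p = 𝟙 ⊞ (q ⊞ q)

-- The partial sum of Σ bₖ qᵏ up to M misses the equation of g only by
-- edge M · qᴹ θq, which vanishes in degrees at most M.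
edge : ℕ → ℚ
edge M = (ι 2 * ι M - 1ℚ) * coeff M

coeff-edge : ∀ M → coeff M + edge M ≡ ι M * coeff M + ι M * coeff M
coeff-edge M = solve 2 (λ c m → c :+ (con (ι 2) :* m :- con 1ℚ) :* c := m :* c :+ m :* c) refl (coeff M) (ι M)

-- The new term b qᴹ⁺¹ contributes m qᴹ θq + 2m qᴹ⁺¹ θq on the left, where m = (M + 1) b. The first
-- part cancels the old edge by `coeff-suc`; by `coeff-edge` the second is b qᴹ⁺¹ θq plus the new
-- edge.
partial-ode : ∀ M → p ⋆ θ (partial M) ≋ (partial M ⊞ const (edge M) ⋆ q ^ˢ M) ⋆ θ q
partial-ode zero    = begin
  p ⋆ θ (const (coeff 0) ⋆ q ^ˢ 0)                                    ≈⟨ Ps.*-congˡ {p} (transˢ (θ-const-⋆ (coeff 0) (q ^ˢ 0)) (transˢ (Ps.*-congˡ {const (coeff 0)} (transˢ (θ-cong (transˢ ^ˢ-zero (symˢ const-1))) (θ-const 1ℚ))) (transˢ (Ps.*-comm (const (coeff 0)) 𝟘) (Ps.zeroˡ (const (coeff 0)))))) ⟩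
  p ⋆ 𝟘                                                               ≈⟨ transˢ (Ps.*-comm p 𝟘) (Ps.zeroˡ p) ⟩
  𝟘                                                                   ≈⟨ Ps.zeroˡ (q ^ˢ 0 ⋆ θ q) ⟨
  -- `edge 0` is the negative of `coeff 0`.
  𝟘 ⋆ (q ^ˢ 0 ⋆ θ q)                                                  ≈⟨ Ps.*-congʳ {q ^ˢ 0 ⋆ θ q} {const (coeff 0) ⊞ const (edge 0)} {𝟘} (λ { zero → refl ; (suc n) → refl }) ⟨
  (const (coeff 0) ⊞ const (edge 0)) ⋆ (q ^ˢ 0 ⋆ θ q)                 ≈⟨ Ps.solve 4 (λ c d a t → (c Ps.:+ d) Ps.:* (a Ps.:* t) Ps.:= (c Ps.:* a Ps.:+ d Ps.:* a) Ps.:* t) reflˢ (const (coeff 0)) (const (edge 0)) (q ^ˢ 0) (θ q) ⟩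
  (partial 0 ⊞ const (edge 0) ⋆ q ^ˢ 0) ⋆ θ q                         ∎
  where open ≋-Reasoning
partial-ode (suc M) = begin
  p ⋆ θ (G ⊞ const b′ ⋆ (q ⋆ A))                                      ≈⟨ Ps.*-congˡ {p} (transˢ (θ-⊞ G (const b′ ⋆ (q ⋆ A))) (Ps.+-congˡ {θ G} (transˢ (θ-const-⋆ b′ (q ⋆ A)) (transˢ (Ps.*-congˡ {const b′} (θ-^ˢ M)) regroup)))) ⟩
  p ⋆ (θ G ⊞ const m ⋆ (A ⋆ t))                                       ≈⟨ Ps.solve 4 (λ q g m at → (Ps.con 1 Ps.:+ (q Ps.:+ q)) Ps.:* (g Ps.:+ m Ps.:* at) Ps.:= (Ps.con 1 Ps.:+ (q Ps.:+ q)) Ps.:* g Ps.:+ (m Ps.:* at Ps.:+ (m Ps.:+ m) Ps.:* (q Ps.:* at))) reflˢ q (θ G) (const m) (A ⋆ t) ⟩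
  p ⋆ θ G ⊞ (const m ⋆ (A ⋆ t) ⊞ (const m ⊞ const m) ⋆ (q ⋆ (A ⋆ t)))   ≈⟨ Ps.+-cong (partial-ode M) (Ps.+-congˡ {const m ⋆ (A ⋆ t)} (Ps.*-congʳ {q ⋆ (A ⋆ t)} double)) ⟩
  (G ⊞ const c ⋆ A) ⋆ t ⊞ (const m ⋆ (A ⋆ t) ⊞ (const b′ ⊞ const c′) ⋆ (q ⋆ (A ⋆ t)))     ≈⟨ Ps.solve 8 (λ g c a t m b c′ q → (g Ps.:+ c Ps.:* a) Ps.:* t Ps.:+ (m Ps.:* (a Ps.:* t) Ps.:+ (b Ps.:+ c′) Ps.:* (q Ps.:* (a Ps.:* t))) Ps.:= (c Ps.:+ m) Ps.:* (a Ps.:* t) Ps.:+ (g Ps.:+ b Ps.:* (q Ps.:* a) Ps.:+ c′ Ps.:* (q Ps.:* a)) Ps.:* t) reflˢ G (const c) A t (const m) (const b′) (const c′) q ⟩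
  (const c ⊞ const m) ⋆ (A ⋆ t) ⊞ (G ⊞ const b′ ⋆ (q ⋆ A) ⊞ const c′ ⋆ (q ⋆ A)) ⋆ t       ≈⟨ Ps.+-congʳ {goal} (transˢ (Ps.*-congʳ {A ⋆ t} cancel) (Ps.zeroˡ (A ⋆ t))) ⟩
  𝟘 ⊞ goal                                                             ≈⟨ Ps.+-identityˡ goal ⟩
  goal                                                                 ∎
  where
  open ≋-Reasoning
  G = partial M
  A = q ^ˢ M
  t = θ q
  b′ = coeff (suc M)
  c = edge M
  c′ = edge (suc M)
  m = ι (suc M) * b′
  goal = (G ⊞ const b′ ⋆ (q ⋆ A) ⊞ const c′ ⋆ (q ⋆ A)) ⋆ t
  const-* : ∀ u v → const u ⋆ const v ≋ const (u * v)
  const-* u v zero    = refl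
  const-* u v (suc n) = trans (const-⋆ u (const v) (suc n)) (*-zeroʳ u)
  regroup : const b′ ⋆ (const (ι (suc M)) ⋆ A ⋆ t) ≋ const m ⋆ (A ⋆ t)
  regroup = transˢ (Ps.solve 4 (λ b i a t → b Ps.:* (i Ps.:* a Ps.:* t) Ps.:= (i Ps.:* b) Ps.:* (a Ps.:* t)) reflˢ (const b′) (const (ι (suc M))) A t) (Ps.*-congʳ {A ⋆ t} (const-* (ι (suc M)) b′))
  double : const m ⊞ const m ≋ const b′ ⊞ const c′
  double = transˢ (symˢ (const-+ m m)) (transˢ (λ n → cong (λ u → const u n) (sym (coeff-edge (suc M)))) (const-+ b′ c′))
  cancel : const c ⊞ const m ≋ 𝟘
  cancel = transˢ (symˢ (const-+ c m)) (transˢ (λ n → cong (λ u → const u n) (coeff-suc M)) const-0)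

partial-Σ : ∀ M n → partial M n ≡ Σ[ M ] λ k → coeff k * (q ^ˢ k) n
partial-Σ zero    n = const-⋆ (coeff 0) (q ^ˢ 0) n
partial-Σ (suc M) n = cong₂ _+_ (partial-Σ M n) (const-⋆ (coeff (suc M)) (q ^ˢ suc M) n)

-- Stopping at k = n loses nothing: q has no constant term, so qᵏ vanishes in degree n for k > n.
g : Power
g n = Σ[ n ] λ k → coeff k * (q ^ˢ k) n

partial-stable : ∀ {M} n → n ℕ.≤ M → partial M n ≡ g n
partial-stable {M} n n≤M = trans (partial-Σ M n) (≤-induction (λ M → Σ[ M ] (λ k → coeff k * (q ^ˢ k) n) ≡ g n) refl
  (λ m n≤m h → trans (cong₂ _+_ h (trans (cong (coeff (suc m) *_) (^ˢ-vanishes (suc m) n (s≤s n≤m))) (*-zeroʳ (coeff (suc m))))) (+-identityʳ (g n))) M n≤M)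

-- Degree n of either side involves only coefficients up to n, where g agrees with `partial n`. The
-- edge term drops out because θq, having no constant term, raises the order of qⁿ to n + 1.
g-ode : p ⋆ θ g ≋ g ⋆ θ q
g-ode n = begin
  (p ⋆ θ g) n                                                              ≡⟨ ⋆-cong-≤ n {p} (λ _ _ → refl) (λ i i≤n → cong (ι i *_) (partial-stable i i≤n)) ⟨
  (p ⋆ θ (partial n)) n                                                    ≡⟨ partial-ode n n ⟩
  ((partial n ⊞ const (edge n) ⋆ q ^ˢ n) ⋆ θ q) n                          ≡⟨ Ps.solve 4 (λ g c a t → (g Ps.:+ c Ps.:* a) Ps.:* t Ps.:= g Ps.:* t Ps.:+ c Ps.:* (t Ps.:* a)) reflˢ (partial n) (const (edge n)) (q ^ˢ n) (θ q) n ⟩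
  (partial n ⋆ θ q) n + (const (edge n) ⋆ (θ q ⋆ q ^ˢ n)) n                ≡⟨ cong₂ _+_ (⋆-cong-≤ n {g = θ q} partial-stable (λ _ _ → refl)) (trans (const-⋆ (edge n) (θ q ⋆ q ^ˢ n) n) (trans (cong (edge n *_) (⋆-vanishes {θ q} refl (^ˢ-vanishes n) n ℕ.≤-refl)) (*-zeroʳ (edge n)))) ⟩
  (g ⋆ θ q) n + 0ℚ                                                         ≡⟨ +-identityʳ _ ⟩
  (g ⋆ θ q) n                                                              ∎
  where open ≡-Reasoning

θ-p : θ p ≋ θ q ⊞ θ q
θ-p = transˢ (θ-⊞ 𝟙 (q ⊞ q)) (transˢ (Ps.+-cong (transˢ (θ-cong (symˢ const-1)) (θ-const 1ℚ)) (θ-⊞ q q)) (Ps.+-identityˡ (θ q ⊞ θ q)))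

-- Both sides satisfy p θy = 2 θq y and have constant term 1.
g² : g ⋆ g ≋ p
g² = linear-ode-unique {p} {θ q ⊞ θ q} refl refl refl
  (begin
    p ⋆ θ (g ⋆ g)                        ≈⟨ Ps.*-congˡ {p} (θ-⋆ g g) ⟩
    p ⋆ (θ g ⋆ g ⊞ g ⋆ θ g)              ≈⟨ Ps.solve 3 (λ p g t → p Ps.:* (t Ps.:* g Ps.:+ g Ps.:* t) Ps.:= (Ps.con 2 Ps.:* g) Ps.:* (p Ps.:* t)) reflˢ p g (θ g) ⟩
    (𝟙 ⊞ 𝟙) ⋆ g ⋆ (p ⋆ θ g)              ≈⟨ Ps.*-congˡ {(𝟙 ⊞ 𝟙) ⋆ g} g-ode ⟩
    (𝟙 ⊞ 𝟙) ⋆ g ⋆ (g ⋆ θ q)              ≈⟨ Ps.solve 2 (λ g t → Ps.con 2 Ps.:* g Ps.:* (g Ps.:* t) Ps.:= (t Ps.:+ t) Ps.:* (g Ps.:* g)) reflˢ g (θ q) ⟩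
    (θ q ⊞ θ q) ⋆ (g ⋆ g)                ∎)
  (transˢ (Ps.*-congˡ {p} θ-p) (Ps.*-comm p (θ q ⊞ θ q)))
  where open ≋-Reasoning

-- The reflected series and its recurrence

f : Power
f = scale (- 1ℚ) g

q̄ ē : Power
q̄ = scale (- 1ℚ) q
ē = 𝟙 ⊞ q̄

scale-p : scale (- 1ℚ) p ≋ 𝟙 ⊞ (q̄ ⊞ q̄)
scale-p = transˢ (scale-⊞ (- 1ℚ) 𝟙 (q ⊞ q)) (Ps.+-cong (scale-𝟙 (- 1ℚ)) (scale-⊞ (- 1ℚ) q q))

scale-e : scale (- 1ℚ) e ≋ ē
scale-e = transˢ (scale-⊞ (- 1ℚ) 𝟙 q) (Ps.+-congʳ {q̄} (scale-𝟙 (- 1ℚ)))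

f² : f ⋆ f ≋ 𝟙 ⊞ (q̄ ⊞ q̄)
f² = transˢ (symˢ (scale-⋆ (- 1ℚ) g g)) (transˢ (λ n → cong (_* (- 1ℚ) ^ n) (g² n)) scale-p)

θ-𝟙⊞ : ∀ h → θ (𝟙 ⊞ h) ≋ θ h
θ-𝟙⊞ h = transˢ (θ-⊞ 𝟙 h) (transˢ (Ps.+-congʳ {θ h} (transˢ (θ-cong (symˢ const-1)) (θ-const 1ℚ))) (Ps.+-identityˡ (θ h)))

θ-q̄ : θ q̄ ≋ (⊟ X) ⋆ ē
θ-q̄ = transˢ (symˢ (scale-θ (- 1ℚ) q)) (transˢ (λ n → cong (_* (- 1ℚ) ^ n) (θ-expˢ-1 n)) (transˢ (scale-⋆ (- 1ℚ) X e) (Ps.*-cong scale-X scale-e)))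
  where
  scale-X : scale (- 1ℚ) X ≋ ⊟ X
  scale-X zero          = refl
  scale-X (suc zero)    = refl
  scale-X (suc (suc n)) = *-zeroˡ ((- 1ℚ) ^ suc (suc n))

-- Since θe = x e and θē = -x ē, the product is annihilated by θ, as is 1.
e⋆ē : e ⋆ ē ≋ 𝟙
e⋆ē = linear-ode-unique {𝟙} {𝟘} refl refl refl
  (begin
    𝟙 ⋆ θ (e ⋆ ē)                              ≈⟨ transˢ (Ps.*-identityˡ (θ (e ⋆ ē))) (θ-⋆ e ē) ⟩
    θ e ⋆ ē ⊞ e ⋆ θ ē                          ≈⟨ Ps.+-cong (Ps.*-congʳ {ē} (transˢ (θ-𝟙⊞ q) θ-expˢ-1)) (Ps.*-congˡ {e} (transˢ (θ-𝟙⊞ q̄) θ-q̄)) ⟩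
    X ⋆ e ⋆ ē ⊞ e ⋆ ((⊟ X) ⋆ ē)                ≈⟨ Ps.solve 4 (λ x y e e′ → x Ps.:* e Ps.:* e′ Ps.:+ e Ps.:* (y Ps.:* e′) Ps.:= (y Ps.:+ x) Ps.:* (e Ps.:* e′)) reflˢ X (⊟ X) e ē ⟩
    (⊟ X ⊞ X) ⋆ (e ⋆ ē)                        ≈⟨ Ps.*-congʳ {e ⋆ ē} (Ps.-‿inverseˡ X) ⟩
    𝟘 ⋆ (e ⋆ ē)                                ∎)
  (transˢ (Ps.*-identityˡ (θ 𝟙)) (transˢ (θ-cong (symˢ const-1)) (transˢ (θ-const 1ℚ) (symˢ (Ps.zeroˡ 𝟙)))))
  where open ≋-Reasoning

f-ode : θ f ≋ (⊟ X) ⋆ f ⊞ q ⋆ θ f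
f-ode = begin
  θ f                                                ≈⟨ Ps.*-identityˡ (θ f) ⟨
  𝟙 ⋆ θ f                                            ≈⟨ Ps.*-congʳ {θ f} unit ⟨
  (e ⋆ p̄ ⊞ q) ⋆ θ f                                  ≈⟨ Ps.solve 4 (λ e p q t → (e Ps.:* p Ps.:+ q) Ps.:* t Ps.:= e Ps.:* (p Ps.:* t) Ps.:+ q Ps.:* t) reflˢ e p̄ q (θ f) ⟩
  e ⋆ (p̄ ⋆ θ f) ⊞ q ⋆ θ f                            ≈⟨ Ps.+-congʳ {q ⋆ θ f} (Ps.*-congˡ {e} (transˢ scaled-ode (Ps.*-congˡ {f} θ-q̄))) ⟩
  e ⋆ (f ⋆ ((⊟ X) ⋆ ē)) ⊞ q ⋆ θ f                    ≈⟨ Ps.+-congʳ {q ⋆ θ f} (Ps.solve 4 (λ e f x e′ → e Ps.:* (f Ps.:* (x Ps.:* e′)) Ps.:= (e Ps.:* e′) Ps.:* (x Ps.:* f)) reflˢ e f (⊟ X) ē) ⟩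
  (e ⋆ ē) ⋆ ((⊟ X) ⋆ f) ⊞ q ⋆ θ f                    ≈⟨ Ps.+-congʳ {q ⋆ θ f} (transˢ (Ps.*-congʳ {(⊟ X) ⋆ f} e⋆ē) (Ps.*-identityˡ ((⊟ X) ⋆ f))) ⟩
  (⊟ X) ⋆ f ⊞ q ⋆ θ f                                ∎
  where
  open ≋-Reasoning
  p̄ = 𝟙 ⊞ (q̄ ⊞ q̄)
  scaled-ode : p̄ ⋆ θ f ≋ f ⋆ θ q̄
  scaled-ode = begin
    p̄ ⋆ θ f                                  ≈⟨ Ps.*-cong scale-p (scale-θ (- 1ℚ) g) ⟨
    scale (- 1ℚ) p ⋆ scale (- 1ℚ) (θ g)      ≈⟨ scale-⋆ (- 1ℚ) p (θ g) ⟨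
    scale (- 1ℚ) (p ⋆ θ g)                   ≈⟨ (λ n → cong (_* (- 1ℚ) ^ n) (g-ode n)) ⟩
    scale (- 1ℚ) (g ⋆ θ q)                   ≈⟨ scale-⋆ (- 1ℚ) g (θ q) ⟩
    f ⋆ scale (- 1ℚ) (θ q)                   ≈⟨ Ps.*-congˡ {f} (scale-θ (- 1ℚ) q) ⟩
    f ⋆ θ q̄                                  ∎
  unit : e ⋆ p̄ ⊞ q ≋ 𝟙
  -- Adding 1 to both sides leaves an identity free of subtraction, as the semiring solver requires:
  -- e p̄ + q + 1 = 2 e ē.
  unit = Ps.+-cancelʳ 𝟙 (e ⋆ p̄ ⊞ q) 𝟙 (begin
    e ⋆ p̄ ⊞ q ⊞ 𝟙                  ≈⟨ Ps.solve 2 (λ q r → (Ps.con 1 Ps.:+ q) Ps.:* (Ps.con 1 Ps.:+ (r Ps.:+ r)) Ps.:+ q Ps.:+ Ps.con 1 Ps.:= Ps.con 2 Ps.:* ((Ps.con 1 Ps.:+ q) Ps.:* (Ps.con 1 Ps.:+ r))) reflˢ q q̄ ⟩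
    (𝟙 ⊞ 𝟙) ⋆ (e ⋆ ē)              ≈⟨ Ps.*-congˡ {𝟙 ⊞ 𝟙} e⋆ē ⟩
    (𝟙 ⊞ 𝟙) ⋆ 𝟙                    ≈⟨ transˢ (Ps.*-comm (𝟙 ⊞ 𝟙) 𝟙) (Ps.*-identityˡ (𝟙 ⊞ 𝟙)) ⟩
    𝟙 ⊞ 𝟙                          ∎)

v : Power
v = ⊟ θ f

v-ode : v ≋ X ⋆ f ⊞ q ⋆ v
v-ode n = begin
  - θ f n                                      ≡⟨ cong -_ (f-ode n) ⟩
  - (((⊟ X) ⋆ f) n + (q ⋆ θ f) n)              ≡⟨ neg-distrib-+ (((⊟ X) ⋆ f) n) ((q ⋆ θ f) n) ⟩
  - ((⊟ X) ⋆ f) n - (q ⋆ θ f) n                ≡⟨ cong₂ _+_ (cong -_ (sym (-‿distribˡ-* X f n))) (-‿distribʳ-* q (θ f) n) ⟩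
  - - (X ⋆ f) n + (q ⋆ v) n                    ≡⟨ cong (λ y → y + (q ⋆ v) n) (solve 1 (λ x → :- :- x := x) refl ((X ⋆ f) n)) ⟩
  (X ⋆ f) n + (q ⋆ v) n                        ∎
  where
  open ≡-Reasoning
  open import Algebra.Properties.Ring (CommutativeRing.ring powerSeriesRing) using (-‿distribˡ-*; -‿distribʳ-*)

-- The n! in `S n k` cancels `1/! n`. Of the sign (-1)ⁿ⁺¹, one factor -1 goes into `coeff k`, and
-- the remaining (-1)ⁿ is the reflection.
f-coefficient : ∀ n → (- 1ℚ) ^ suc n * ∑ _+_ n (λ k → (- 1ℚ) ^ k * S n k * [2 + k ℤ.- + 1 -1]!!) * 1/! n ≡ f n
f-coefficient n = begin
  - 1ℚ * s * Σ[ n ] c * 1/! n                               ≡⟨ solve 4 (λ m s c r → m :* s :* c :* r := (m :* r :* c) :* s) refl (- 1ℚ) s (Σ[ n ] c) (1/! n) ⟩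
  (- 1ℚ * 1/! n) * Σ[ n ] c * s                             ≡⟨ cong (_* s) (trans (sym (Σ-*ˡ n (- 1ℚ * 1/! n) c)) (Σ-cong n term)) ⟩
  g n * s                                                   ∎
  where
  open ≡-Reasoning
  s = (- 1ℚ) ^ n
  c : ℕ → ℚ
  c k = (- 1ℚ) ^ k * S n k * [2 + k ℤ.- + 1 -1]!!
  term : ∀ k → - 1ℚ * 1/! n * c k ≡ coeff k * (q ^ˢ k) n
  term k = begin
    - 1ℚ * 1/! n * ((- 1ℚ) ^ k * (ι (n !) * (1/! k * (q ^ˢ k) n)) * d)         ≡⟨ solve 7 (λ m r s i k a d → m :* r :* (s :* (i :* (k :* a)) :* d) := (r :* i) :* (m :* (s :* k :* d) :* a)) refl (- 1ℚ) (1/! n) ((- 1ℚ) ^ k) (ι (n !)) (1/! k) ((q ^ˢ k) n) d ⟩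
    (1/! n * ι (n !)) * (coeff k * (q ^ˢ k) n)                                 ≡⟨ cong (_* (coeff k * (q ^ˢ k) n)) (1/!-ι n) ⟩
    1ℚ * (coeff k * (q ^ˢ k) n)                                                ≡⟨ *-identityˡ _ ⟩
    coeff k * (q ^ˢ k) n                                                       ∎
    where d = [2 + k ℤ.- + 1 -1]!!

-- Bounds for partial sums on the positive real axis

f-suc : ∀ n → f (suc n) ≡ - (1 /1+ n * v (suc n))
f-suc n = begin
  f (suc n)                                      ≡⟨ *-identityˡ (f (suc n)) ⟨
  1ℚ * f (suc n)                                 ≡⟨ cong (_* f (suc n)) (1/1+-ι n) ⟨
  1 /1+ n * ι (suc n) * f (suc n)                ≡⟨ solve 3 (λ a b c → a :* b :* c := :- (a :* (:- (b :* c)))) refl (1 /1+ n) (ι (suc n)) (f (suc n)) ⟩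
  - (1 /1+ n * v (suc n))                        ∎
  where open ≡-Reasoning

p≤q⇒0≤q-p : ∀ {p q} → p ≤ q → 0ℚ ≤ q - p
p≤q⇒0≤q-p {p} {q} p≤q = subst (_≤ q - p) (+-inverseʳ p) (+-monoˡ-≤ (- p) p≤q)

Σ-nonNeg : ∀ n {a} → (∀ i → i ℕ.≤ n → 0ℚ ≤ a i) → 0ℚ ≤ Σ[ n ] a
Σ-nonNeg zero    h = h 0 z≤n
Σ-nonNeg (suc n) h = +-nonNeg (Σ-nonNeg n λ i i≤n → h i (ℕ.m≤n⇒m≤1+n i≤n)) (h (suc n) ℕ.≤-refl)

Σ-mono : ∀ n {a b} → (∀ i → i ℕ.≤ n → a i ≤ b i) → Σ[ n ] a ≤ Σ[ n ] b
Σ-mono zero    h = h 0 z≤n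
Σ-mono (suc n) h = +-mono-≤ (Σ-mono n λ i i≤n → h i (ℕ.m≤n⇒m≤1+n i≤n)) (h (suc n) ℕ.≤-refl)

Σ-extend : ∀ {a} → (∀ i → 0ℚ ≤ a i) → ∀ {n m} → n ℕ.≤ m → Σ[ n ] a ≤ Σ[ m ] a
Σ-extend {a} h {n} {m} = ≤-induction (λ m → Σ[ n ] a ≤ Σ[ m ] a) ≤-refl (λ m _ le → ≤-trans le (p≤p+q (h (suc m)))) m

-- In the recurrence for v of index m + 2 the only possibly negative summand is f of index m + 1,
-- which is -1/(m + 1) times v of index m + 1. The linear coefficient 1 of q supplies v of that
-- index once, which absorbs it; all other summands are nonnegative by induction.
0≤v : ∀ n → 0ℚ ≤ v n
0≤v n = below n n ℕ.≤-refl
  where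
  0≤⋆ : ∀ {a b} n → (∀ i → 0ℚ ≤ a i) → (∀ i → i ℕ.≤ n → 0ℚ ≤ b i) → 0ℚ ≤ (a ⋆ b) n
  0≤⋆ n 0≤a 0≤b = Σ-nonNeg n λ i i≤n → *-nonNeg (0≤a i) (0≤b (n ℕ.∸ i) (ℕ.m∸n≤m n i))
  v-suc : ∀ n → v (suc n) ≡ f n + (tail q ⋆ v) n
  v-suc n = trans (v-ode (suc n)) (cong₂ _+_ (X-⋆ f n) (trans (⋆-suc q v n) (trans (cong (λ y → y + (tail q ⋆ v) n) (*-zeroˡ (v (suc n)))) (+-identityˡ _))))
  below : ∀ n i → i ℕ.≤ n → 0ℚ ≤ v i
  below zero    .zero z≤n = ≤-refl
  below (suc n) i     i≤ with ℕ.m≤n⇒m<n∨m≡n i≤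
  below (suc n)       i     i≤ | inj₁ (s≤s i≤n) = below n i i≤n
  below (suc zero)    .1    i≤ | inj₂ refl = subst (0ℚ ≤_) (sym (v-suc 0)) (<⇒≤ 0<1)
  below (suc (suc m)) .(suc (suc m)) i≤ | inj₂ refl = subst (0ℚ ≤_) (sym eq)
    (+-nonNeg (*-nonNeg (p≤q⇒0≤q-p (1/1+≤1 m)) (below (suc m) (suc m) ℕ.≤-refl))
              (0≤⋆ m (λ i → 0≤1/! (suc (suc i))) λ i i≤m → below (suc m) i (ℕ.m≤n⇒m≤1+n i≤m)))
    where
    open ≡-Reasoning
    r = (tail (tail q) ⋆ v) m
    eq : v (suc (suc m)) ≡ (1ℚ - 1 /1+ m) * v (suc m) + r
    eq = begin
      v (suc (suc m))                                            ≡⟨ v-suc (suc m) ⟩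
      f (suc m) + (tail q ⋆ v) (suc m)                           ≡⟨ cong₂ _+_ (f-suc m) (⋆-suc (tail q) v m) ⟩
      - (1 /1+ m * v (suc m)) + (1ℚ * v (suc m) + r)             ≡⟨ solve 3 (λ i v r → :- (i :* v) :+ (con 1ℚ :* v :+ r) := (con 1ℚ :- i) :* v :+ r) refl (1 /1+ m) (v (suc m)) r ⟩
      (1ℚ - 1 /1+ m) * v (suc m) + r                             ∎

f-suc≤0 : ∀ n → f (suc n) ≤ 0ℚ
f-suc≤0 n = ≤-trans (≤-reflexive (f-suc n)) (neg-antimono-≤ (*-nonNeg (0≤/1+ 1 n) (0≤v (suc n))))

∣f∣-ι : ∀ n → ι n * ∣ f n ∣ ≡ v n
∣f∣-ι n = begin
  ι n * ∣ f n ∣          ≡⟨ cong (_* ∣ f n ∣) (0≤p⇒∣p∣≡p (0≤ι n)) ⟨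
  ∣ ι n ∣ * ∣ f n ∣      ≡⟨ ∣p*q∣≡∣p∣*∣q∣ (ι n) (f n) ⟨
  ∣ ι n * f n ∣          ≡⟨ ∣-p∣≡∣p∣ (ι n * f n) ⟨
  ∣ v n ∣                ≡⟨ 0≤p⇒∣p∣≡p (0≤v n) ⟩
  v n                    ∎
  where open ≡-Reasoning

Σ-⋆-≤ : ∀ n {a b} → (∀ i → 0ℚ ≤ a i) → (∀ i → 0ℚ ≤ b i) → Σ[ n ] (a ⋆ b) ≤ Σ[ n ] a * Σ[ n ] b
Σ-⋆-≤ n {a} {b} 0≤a 0≤b = begin
  Σ[ n ] (a ⋆ b)                              ≡⟨ Σ-⋆ n a b ⟩
  Σ[ n ] (λ i → a i * Σ[ n ℕ.∸ i ] b)         ≤⟨ Σ-mono n (λ i _ → *-monoˡ (0≤a i) (Σ-extend 0≤b (ℕ.m∸n≤m n i))) ⟩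
  Σ[ n ] (λ i → a i * Σ[ n ] b)               ≡⟨ trans (Σ-cong n λ i → *-comm (a i) (Σ[ n ] b)) (Σ-*ˡ n (Σ[ n ] b) a) ⟩
  Σ[ n ] b * Σ[ n ] a                         ≡⟨ *-comm (Σ[ n ] b) (Σ[ n ] a) ⟩
  Σ[ n ] a * Σ[ n ] b                         ∎
  where open ≤-Reasoning

-- `E≤` is the form in which R < ln 2 is used: all partial sums of e^R stay below 2 by η, hence
-- those of q(R) are at most 1 - η (`Q≤`).
module Majorant (R η : ℚ) (0<R : 0ℚ < R) (0<η : 0ℚ < η) (E≤ : ∀ n → E n R + η ≤ 2ℚ) where
  open ≤-Reasoning

  0≤R : 0ℚ ≤ R
  0≤R = <⇒≤ 0<R
  0≤η : 0ℚ ≤ η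
  0≤η = <⇒≤ 0<η

  -- Partial sums at x = R of f, v, q and of the series of absolute values of f.
  F W Q T : ℕ → ℚ
  F n = Σ[ n ] (scale R f)
  W n = Σ[ n ] (scale R v)
  Q n = Σ[ n ] (scale R q)

  t : ℕ → ℚ
  t n = ∣ f n ∣ * R ^ n
  T n = Σ[ n ] t

  0≤t : ∀ n → 0ℚ ≤ t n
  0≤t n = *-nonNeg (0≤∣p∣ (f n)) (0≤^ 0≤R n)

  0≤T : ∀ n → 0ℚ ≤ T n
  0≤T n = Σ-nonNeg n λ i _ → 0≤t i

  0≤v̂ : ∀ n → 0ℚ ≤ scale R v n
  0≤v̂ n = *-nonNeg (0≤v n) (0≤^ 0≤R n)

  0≤W : ∀ n → 0ℚ ≤ W n
  0≤W n = Σ-nonNeg n λ i _ → 0≤v̂ i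

  ι-t : ∀ n → ι n * t n ≡ scale R v n
  ι-t n = trans (sym (*-assoc (ι n) (∣ f n ∣) (R ^ n))) (cong (_* R ^ n) (∣f∣-ι n))

  Q+1 : ∀ n → Q n + 1ℚ ≡ E n R
  Q+1 zero    = refl
  Q+1 (suc n) = trans (solve 2 (λ a b → a :+ b :+ con 1ℚ := a :+ con 1ℚ :+ b) refl (Q n) (scale R q (suc n))) (cong (λ y → y + D R (suc n)) (Q+1 n))

  Q≤ : ∀ n → Q n ≤ 1ℚ - η
  Q≤ n = begin
    Q n                      ≡⟨ solve 2 (λ a b → a := a :+ con 1ℚ :+ b :- con 1ℚ :- b) refl (Q n) η ⟩
    Q n + 1ℚ + η - 1ℚ - η    ≡⟨ cong (λ y → y + η - 1ℚ - η) (Q+1 n) ⟩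
    E n R + η - 1ℚ - η       ≤⟨ +-monoˡ-≤ (- η) (+-monoˡ-≤ (- 1ℚ) (E≤ n)) ⟩
    2ℚ - 1ℚ - η              ≡⟨⟩
    1ℚ - η                   ∎

  Σ-X-⋆ : ∀ n → Σ[ suc n ] (scale R (X ⋆ f)) ≡ R * F n
  Σ-X-⋆ n = begin-equality
    Σ[ suc n ] (scale R (X ⋆ f))                           ≡⟨ Σ-head n (scale R (X ⋆ f)) ⟩
    0ℚ + Σ[ n ] (λ i → scale R (X ⋆ f) (suc i))            ≡⟨ +-identityˡ _ ⟩
    Σ[ n ] (λ i → scale R (X ⋆ f) (suc i))                 ≡⟨ Σ-cong n (λ i → trans (cong (_* R ^ suc i) (X-⋆ f i)) (solve 3 (λ a b c → a :* (b :* c) := b :* (a :* c)) refl (f i) R (R ^ i))) ⟩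
    Σ[ n ] (λ i → R * scale R f i)                         ≡⟨ Σ-*ˡ n R (scale R f) ⟩
    R * F n                                                ∎

  -- Sum v = x f + q v at R. Since q and v have nonnegative coefficients, the partial sum of q v is
  -- at most Q W ≤ (1 - η) W, which is absorbed on the left. The factor x lowers the index from n +
  -- 1 to n.
  ηW≤RF : ∀ n → η * W (suc n) ≤ R * F n
  ηW≤RF n = begin
    η * W (suc n)                                                  ≡⟨ solve 2 (λ e w → e :* w := w :- (con 1ℚ :- e) :* w) refl η (W (suc n)) ⟩
    W (suc n) - (1ℚ - η) * W (suc n)                               ≡⟨ cong (λ y → y - (1ℚ - η) * W (suc n)) (trans (Σ-cong (suc n) v̂-ode) (Σ-+ (suc n) _ _)) ⟩
    Σ[ suc n ] (scale R (X ⋆ f)) + Σ[ suc n ] (scale R q ⋆ scale R v) - (1ℚ - η) * W (suc n)   ≤⟨ +-monoˡ-≤ (- ((1ℚ - η) * W (suc n))) (+-mono-≤ (≤-reflexive (Σ-X-⋆ n)) (≤-trans (Σ-⋆-≤ (suc n) 0≤q̂ 0≤v̂) (*-monoʳ (0≤W (suc n)) (Q≤ (suc n))))) ⟩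
    R * F n + (1ℚ - η) * W (suc n) - (1ℚ - η) * W (suc n)          ≡⟨ solve 2 (λ a b → a :+ b :- b := a) refl (R * F n) ((1ℚ - η) * W (suc n)) ⟩
    R * F n                                                        ∎
    where
    0≤q̂ : ∀ i → 0ℚ ≤ scale R q i
    0≤q̂ zero    = ≤-refl
    0≤q̂ (suc i) = *-nonNeg (0≤1/! (suc i)) (0≤^ 0≤R (suc i))
    v̂-ode : ∀ i → scale R v i ≡ scale R (X ⋆ f) i + (scale R q ⋆ scale R v) i
    v̂-ode i = trans (cong (_* R ^ i) (v-ode i)) (trans (*-distribʳ-+ (R ^ i) ((X ⋆ f) i) ((q ⋆ v) i)) (cong (λ y → scale R (X ⋆ f) i + y) (scale-⋆ R q v i)))

  R≤W : ∀ n → R ≤ W (suc n)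
  R≤W n = ≤-trans (≤-reflexive (solve 1 (λ r → r := con 0ℚ :* con 1ℚ :+ con 1ℚ :* (r :* con 1ℚ)) refl R)) (Σ-extend 0≤v̂ {1} {suc n} (s≤s z≤n))

  -- The coefficients 0 and 1 of v in degrees 0 and 1 give W ≥ R, so `ηW≤RF` also bounds F from
  -- below. This is what makes the real part of the root positive.
  η≤F : ∀ n → η ≤ F n
  η≤F n = *-cancelˡ-≤-pos R ⦃ positive 0<R ⦄ (begin
    R * η              ≡⟨ *-comm R η ⟩
    η * R              ≤⟨ *-monoˡ 0≤η (R≤W n) ⟩
    η * W (suc n)      ≤⟨ ηW≤RF n ⟩
    R * F n            ∎)

  F≤1 : ∀ n → F n ≤ 1ℚ
  F≤1 zero    = ≤-refl
  F≤1 (suc n) = ≤-trans (+-mono-≤ (F≤1 n) (≤-trans (*-monoʳ (0≤^ 0≤R (suc n)) (f-suc≤0 n)) (≤-reflexive (*-zeroˡ (R ^ suc n))))) (≤-reflexive (+-identityʳ 1ℚ))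

  instance
    η≢0 : NonZero η
    η≢0 = pos⇒nonZero η ⦃ positive 0<η ⦄
    R≢0 : NonZero R
    R≢0 = pos⇒nonZero R ⦃ positive 0<R ⦄

  -- The bound R / η of W that results from η W ≤ R F and F ≤ 1.
  C : ℚ
  C = 1/ η * R

  0<C : 0ℚ < C
  0<C = positive⁻¹ C ⦃ pos*pos⇒pos (1/ η) ⦃ 1/pos⇒pos η ⦃ positive 0<η ⦄ ⦄ R ⦃ positive 0<R ⦄ ⦄

  W≤C : ∀ n → W n ≤ C
  W≤C n = *-cancelˡ-≤-pos η ⦃ positive 0<η ⦄ (begin
    η * W n            ≤⟨ *-monoˡ 0≤η (Σ-extend 0≤v̂ (ℕ.n≤1+n n)) ⟩
    η * W (suc n)      ≤⟨ ηW≤RF n ⟩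
    R * F n            ≤⟨ *-monoˡ 0≤R (F≤1 n) ⟩
    R * 1ℚ             ≡⟨ trans (*-identityʳ R) (sym (*-identityˡ R)) ⟩
    1ℚ * R             ≡⟨ cong (_* R) (*-inverseʳ η) ⟨
    η * 1/ η * R       ≡⟨ *-assoc η (1/ η) R ⟩
    η * C              ∎)

  T≤ : ∀ n → T n ≤ 1ℚ + C
  T≤ n = ≤-trans (go n) (+-monoʳ-≤ 1ℚ (W≤C n))
    where
    go : ∀ n → T n ≤ 1ℚ + W n
    go zero    = ≤-refl
    go (suc n) = begin
      T n + t (suc n)                          ≤⟨ +-mono-≤ (go n) (begin
        t (suc n)                  ≡⟨ *-identityˡ (t (suc n)) ⟨
        1ℚ * t (suc n)             ≤⟨ *-monoʳ (0≤t (suc n)) (ι-≤ {1} {suc n} (s≤s z≤n)) ⟩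
        ι (suc n) * t (suc n)      ≡⟨ ι-t (suc n) ⟩
        scale R v (suc n)          ∎) ⟩
      1ℚ + W n + scale R v (suc n)             ≡⟨ +-assoc 1ℚ (W n) (scale R v (suc n)) ⟩
      1ℚ + W (suc n)                           ∎

  -- For n < k ≤ m the factor n + 1 is at most k, and k |fₖ| Rᵏ is the summand of W. Together with
  -- `W≤C` this makes the tails of T of order 1/n. Keeping `W n` on the left lets the induction
  -- telescope.
  tail-bound : ∀ {n m} → n ℕ.≤ m → ι (suc n) * (T m - T n) ≤ W m
  tail-bound {n} {m} n≤m = ≤-trans (p≤p+q (0≤W n)) (≤-induction (λ m → ι (suc n) * (T m - T n) + W n ≤ W m)
    (≤-reflexive (solve 3 (λ i a w → i :* (a :- a) :+ w := w) refl (ι (suc n)) (T n) (W n)))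
    (λ m n≤m h → begin
      ι (suc n) * (T m + t (suc m) - T n) + W n              ≡⟨ solve 5 (λ i a b c w → i :* (a :+ b :- c) :+ w := i :* (a :- c) :+ w :+ i :* b) refl (ι (suc n)) (T m) (t (suc m)) (T n) (W n) ⟩
      ι (suc n) * (T m - T n) + W n + ι (suc n) * t (suc m)  ≤⟨ +-mono-≤ h (*-monoʳ (0≤t (suc m)) (ι-≤ (s≤s n≤m))) ⟩
      W m + ι (suc m) * t (suc m)                            ≡⟨ cong (λ y → W m + y) (ι-t (suc m)) ⟩
      W (suc m)                                              ∎) m n≤m)

-- Gaussian rationals

negᴳ : 𝔾 → 𝔾
negᴳ (a , b) = - a , - b

𝔾-commutativeRing : CommutativeRing 0ℓ 0ℓ
𝔾-commutativeRing = record
  { Carrier = 𝔾 ; _≈_ = _≡_ ; _+_ = _+ᴳ_ ; _*_ = _*ᴳ_ ; -_ = negᴳ ; 0# = 0ℚ , 0ℚ ; 1# = 1ℚ , 0ℚ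
  ; isCommutativeRing = record
    { isRing = record
      { +-isAbelianGroup = record
        { isGroup = record
          { isMonoid = record
            { isSemigroup = record
              { isMagma = record { isEquivalence = isEquivalence ; ∙-cong = cong₂ _+ᴳ_ }
              ; assoc = λ (a , b) (c , d) (x , y) → cong₂ _,_ (+-assoc a c x) (+-assoc b d y) }
            ; identity = (λ (a , b) → cong₂ _,_ (+-identityˡ a) (+-identityˡ b)) , λ (a , b) → cong₂ _,_ (+-identityʳ a) (+-identityʳ b) }
          ; inverse = (λ (a , b) → cong₂ _,_ (+-inverseˡ a) (+-inverseˡ b)) , λ (a , b) → cong₂ _,_ (+-inverseʳ a) (+-inverseʳ b)
          ; ⁻¹-cong = cong negᴳ }
        ; comm = λ (a , b) (c , d) → cong₂ _,_ (+-comm a c) (+-comm b d) }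
      ; *-cong = cong₂ _*ᴳ_
      ; *-assoc = λ (a , b) (c , d) (x , y) → cong₂ _,_
          (solve 6 (λ a b c d x y → (a :* c :- b :* d) :* x :- (a :* d :+ b :* c) :* y := a :* (c :* x :- d :* y) :- b :* (c :* y :+ d :* x)) refl a b c d x y)
          (solve 6 (λ a b c d x y → (a :* c :- b :* d) :* y :+ (a :* d :+ b :* c) :* x := a :* (c :* y :+ d :* x) :+ b :* (c :* x :- d :* y)) refl a b c d x y)
      ; *-identity = (λ (a , b) → cong₂ _,_ (solve 2 (λ a b → con 1ℚ :* a :- con 0ℚ :* b := a) refl a b) (solve 2 (λ a b → con 1ℚ :* b :+ con 0ℚ :* a := b) refl a b))
                   , (λ (a , b) → cong₂ _,_ (solve 2 (λ a b → a :* con 1ℚ :- b :* con 0ℚ := a) refl a b) (solve 2 (λ a b → a :* con 0ℚ :+ b :* con 1ℚ := b) refl a b))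
      ; distrib = (λ (a , b) (c , d) (x , y) → cong₂ _,_
                    (solve 6 (λ a b c d x y → a :* (c :+ x) :- b :* (d :+ y) := (a :* c :- b :* d) :+ (a :* x :- b :* y)) refl a b c d x y)
                    (solve 6 (λ a b c d x y → a :* (d :+ y) :+ b :* (c :+ x) := (a :* d :+ b :* c) :+ (a :* y :+ b :* x)) refl a b c d x y))
                , (λ (a , b) (c , d) (x , y) → cong₂ _,_
                    (solve 6 (λ a b c d x y → (c :+ x) :* a :- (d :+ y) :* b := (c :* a :- d :* b) :+ (x :* a :- y :* b)) refl a b c d x y)
                    (solve 6 (λ a b c d x y → (c :+ x) :* b :+ (d :+ y) :* a := (c :* b :+ d :* a) :+ (x :* b :+ y :* a)) refl a b c d x y)) }
    ; *-comm = λ (a , b) (c , d) → cong₂ _,_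
        (solve 4 (λ a b c d → a :* c :- b :* d := c :* a :- d :* b) refl a b c d)
        (solve 4 (λ a b c d → a :* d :+ b :* c := c :* b :+ d :* a) refl a b c d) } }

-- Sequences of Gaussian rationals under the same Cauchy product; their entries are the evaluated
-- terms aₖ uᵏ.
module ΣG = PowerSeries 𝔾-commutativeRing

infix 4 _⊑_

N : 𝔾 → ℚ
N (a , b) = a * a + b * b

-- ∣u∣ ≤ t, squared because the modulus itself need not be rational.
record _⊑_ (u : 𝔾) (t : ℚ) : Set where
  constructor _,_
  field
    0≤bound : 0ℚ ≤ t
    N≤      : N u ≤ t * t

∣∣-square : ∀ x → ∣ x ∣ * ∣ x ∣ ≡ x * x
∣∣-square x with ∣p∣≡p∨∣p∣≡-p x
... | inj₁ h = cong₂ _*_ h h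
... | inj₂ h = trans (cong₂ _*_ h h) (solve 1 (λ x → :- x :* :- x := x :* x) refl x)

0≤square : ∀ x → 0ℚ ≤ x * x
0≤square x = subst (0ℚ ≤_) (∣∣-square x) (*-nonNeg (0≤∣p∣ x) (0≤∣p∣ x))

square≤⇒∣∣≤ : ∀ {x t} → 0ℚ ≤ t → x * x ≤ t * t → ∣ x ∣ ≤ t
square≤⇒∣∣≤ {x} 0≤t h = square-cancel (0≤∣p∣ x) 0≤t (≤-trans (≤-reflexive (∣∣-square x)) h)

0≤N : ∀ u → 0ℚ ≤ N u
0≤N (a , b) = +-nonNeg (0≤square a) (0≤square b)

⊑-weaken : ∀ {u s t} → s ≤ t → u ⊑ s → u ⊑ t
⊑-weaken s≤t (0≤s , h) = ≤-trans 0≤s s≤t , ≤-trans h (*-mono (≤-trans 0≤s s≤t) 0≤s s≤t s≤t)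

⊑-0 : (0ℚ , 0ℚ) ⊑ 0ℚ
⊑-0 = ≤-refl , ≤-refl

⊑-* : ∀ {u w s t} → u ⊑ s → w ⊑ t → u *ᴳ w ⊑ s * t
⊑-* {u@(a , b)} {w@(c , d)} {s} {t} (0≤s , u≤s) (0≤t , w≤t) = *-nonNeg 0≤s 0≤t , (begin
  N (u *ᴳ w)               ≡⟨ solve 4 (λ a b c d → (a :* c :- b :* d) :* (a :* c :- b :* d) :+ (a :* d :+ b :* c) :* (a :* d :+ b :* c) := (a :* a :+ b :* b) :* (c :* c :+ d :* d)) refl a b c d ⟩
  N u * N w                ≤⟨ *-mono (*-nonNeg 0≤s 0≤s) (0≤N w) u≤s w≤t ⟩
  s * s * (t * t)          ≡⟨ solve 2 (λ s t → s :* s :* (t :* t) := s :* t :* (s :* t)) refl s t ⟩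
  s * t * (s * t)          ∎)
  where open ≤-Reasoning

⊑-+ : ∀ {u w s t} → u ⊑ s → w ⊑ t → u +ᴳ w ⊑ s + t
⊑-+ {u@(a , b)} {w@(c , d)} {s} {t} (0≤s , u≤s) (0≤t , w≤t) = +-nonNeg 0≤s 0≤t , (begin
  N (u +ᴳ w)                                       ≡⟨ solve 4 (λ a b c d → (a :+ c) :* (a :+ c) :+ (b :+ d) :* (b :+ d) := (a :* a :+ b :* b) :+ (c :* c :+ d :* d) :+ ((a :* c :+ b :* d) :+ (a :* c :+ b :* d))) refl a b c d ⟩
  N u + N w + (inner + inner)                      ≤⟨ +-mono-≤ (+-mono-≤ u≤s w≤t) (+-mono-≤ cauchy-schwarz cauchy-schwarz) ⟩
  s * s + t * t + (s * t + s * t)                  ≡⟨ solve 2 (λ s t → s :* s :+ t :* t :+ (s :* t :+ s :* t) := (s :+ t) :* (s :+ t)) refl s t ⟩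
  (s + t) * (s + t)                                ∎)
  where
  open ≤-Reasoning
  inner = a * c + b * d
  cross = a * d - b * c
  -- Lagrange's identity: `cross` completes the square of `inner` to `N u * N w`.
  cauchy-schwarz : inner ≤ s * t
  cauchy-schwarz = ≤-trans (p≤∣p∣ inner) (square≤⇒∣∣≤ (*-nonNeg 0≤s 0≤t) (begin
    inner * inner                    ≤⟨ p≤p+q (0≤square cross) ⟩
    inner * inner + cross * cross    ≡⟨ solve 4 (λ a b c d → (a :* c :+ b :* d) :* (a :* c :+ b :* d) :+ (a :* d :- b :* c) :* (a :* d :- b :* c) := (a :* a :+ b :* b) :* (c :* c :+ d :* d)) refl a b c d ⟩
    N u * N w                        ≤⟨ *-mono (*-nonNeg 0≤s 0≤s) (0≤N w) u≤s w≤t ⟩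
    s * s * (t * t)                  ≡⟨ solve 2 (λ s t → s :* s :* (t :* t) := s :* t :* (s :* t)) refl s t ⟩
    s * t * (s * t)                  ∎))

⊑-• : ∀ {u t} c → u ⊑ t → c • u ⊑ ∣ c ∣ * t
⊑-• {u@(a , b)} {t} c (0≤t , h) = *-nonNeg (0≤∣p∣ c) 0≤t , (begin
  N (c • u)                        ≡⟨ solve 3 (λ a b c → c :* a :* (c :* a) :+ c :* b :* (c :* b) := c :* c :* (a :* a :+ b :* b)) refl a b c ⟩
  c * c * N u                      ≤⟨ *-monoˡ (0≤square c) h ⟩
  c * c * (t * t)                  ≡⟨ cong (_* (t * t)) (∣∣-square c) ⟨
  ∣ c ∣ * ∣ c ∣ * (t * t)          ≡⟨ solve 2 (λ c t → c :* c :* (t :* t) := c :* t :* (c :* t)) refl (∣ c ∣) t ⟩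
  ∣ c ∣ * t * (∣ c ∣ * t)          ∎)
  where open ≤-Reasoning

⊑⇒∣re∣≤ : ∀ {u t} → u ⊑ t → ∣ proj₁ u ∣ ≤ t
⊑⇒∣re∣≤ {a , b} (0≤t , h) = square≤⇒∣∣≤ 0≤t (≤-trans (p≤p+q (0≤square b)) h)

⊑⇒∣im∣≤ : ∀ {u t} → u ⊑ t → ∣ proj₂ u ∣ ≤ t
⊑⇒∣im∣≤ {a , b} (0≤t , h) = square≤⇒∣∣≤ 0≤t (≤-trans (p≤q+p (0≤square a)) h)

⊑⇒‖‖≤ : ∀ {u t} → u ⊑ t → ‖ u ‖ ≤ t + t
⊑⇒‖‖≤ h = +-mono-≤ (⊑⇒∣re∣≤ h) (⊑⇒∣im∣≤ h)

⊑-‖‖ : ∀ u → u ⊑ ‖ u ‖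
⊑-‖‖ u@(a , b) = 0≤‖‖ u , (begin
  a * a + b * b                                          ≡⟨ cong₂ _+_ (∣∣-square a) (∣∣-square b) ⟨
  x * x + y * y                                          ≤⟨ p≤p+q (*-nonNeg (*-nonNeg {1ℚ + 1ℚ} (+-nonNeg (<⇒≤ 0<1) (<⇒≤ 0<1)) (0≤∣p∣ a)) (0≤∣p∣ b)) ⟩
  x * x + y * y + (1ℚ + 1ℚ) * x * y                      ≡⟨ solve 2 (λ x y → x :* x :+ y :* y :+ (con 1ℚ :+ con 1ℚ) :* x :* y := (x :+ y) :* (x :+ y)) refl x y ⟩
  (x + y) * (x + y)                                      ∎)
  where
  open ≤-Reasoning
  x = ∣ a ∣
  y = ∣ b ∣

⊑-Σ : ∀ n {a : ℕ → 𝔾} {t} → (∀ i → i ℕ.≤ n → a i ⊑ t i) → ΣG.Σ[ n ] a ⊑ Σ[ n ] t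
⊑-Σ zero    h = h 0 z≤n
⊑-Σ (suc n) h = ⊑-+ (⊑-Σ n λ i i≤n → h i (ℕ.m≤n⇒m≤1+n i≤n)) (h (suc n) ℕ.≤-refl)

-ᴳ-+ᴳ : ∀ a b c d → (a +ᴳ b) -ᴳ (c +ᴳ d) ≡ (a -ᴳ c) +ᴳ (b -ᴳ d)
-ᴳ-+ᴳ (a , a′) (b , b′) (c , c′) (d , d′) = cong₂ _,_ (eq a b c d) (eq a′ b′ c′ d′)
  where eq = solve 4 (λ a b c d → (a :+ b) :- (c :+ d) := (a :- c) :+ (b :- d)) refl

ΣG-- : ∀ n a b → ΣG.Σ[ n ] a -ᴳ ΣG.Σ[ n ] b ≡ ΣG.Σ[ n ] λ i → a i -ᴳ b i
ΣG-- zero    a b = refl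
ΣG-- (suc n) a b = trans (-ᴳ-+ᴳ (ΣG.Σ[ n ] a) (a (suc n)) (ΣG.Σ[ n ] b) (b (suc n))) (cong (_+ᴳ (a (suc n) -ᴳ b (suc n))) (ΣG-- n a b))

+ᴳ--ᴳ : ∀ a b c → (a +ᴳ b) -ᴳ c ≡ (a -ᴳ c) +ᴳ b
+ᴳ--ᴳ (a , a′) (b , b′) (c , c′) = cong₂ _,_ (eq a b c) (eq a′ b′ c′)
  where eq = solve 3 (λ a b c → a :+ b :- c := a :- c :+ b) refl

-ᴳ-self : ∀ a → a -ᴳ a ≡ (0ℚ , 0ℚ)
-ᴳ-self (a , b) = cong₂ _,_ (+-inverseʳ a) (+-inverseʳ b)

•--ᴳ : ∀ r x y → r • x -ᴳ r • y ≡ r • (x -ᴳ y)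
•--ᴳ r (a , b) (c , d) = cong₂ _,_ (eq r a c) (eq r b d)
  where eq = solve 3 (λ r a c → r :* a :- r :* c := r :* (a :- c)) refl

^ᴳ-homo-* : ∀ u i j → u ^ᴳ (i ℕ.+ j) ≡ u ^ᴳ i *ᴳ u ^ᴳ j
^ᴳ-homo-* u zero    j = sym (CommutativeRing.*-identityˡ 𝔾-commutativeRing (u ^ᴳ j))
^ᴳ-homo-* u (suc i) j = trans (cong (u *ᴳ_) (^ᴳ-homo-* u i j)) (sym (CommutativeRing.*-assoc 𝔾-commutativeRing u (u ^ᴳ i) (u ^ᴳ j)))

•-*ᴳ : ∀ r s x y → (r • x) *ᴳ (s • y) ≡ (r * s) • (x *ᴳ y)
•-*ᴳ r s (a , b) (c , d) = cong₂ _,_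
  (solve 6 (λ r s a b c d → r :* a :* (s :* c) :- r :* b :* (s :* d) := r :* s :* (a :* c :- b :* d)) refl r s a b c d)
  (solve 6 (λ r s a b c d → r :* a :* (s :* d) :+ r :* b :* (s :* c) := r :* s :* (a :* d :+ b :* c)) refl r s a b c d)

•-Σ : ∀ n (a : ℕ → ℚ) u → Σ[ n ] a • u ≡ ΣG.Σ[ n ] λ i → a i • u
•-Σ zero    a u       = refl
•-Σ (suc n) a u = trans (•-distribʳ (Σ[ n ] a) (a (suc n)) u) (cong (_+ᴳ a (suc n) • u) (•-Σ n a u))
  where
  •-distribʳ : ∀ r s u → (r + s) • u ≡ r • u +ᴳ s • u
  •-distribʳ r s (a , b) = cong₂ _,_ (*-distribʳ-+ a r s) (*-distribʳ-+ b r s)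

eval : Power → ℕ → 𝔾 → 𝔾
eval a n u = ΣG.Σ[ n ] λ k → a k • u ^ᴳ k

•-⋆ : ∀ a b u n → (a ⋆ b) n • u ^ᴳ n ≡ ((λ k → a k • u ^ᴳ k) ΣG.⋆ (λ k → b k • u ^ᴳ k)) n
•-⋆ a b u n = trans (•-Σ n _ (u ^ᴳ n)) (ΣG.Σ-cong-≤ n split)
  where
  split : ∀ i → i ℕ.≤ n → (a i * b (n ℕ.∸ i)) • u ^ᴳ n ≡ (a i • u ^ᴳ i) *ᴳ (b (n ℕ.∸ i) • u ^ᴳ (n ℕ.∸ i))
  split i i≤n = trans (cong ((a i * b (n ℕ.∸ i)) •_) (trans (cong (u ^ᴳ_) (sym (ℕ.m+[n∸m]≡n i≤n))) (^ᴳ-homo-* u i (n ℕ.∸ i)))) (sym (•-*ᴳ (a i) (b (n ℕ.∸ i)) (u ^ᴳ i) (u ^ᴳ (n ℕ.∸ i))))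

⊑-^ : ∀ {u R} → u ⊑ R → ∀ k → u ^ᴳ k ⊑ R ^ k
⊑-^ h zero    = <⇒≤ 0<1 , ≤-refl
⊑-^ h (suc k) = ⊑-* h (⊑-^ h k)

-- The distance of u and w is given as R * δ to avoid the exponent k - 1.
⊑-^-lipschitz : ∀ {u w R δ} → u ⊑ R → w ⊑ R → 0ℚ ≤ δ → u -ᴳ w ⊑ R * δ → ∀ k → u ^ᴳ k -ᴳ w ^ᴳ k ⊑ ι k * R ^ k * δ
⊑-^-lipschitz {δ = δ} _ _ 0≤δ _ zero = ≤-reflexive (sym eq) , ≤-reflexive (sym (cong₂ _*_ eq eq))
  where
  eq : ι 0 * 1ℚ * δ ≡ 0ℚ
  eq = solve 1 (λ d → con 0ℚ :* con 1ℚ :* d := con 0ℚ) refl δ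
⊑-^-lipschitz {u} {w} {R} {δ} u≤R w≤R 0≤δ h (suc k) = subst (_⊑ ι (suc k) * (R * R ^ k) * δ) (sym (*ᴳ-telescope u w (u ^ᴳ k) (w ^ᴳ k)))
  (subst (u *ᴳ (u ^ᴳ k -ᴳ w ^ᴳ k) +ᴳ (u -ᴳ w) *ᴳ w ^ᴳ k ⊑_) eq
    (⊑-+ (⊑-* u≤R (⊑-^-lipschitz u≤R w≤R 0≤δ h k)) (⊑-* h (⊑-^ w≤R k))))
  where
  eq : R * (ι k * R ^ k * δ) + R * δ * R ^ k ≡ ι (suc k) * (R * R ^ k) * δ
  eq = trans (solve 4 (λ r i p d → r :* (i :* p :* d) :+ r :* d :* p := (con 1ℚ :+ i) :* (r :* p) :* d) refl R (ι k) (R ^ k) δ) (cong (λ y → y * (R * R ^ k) * δ) (sym (ι-+ 1 k)))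

*ᴳ--ᴳ : ∀ a b c → a *ᴳ b -ᴳ a *ᴳ c ≡ a *ᴳ (b -ᴳ c)
*ᴳ--ᴳ (a , a′) (b , b′) (c , c′) = cong₂ _,_
  (solve 6 (λ a x b y c z → a :* b :- x :* y :- (a :* c :- x :* z) := a :* (b :- c) :- x :* (y :- z)) refl a a′ b b′ c c′)
  (solve 6 (λ a x b y c z → a :* y :+ x :* b :- (a :* z :+ x :* c) := a :* (y :- z) :+ x :* (b :- c)) refl a a′ b b′ c c′)

-- Beyond the truncated product, the product of two partial sums contains the terms aᵢ bⱼ with i, j
-- ≤ n < i + j, here grouped by i.
product-split : ∀ n a b → ΣG.Σ[ n ] a *ᴳ ΣG.Σ[ n ] b -ᴳ ΣG.Σ[ n ] (a ΣG.⋆ b) ≡ ΣG.Σ[ n ] λ i → a i *ᴳ (ΣG.Σ[ n ] b -ᴳ ΣG.Σ[ n ℕ.∸ i ] b)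
product-split n a b = begin
  A *ᴳ B -ᴳ ΣG.Σ[ n ] (a ΣG.⋆ b)                                                   ≡⟨ cong₂ _-ᴳ_ (trans (*ᴳ-comm A B) (trans (sym (ΣG.Σ-*ˡ n B a)) (ΣG.Σ-cong n λ i → *ᴳ-comm B (a i)))) (ΣG.Σ-⋆ n a b) ⟩
  ΣG.Σ[ n ] (λ i → a i *ᴳ B) -ᴳ ΣG.Σ[ n ] (λ i → a i *ᴳ ΣG.Σ[ n ℕ.∸ i ] b)         ≡⟨ ΣG-- n _ _ ⟩
  ΣG.Σ[ n ] (λ i → a i *ᴳ B -ᴳ a i *ᴳ ΣG.Σ[ n ℕ.∸ i ] b)                           ≡⟨ ΣG.Σ-cong n (λ i → *ᴳ--ᴳ (a i) B (ΣG.Σ[ n ℕ.∸ i ] b)) ⟩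
  ΣG.Σ[ n ] (λ i → a i *ᴳ (B -ᴳ ΣG.Σ[ n ℕ.∸ i ] b))                                ∎
  where
  open ≡-Reasoning
  A = ΣG.Σ[ n ] a
  B = ΣG.Σ[ n ] b
  *ᴳ-comm = CommutativeRing.*-comm 𝔾-commutativeRing

module Evaluation (R η : ℚ) (0<R : 0ℚ < R) (0<η : 0ℚ < η) (E≤ : ∀ n → E n R + η ≤ 2ℚ) where
  open Majorant R η 0<R 0<η E≤
  open ≤-Reasoning

  ⊑-term : ∀ {u} → u ⊑ R → ∀ k → f k • u ^ᴳ k ⊑ t k
  ⊑-term h k = ⊑-• (f k) (⊑-^ h k)

  ⊑-tail-T : ∀ {u} → u ⊑ R → ∀ {n} m → n ℕ.≤ m → eval f m u -ᴳ eval f n u ⊑ T m - T n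
  ⊑-tail-T {u} h {n} = ≤-induction (λ m → eval f m u -ᴳ eval f n u ⊑ T m - T n)
    (subst (_⊑ T n - T n) (sym (-ᴳ-self (eval f n u))) (subst ((0ℚ , 0ℚ) ⊑_) (sym (+-inverseʳ (T n))) ⊑-0))
    (λ m _ ih → subst (_⊑ T m + t (suc m) - T n) (sym (+ᴳ--ᴳ (eval f m u) (f (suc m) • u ^ᴳ suc m) (eval f n u)))
      (subst ((eval f m u -ᴳ eval f n u) +ᴳ f (suc m) • u ^ᴳ suc m ⊑_) (solve 3 (λ a b c → a :- c :+ b := a :+ b :- c) refl (T m) (t (suc m)) (T n))
        (⊑-+ ih (⊑-term h (suc m)))))

  divide : ∀ n {a b} → ι (suc n) * a ≤ b → a ≤ b * 1 /1+ n
  divide n {a} {b} h = begin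
    a                              ≡⟨ *-identityˡ a ⟨
    1ℚ * a                         ≡⟨ cong (_* a) (1/1+-ι n) ⟨
    1 /1+ n * ι (suc n) * a        ≡⟨ *-assoc (1 /1+ n) (ι (suc n)) a ⟩
    1 /1+ n * (ι (suc n) * a)      ≤⟨ *-monoˡ (0≤/1+ 1 n) h ⟩
    1 /1+ n * b                    ≡⟨ *-comm (1 /1+ n) b ⟩
    b * 1 /1+ n                    ∎

  ⊑-tail : ∀ {u} → u ⊑ R → ∀ {n m} → n ℕ.≤ m → eval f m u -ᴳ eval f n u ⊑ C * 1 /1+ n
  ⊑-tail h {n} {m} n≤m = ⊑-weaken (divide n (≤-trans (tail-bound n≤m) (W≤C m))) (⊑-tail-T h m n≤m)

  -- The power uᵏ has Lipschitz constant k Rᵏ⁻¹ on the disk, and the sum of k |fₖ| Rᵏ⁻¹ is W / R ≤ C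
  -- / R.
  ⊑-lipschitz : ∀ {u w δ} → u ⊑ R → w ⊑ R → u -ᴳ w ⊑ δ → ∀ n → eval f n u -ᴳ eval f n w ⊑ C * 1/ R * δ
  ⊑-lipschitz {u} {w} {δ} u≤R w≤R h n = ⊑-weaken sum≤ (subst (_⊑ Σ[ n ] (λ k → ∣ f k ∣ * (ι k * R ^ k * δ′))) (sym (ΣG-- n _ _))
      (⊑-Σ n λ k _ → subst (_⊑ ∣ f k ∣ * (ι k * R ^ k * δ′)) (sym (•--ᴳ (f k) (u ^ᴳ k) (w ^ᴳ k))) (⊑-• (f k) (⊑-^-lipschitz u≤R w≤R 0≤δ′ h′ k))))
    where
    0≤1/R : 0ℚ ≤ 1/ R
    0≤1/R = <⇒≤ (positive⁻¹ (1/ R) ⦃ 1/pos⇒pos R ⦃ positive 0<R ⦄ ⦄)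
    δ′ = 1/ R * δ
    0≤δ′ = *-nonNeg 0≤1/R (_⊑_.0≤bound h)
    h′ : u -ᴳ w ⊑ R * δ′
    h′ = subst (u -ᴳ w ⊑_) (sym (trans (sym (*-assoc R (1/ R) δ)) (trans (cong (_* δ) (*-inverseʳ R)) (*-identityˡ δ)))) h
    sum≤ : Σ[ n ] (λ k → ∣ f k ∣ * (ι k * R ^ k * δ′)) ≤ C * 1/ R * δ
    sum≤ = begin
      Σ[ n ] (λ k → ∣ f k ∣ * (ι k * R ^ k * δ′))      ≡⟨ Σ-cong n (λ k → trans (solve 4 (λ a i r d → a :* (i :* r :* d) := d :* (i :* (a :* r))) refl (∣ f k ∣) (ι k) (R ^ k) δ′) (cong (δ′ *_) (ι-t k))) ⟩
      Σ[ n ] (λ k → δ′ * scale R v k)                  ≡⟨ Σ-*ˡ n δ′ (scale R v) ⟩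
      δ′ * W n                                         ≤⟨ *-monoˡ 0≤δ′ (W≤C n) ⟩
      δ′ * C                                           ≡⟨ solve 3 (λ r d c → r :* d :* c := c :* r :* d) refl (1/ R) δ C ⟩
      C * 1/ R * δ                                     ∎

  -- Split n + 1 into n - i + 1 and i. The first part times the tail is at most W by `tail-bound`;
  -- for the second, the tail is at most all of T.
  product-gap : ∀ n i → i ℕ.≤ n → ι (suc n) * (T n - T (n ℕ.∸ i)) ≤ W n + ι i * T n
  product-gap n i i≤n = begin
    ι (suc n) * d                          ≡⟨ cong (λ k → ι (suc k) * d) (ℕ.m∸n+n≡m i≤n) ⟨
    ι (suc (n ℕ.∸ i) ℕ.+ i) * d            ≡⟨ cong (_* d) (ι-+ (suc (n ℕ.∸ i)) i) ⟩
    (ι (suc (n ℕ.∸ i)) + ι i) * d          ≡⟨ *-distribʳ-+ d (ι (suc (n ℕ.∸ i))) (ι i) ⟩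
    ι (suc (n ℕ.∸ i)) * d + ι i * d        ≤⟨ +-mono-≤ (tail-bound (ℕ.m∸n≤m n i)) (*-monoˡ (0≤ι i) d≤T) ⟩
    W n + ι i * T n                        ∎
    where
    d = T n - T (n ℕ.∸ i)
    d≤T : d ≤ T n
    d≤T = ≤-trans (+-monoʳ-≤ (T n) (neg-antimono-≤ (0≤T (n ℕ.∸ i)))) (≤-reflexive (+-identityʳ (T n)))

  K : ℚ
  K = (1ℚ + C) * (C + C)

  0≤K : 0ℚ ≤ K
  0≤K = *-nonNeg (+-nonNeg (<⇒≤ 0<1) (<⇒≤ 0<C)) (+-nonNeg (<⇒≤ 0<C) (<⇒≤ 0<C))

  -- The error from `product-split` is at most the sum of tᵢ (T n - T (n - i)). Times n + 1,
  -- `product-gap` bounds it by W T + T W, because the sum of i tᵢ is W; hence the constant K and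
  -- the order 1/n.
  ⊑-product : ∀ {u} → u ⊑ R → ∀ n → eval f n u *ᴳ eval f n u -ᴳ eval (f ⋆ f) n u ⊑ K * 1 /1+ n
  ⊑-product {u} h n = subst (_⊑ K * 1 /1+ n) (sym split)
    (⊑-weaken (divide n bound) (⊑-Σ n λ i i≤n → ⊑-* (⊑-term h i) (⊑-tail-T h n (ℕ.m∸n≤m n i))))
    where
    split : eval f n u *ᴳ eval f n u -ᴳ eval (f ⋆ f) n u ≡ ΣG.Σ[ n ] λ i → (f i • u ^ᴳ i) *ᴳ (eval f n u -ᴳ eval f (n ℕ.∸ i) u)
    split = trans (cong (eval f n u *ᴳ eval f n u -ᴳ_) (ΣG.Σ-cong n (•-⋆ f f u))) (product-split n _ _)
    bound : ι (suc n) * Σ[ n ] (λ i → t i * (T n - T (n ℕ.∸ i))) ≤ K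
    bound = begin
      ι (suc n) * Σ[ n ] (λ i → t i * (T n - T (n ℕ.∸ i)))           ≡⟨ Σ-*ˡ n (ι (suc n)) _ ⟨
      Σ[ n ] (λ i → ι (suc n) * (t i * (T n - T (n ℕ.∸ i))))         ≤⟨ Σ-mono n (λ i i≤n → begin
        ι (suc n) * (t i * (T n - T (n ℕ.∸ i)))        ≡⟨ solve 3 (λ a b c → a :* (b :* c) := b :* (a :* c)) refl (ι (suc n)) (t i) (T n - T (n ℕ.∸ i)) ⟩
        t i * (ι (suc n) * (T n - T (n ℕ.∸ i)))        ≤⟨ *-monoˡ (0≤t i) (product-gap n i i≤n) ⟩
        t i * (W n + ι i * T n)                        ≡⟨ solve 4 (λ a w i b → a :* (w :+ i :* b) := w :* a :+ b :* (i :* a)) refl (t i) (W n) (ι i) (T n) ⟩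
        W n * t i + T n * (ι i * t i)                  ≡⟨ cong (λ y → W n * t i + T n * y) (ι-t i) ⟩
        W n * t i + T n * scale R v i                  ∎) ⟩
      Σ[ n ] (λ i → W n * t i + T n * scale R v i)                   ≡⟨ Σ-+ n _ _ ⟩
      Σ[ n ] (λ i → W n * t i) + Σ[ n ] (λ i → T n * scale R v i)    ≡⟨ cong₂ _+_ (Σ-*ˡ n (W n) t) (Σ-*ˡ n (T n) (scale R v)) ⟩
      W n * T n + T n * W n                                          ≡⟨ solve 2 (λ w t → w :* t :+ t :* w := t :* (w :+ w)) refl (W n) (T n) ⟩
      T n * (W n + W n)                                              ≤⟨ *-mono (+-nonNeg (<⇒≤ 0<1) (<⇒≤ 0<C)) (+-nonNeg (0≤W n) (0≤W n)) (T≤ n) (+-mono-≤ (W≤C n) (W≤C n)) ⟩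
      K                                                              ∎

  -- re uᵏ ≤ Rᵏ, and all coefficients of f but the first are nonpositive.
  F≤re : ∀ {u} → u ⊑ R → ∀ n → F n ≤ proj₁ (eval f n u)
  F≤re h zero    = ≤-refl
  F≤re {u} h (suc n) = +-mono-≤ (F≤re h n) (begin
    f (suc n) * R ^ suc n                      ≤⟨ *-monoˡ-≤-nonPos (f (suc n)) ⦃ nonPositive (f-suc≤0 n) ⦄ (≤-trans (p≤∣p∣ (proj₁ (u ^ᴳ suc n))) (⊑⇒∣re∣≤ (⊑-^ h (suc n)))) ⟩
    f (suc n) * proj₁ (u ^ᴳ suc n)             ∎)

  η≤re : ∀ {u} → u ⊑ R → ∀ n → η ≤ proj₁ (eval f n u)
  η≤re h n = ≤-trans (η≤F n) (F≤re h n)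

-- The sum on the disk ∣z∣ < ln 2

scalar-*ᴳ : ∀ c u → (c , 0ℚ) *ᴳ u ≡ c • u
scalar-*ᴳ c (a , b) = cong₂ _,_
  (solve 3 (λ c a b → c :* a :- con 0ℚ :* b := c :* a) refl c a b)
  (solve 3 (λ c a b → c :* b :+ con 0ℚ :* a := c :* b) refl c a b)

•-assoc : ∀ r s u → r • (s • u) ≡ (r * s) • u
•-assoc r s (a , b) = cong₂ _,_ (sym (*-assoc r s a)) (sym (*-assoc r s b))

^ᴳ-neg : ∀ u k → negᴳ u ^ᴳ k ≡ (- 1ℚ) ^ k • u ^ᴳ k
^ᴳ-neg u zero    = refl
^ᴳ-neg u@(a , b) (suc k) = trans (cong (negᴳ u *ᴳ_) (^ᴳ-neg u k)) (lemma ((- 1ℚ) ^ k) (u ^ᴳ k))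
  where
  lemma : ∀ s w → negᴳ u *ᴳ (s • w) ≡ (- 1ℚ * s) • (u *ᴳ w)
  lemma s (c , d) = cong₂ _,_
    (solve 5 (λ a b s c d → :- a :* (s :* c) :- :- b :* (s :* d) := con (- 1ℚ) :* s :* (a :* c :- b :* d)) refl a b s c d)
    (solve 5 (λ a b s c d → :- a :* (s :* d) :+ :- b :* (s :* c) := con (- 1ℚ) :* s :* (a :* d :+ b :* c)) refl a b s c d)

-- An exact identity of truncations, since `exp` is approximated by partial sums of equal index. So
-- only the squaring contributes an error in `square-close`.
eval-2exp-1 : ∀ n u → (2ℚ , 0ℚ) *ᴳ Eᴳ n (negᴳ u) -ᴳ (1ℚ , 0ℚ) ≡ eval (𝟙 ⊞ (q̄ ⊞ q̄)) n u
eval-2exp-1 zero    u = refl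
eval-2exp-1 (suc n) u = begin
  (2ℚ , 0ℚ) *ᴳ (Eᴳ n (negᴳ u) +ᴳ Dᴳ (negᴳ u) (suc n)) -ᴳ (1ℚ , 0ℚ)                        ≡⟨ cong (_-ᴳ (1ℚ , 0ℚ)) (CommutativeRing.distribˡ 𝔾-commutativeRing (2ℚ , 0ℚ) (Eᴳ n (negᴳ u)) (Dᴳ (negᴳ u) (suc n))) ⟩
  (2ℚ , 0ℚ) *ᴳ Eᴳ n (negᴳ u) +ᴳ (2ℚ , 0ℚ) *ᴳ Dᴳ (negᴳ u) (suc n) -ᴳ (1ℚ , 0ℚ)            ≡⟨ +ᴳ--ᴳ ((2ℚ , 0ℚ) *ᴳ Eᴳ n (negᴳ u)) ((2ℚ , 0ℚ) *ᴳ Dᴳ (negᴳ u) (suc n)) (1ℚ , 0ℚ) ⟩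
  ((2ℚ , 0ℚ) *ᴳ Eᴳ n (negᴳ u) -ᴳ (1ℚ , 0ℚ)) +ᴳ (2ℚ , 0ℚ) *ᴳ Dᴳ (negᴳ u) (suc n)          ≡⟨ cong₂ _+ᴳ_ (eval-2exp-1 n u) term ⟩
  eval (𝟙 ⊞ (q̄ ⊞ q̄)) n u +ᴳ (0ℚ + (q̄ (suc n) + q̄ (suc n))) • u ^ᴳ suc n                  ∎
  where
  open ≡-Reasoning
  s = (- 1ℚ) ^ suc n
  r = 1/! (suc n)
  term : (2ℚ , 0ℚ) *ᴳ Dᴳ (negᴳ u) (suc n) ≡ (0ℚ + (q̄ (suc n) + q̄ (suc n))) • u ^ᴳ suc n
  term = begin
    (2ℚ , 0ℚ) *ᴳ (r • negᴳ u ^ᴳ suc n)                 ≡⟨ scalar-*ᴳ 2ℚ (r • negᴳ u ^ᴳ suc n) ⟩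
    2ℚ • (r • negᴳ u ^ᴳ suc n)                         ≡⟨ cong (λ y → 2ℚ • (r • y)) (^ᴳ-neg u (suc n)) ⟩
    2ℚ • (r • (s • u ^ᴳ suc n))                        ≡⟨ trans (cong (2ℚ •_) (•-assoc r s (u ^ᴳ suc n))) (•-assoc 2ℚ (r * s) (u ^ᴳ suc n)) ⟩
    (2ℚ * (r * s)) • u ^ᴳ suc n                        ≡⟨ cong (_• u ^ᴳ suc n) (solve 1 (λ x → con 2ℚ :* x := con 0ℚ :+ (x :+ x)) refl (r * s)) ⟩
    (0ℚ + (q̄ (suc n) + q̄ (suc n))) • u ^ᴳ suc n        ∎

•-at-term : ∀ {a} n z j → a * 1/! n ≡ f n → a • at (fromℚᶜ (1/! n) *ᶜ z ^ᶜ n) j ≡ f n • at z j ^ᴳ n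
•-at-term {a} n z j a≡f = begin
  a • at (fromℚᶜ (1/! n) *ᶜ z ^ᶜ n) j            ≡⟨ cong (a •_) (at-term z n j) ⟩
  a • (1/! n • at z j ^ᴳ n)                      ≡⟨ •-assoc a (1/! n) (at z j ^ᴳ n) ⟩
  (a * 1/! n) • at z j ^ᴳ n                      ≡⟨ cong (_• at z j ^ᴳ n) a≡f ⟩
  f n • at z j ^ᴳ n                              ∎
  where open ≡-Reasoning

-- The coefficient is not given a name, as comparing it with its definition
-- inside a complex number unfolds the arithmetic of ℚ.
at-summand : ∀ z n j → at (fromℚᶜ ((- 1ℚ) ^ suc n * ∑ _+_ n (λ k → (- 1ℚ) ^ k * S n k * [2 + k ℤ.- + 1 -1]!!)) *ᶜ (fromℚᶜ (1/! n) *ᶜ z ^ᶜ n)) j ≡ f n • at z j ^ᴳ n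
at-summand z n j = trans
  (scalar-*ᴳ ((- 1ℚ) ^ suc n * ∑ _+_ n (λ k → (- 1ℚ) ^ k * S n k * [2 + k ℤ.- + 1 -1]!!)) (at (fromℚᶜ (1/! n) *ᶜ z ^ᶜ n) j))
  (•-at-term {((- 1ℚ) ^ suc n * ∑ _+_ n (λ k → (- 1ℚ) ^ k * S n k * [2 + k ℤ.- + 1 -1]!!))} n z j (f-coefficient n))

at-partial : ∀ {s z} → (∀ n j → at (s n) j ≡ f n • at z j ^ᴳ n) → ∀ n j → at (∑ _+ᶜ_ n s) j ≡ eval f n (at z j)
at-partial h zero    j = h 0 j
at-partial {s} {z} h (suc n) j = cong₂ _+ᴳ_ (at-partial {s} {z} h n j) (h (suc n) j)

-- A rational radius strictly between |z| and ln 2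

record Disk (z : ℂ) : Set where
  field
    R η   : ℚ
    0<R   : 0ℚ < R
    0<η   : 0ℚ < η
    E≤    : ∀ n → E n R + η ≤ 2ℚ
    M     : ℕ
    at⊑R  : ∀ n → M ℕ.≤ n → at z n ⊑ R

inDisk : ∀ z → ∣ z ∣ᶜ <ᴿ ln2 → Disk z
inDisk z (ε , 0<ε , N₀ , h) = record { R = R ; η = δ ; 0<R = 0<R ; 0<η = 0<δ ; E≤ = E≤ ; M = M ; at⊑R = at⊑R }
  where
  open ≤-Reasoning
  -- The gap ε between |z| and ln 2 is spent in four quarters. Above R = L - 2δ, one covers the
  -- oscillation of the approximations of ln 2 and one is the margin η; below R, one covers that
  -- oscillation and one the rounding down in `√approx`.
  δ = ½ * (½ * ε)
  0<δ : 0ℚ < δ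
  0<δ = ½-pos (½-pos 0<ε)
  N₁ = proj₁ (ln2-cauchy δ 0<δ)
  close = proj₂ (ln2-cauchy δ 0<δ)
  N₂ = proj₁ (1/1+-small 0<δ)
  small = proj₂ (1/1+-small 0<δ)
  M = suc (N₀ ℕ.+ (N₁ ℕ.+ N₂))
  ≥N₀ : ∀ {n} → M ℕ.≤ n → N₀ ℕ.≤ n
  ≥N₀ = ℕ.≤-trans (ℕ.≤-trans (ℕ.m≤m+n N₀ (N₁ ℕ.+ N₂)) (ℕ.n≤1+n _))
  ≥N₁ : ∀ {n} → M ℕ.≤ n → N₁ ℕ.≤ n
  ≥N₁ = ℕ.≤-trans (ℕ.≤-trans (ℕ.≤-trans (ℕ.m≤m+n N₁ N₂) (ℕ.m≤n+m (N₁ ℕ.+ N₂) N₀)) (ℕ.n≤1+n _))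
  ≥N₂ : ∀ {n} → M ℕ.≤ n → N₂ ℕ.≤ n
  ≥N₂ = ℕ.≤-trans (ℕ.≤-trans (ℕ.≤-trans (ℕ.m≤n+m N₂ N₁) (ℕ.m≤n+m (N₁ ℕ.+ N₂) N₀)) (ℕ.n≤1+n _))
  L R : ℚ
  L = ln2-approx M
  R = L - (δ + δ)
  ε≡ : ε ≡ δ + δ + (δ + δ)
  ε≡ = solve 1 (λ e → e := con ½ :* (con ½ :* e) :+ con ½ :* (con ½ :* e) :+ (con ½ :* (con ½ :* e) :+ con ½ :* (con ½ :* e))) refl ε
  s : ℕ → ℚ
  s n = seq ∣ z ∣ᶜ n
  0≤s : ∀ n → 0ℚ ≤ s n
  0≤s n = 0≤√approx n (seq (re z *ᴿ re z +ᴿ im z *ᴿ im z) n)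
  0<R : 0ℚ < R
  0<R = begin-strict
    0ℚ                                 <⟨ +-mono-< 0<δ 0<δ ⟩
    δ + δ                              ≤⟨ p≤q+p (0≤s M) ⟩
    s M + (δ + δ)                      ≡⟨ solve 2 (λ s d → s :+ d := s :+ (d :+ d) :- d) refl (s M) (δ + δ) ⟩
    s M + (δ + δ + (δ + δ)) - (δ + δ)  ≡⟨ cong (λ y → s M + y - (δ + δ)) ε≡ ⟨
    s M + ε - (δ + δ)                  ≤⟨ +-monoˡ-≤ (- (δ + δ)) (h M (≥N₀ ℕ.≤-refl)) ⟩
    R                                  ∎
  at⊑R : ∀ n → M ℕ.≤ n → at z n ⊑ R
  at⊑R n le = <⇒≤ 0<R , ≤-trans (√approx-upper n _) (*-mono (<⇒≤ 0<R) (+-nonNeg (0≤s n) (0≤/1+ 1 n)) sr≤R sr≤R)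
    where
    sr≤R : s n + 1 /1+ n ≤ R
    sr≤R = begin
      s n + 1 /1+ n                                  ≤⟨ +-monoʳ-≤ (s n) (small n (≥N₂ le)) ⟩
      s n + δ                                        ≡⟨ solve 2 (λ s d → s :+ d := s :+ (d :+ d :+ (d :+ d)) :- d :- (d :+ d)) refl (s n) δ ⟩
      s n + (δ + δ + (δ + δ)) - δ - (δ + δ)          ≡⟨ cong (λ y → s n + y - δ - (δ + δ)) ε≡ ⟨
      s n + ε - δ - (δ + δ)                          ≤⟨ +-monoˡ-≤ (- (δ + δ)) (+-monoˡ-≤ (- δ) (≤-trans (h n (≥N₀ le)) (≤-trans (≤+∣-∣ (ln2-approx n) L) (+-monoʳ-≤ L (close n M (≥N₁ le) (≥N₁ ℕ.≤-refl)))))) ⟩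
      L + δ - δ - (δ + δ)                            ≡⟨ solve 2 (λ l d → l :+ d :- d :- (d :+ d) := l :- (d :+ d)) refl L δ ⟩
      R                                              ∎
  R+δ≤ : ∀ n → M ℕ.≤ n → R + δ ≤ ln2-approx n
  R+δ≤ n le = begin
    L - (δ + δ) + δ                ≤⟨ +-monoˡ-≤ δ (+-monoˡ-≤ (- (δ + δ)) (≤-trans (≤+∣-∣ L (ln2-approx n)) (+-monoʳ-≤ (ln2-approx n) (close M n (≥N₁ ℕ.≤-refl) (≥N₁ le))))) ⟩
    ln2-approx n + δ - (δ + δ) + δ ≡⟨ solve 2 (λ l d → l :+ d :- (d :+ d) :+ d := l) refl (ln2-approx n) δ ⟩
    ln2-approx n                   ∎
  -- Raising n to m ≥ M brings the approximation of ln 2 within reach. `E m` increases by at least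
  -- as much as its argument, which turns the margin δ between R and ln 2 into a margin below 2; the
  -- successor in `M` gives the 1 ≤ m that `E-expanding` asks for.
  E≤ : ∀ n → E n R + δ ≤ 2ℚ
  E≤ n = begin
    E n R + δ                      ≤⟨ +-monoˡ-≤ δ (E-mono-n (<⇒≤ 0<R) (ℕ.m≤m⊔n n M)) ⟩
    E m R + δ                      ≡⟨ cong (λ y → E m R + y) (solve 2 (λ r d → d := r :+ d :- r) refl R δ) ⟩
    E m R + (R + δ - R)            ≤⟨ +-monoʳ-≤ (E m R) (+-monoˡ-≤ (- R) (R+δ≤ m (ℕ.m≤n⊔m n M))) ⟩
    E m R + (ln2-approx m - R)     ≤⟨ E-expanding (<⇒≤ 0<R) (≤-trans (p≤p+q (<⇒≤ 0<δ)) (R+δ≤ m (ℕ.m≤n⊔m n M))) m (ℕ.≤-trans (s≤s z≤n) (ℕ.m≤n⊔m n M)) ⟩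
    E m (ln2-approx m)             ≤⟨ ln2-lower m ⟩
    2ℚ                             ∎
    where m = n ℕ.⊔ M

⊑-sym : ∀ u w {t} → u -ᴳ w ⊑ t → w -ᴳ u ⊑ t
⊑-sym (a , b) (x , y) (0≤t , h) = 0≤t , ≤-trans (≤-reflexive (solve 4 (λ a b x y → (x :- a) :* (x :- a) :+ (y :- b) :* (y :- b) := (a :- x) :* (a :- x) :+ (b :- y) :* (b :- y)) refl a b x y)) h

module Limit (z : ℂ) (D : Disk z) where
  open Disk D
  open Majorant R η 0<R 0<η E≤ using (C; 0<C; R≢0)
  open Evaluation R η 0<R 0<η E≤
  open ≤-Reasoning

  u : ℕ → 𝔾
  u = at z

  -- The degree of truncation and the precision of z grow together, as in `exp`; their effects are
  -- separated in `gap` through `eval f m (u n)`.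
  value : ℕ → 𝔾
  value n = eval f n (u n)

  A : ℚ
  A = C * 1/ R

  0<A : 0ℚ < A
  0<A = positive⁻¹ A ⦃ pos*pos⇒pos C ⦃ positive 0<C ⦄ (1/ R) ⦃ 1/pos⇒pos R ⦃ positive 0<R ⦄ ⦄ ⦄

  gap : ∀ {n m} → M ℕ.≤ n → n ℕ.≤ m → value m -ᴳ value n ⊑ A * ‖ u m -ᴳ u n ‖ + C * 1 /1+ n
  gap {n} {m} M≤n n≤m = subst (_⊑ A * ‖ u m -ᴳ u n ‖ + C * 1 /1+ n) (split (value m) (eval f m (u n)) (value n))
    (⊑-+ (⊑-lipschitz (at⊑R m (ℕ.≤-trans M≤n n≤m)) (at⊑R n M≤n) (⊑-‖‖ (u m -ᴳ u n)) m) (⊑-tail (at⊑R n M≤n) n≤m))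
    where
    split : ∀ x y z → (x -ᴳ y) +ᴳ (y -ᴳ z) ≡ x -ᴳ z
    split (a , a′) (b , b′) (c , c′) = cong₂ _,_ (eq a b c) (eq a′ b′ c′)
      where eq = solve 3 (λ a b c → (a :- b) :+ (b :- c) := a :- c) refl

  gap-sym : ∀ ε → 0ℚ < ε → ∃ λ N → ∀ m n → N ℕ.≤ m → N ℕ.≤ n → value m -ᴳ value n ⊑ A * ‖ u m -ᴳ u n ‖ + ε
  gap-sym ε 0<ε = N₁ ℕ.⊔ M , λ m n N≤m N≤n → [
      (λ m≤n → subst (λ y → value m -ᴳ value n ⊑ A * y + ε) (Exp.‖-‖-comm z (u n) (u m)) (⊑-sym (value n) (value m) (⊑-weaken (+-monoʳ-≤ (A * ‖ u n -ᴳ u m ‖) (small m (ℕ.m⊔n≤o⇒m≤o N₁ M N≤m))) (gap (ℕ.m⊔n≤o⇒n≤o N₁ M N≤m) m≤n))))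
    , (λ n≤m → ⊑-weaken (+-monoʳ-≤ (A * ‖ u m -ᴳ u n ‖) (small n (ℕ.m⊔n≤o⇒m≤o N₁ M N≤n))) (gap (ℕ.m⊔n≤o⇒n≤o N₁ M N≤n) n≤m)) ]′ (ℕ.≤-total m n)
    where
    N₁ = proj₁ (archimedes C (<⇒≤ 0<C) 0<ε)
    small = proj₂ (archimedes C (<⇒≤ 0<C) 0<ε)

  re-cauchy : IsCauchy (λ n → proj₁ (value n))
  re-cauchy = lipschitz (re z) (im z) (λ n → proj₁ (value n)) A 0<A λ ε 0<ε →
    proj₁ (gap-sym ε 0<ε) , λ m n N≤m N≤n → ⊑⇒∣re∣≤ (proj₂ (gap-sym ε 0<ε) m n N≤m N≤n)

  im-cauchy : IsCauchy (λ n → proj₂ (value n))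
  im-cauchy = lipschitz (re z) (im z) (λ n → proj₂ (value n)) A 0<A λ ε 0<ε →
    proj₁ (gap-sym ε 0<ε) , λ m n N≤m N≤n → ⊑⇒∣im∣≤ (proj₂ (gap-sym ε 0<ε) m n N≤m N≤n)

  w : ℂ
  w = mkℝ (λ n → proj₁ (value n)) re-cauchy +i mkℝ (λ n → proj₂ (value n)) im-cauchy

  square-close : ∀ ε → 0ℚ < ε → ∃ λ N → ∀ n → N ℕ.≤ n → at (w *ᶜ w) n -ᴳ at (fromℚᶜ 2ℚ *ᶜ exp (-ᶜ z) -ᶜ fromℚᶜ 1ℚ) n ⊑ ε
  square-close ε 0<ε = N₁ ℕ.⊔ M , λ n le → subst (λ y → value n *ᴳ value n -ᴳ y ⊑ ε) (sym (rhs n))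
      (⊑-weaken (small n (ℕ.m⊔n≤o⇒m≤o N₁ M le)) (⊑-product (at⊑R n (ℕ.m⊔n≤o⇒n≤o N₁ M le)) n))
    where
    N₁ = proj₁ (archimedes K 0≤K 0<ε)
    small = proj₂ (archimedes K 0≤K 0<ε)
    rhs : ∀ n → at (fromℚᶜ 2ℚ *ᶜ exp (-ᶜ z) -ᶜ fromℚᶜ 1ℚ) n ≡ eval (f ⋆ f) n (u n)
    rhs n = trans (eval-2exp-1 n (u n)) (ΣG.Σ-cong n λ k → cong (_• u n ^ᴳ k) (sym (f² k)))

  isPrincipal√ : w IsPrincipal√Of (fromℚᶜ 2ℚ *ᶜ exp (-ᶜ z) -ᶜ fromℚᶜ 1ℚ)
  isPrincipal√ =
      ( (λ ε 0<ε → proj₁ (square-close ε 0<ε) , λ n le → ⊑⇒∣re∣≤ (proj₂ (square-close ε 0<ε) n le))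
      , (λ ε 0<ε → proj₁ (square-close ε 0<ε) , λ n le → ⊑⇒∣im∣≤ (proj₂ (square-close ε 0<ε) n le)))
    , inj₁ (η , 0<η , M , λ n le → ≤-trans (≤-reflexive (+-identityˡ η)) (η≤re (at⊑R n le) n))

  hasSum : ∀ {s} → (∀ n j → at (s n) j ≡ f n • at z j ^ᴳ n) → s HasSum w
  hasSum {s} h ε 0<ε = N₁ , λ n N≤n → δ , 0<δ , n ℕ.⊔ M , λ j le →
    modulus-small {x = x n j} {y = y n j} (0≤√approx j (x n j * x n j + y n j * y n j)) (<⇒≤ 0<δ) (√approx-lower j (x n j * x n j + y n j * y n j))
      (close n j N≤n (ℕ.m⊔n≤o⇒m≤o n M le) (ℕ.m⊔n≤o⇒n≤o n M le)) (≤-reflexive (½+½ ε))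
    where
    -- One half of ε bounds the distance; the other half is the positive margin in `<ᴿ`.
    δ = ½ * ε
    0<δ = ½-pos 0<ε
    0≤2C : 0ℚ ≤ C + C
    0≤2C = +-nonNeg (<⇒≤ 0<C) (<⇒≤ 0<C)
    -- The bound C / (n + 1) on the modulus doubles when real and imaginary parts are added in
    -- `‖_‖`.
    N₁ = proj₁ (archimedes (C + C) 0≤2C 0<δ)
    small = proj₂ (archimedes (C + C) 0≤2C 0<δ)
    x y : ℕ → ℕ → ℚ
    x n j = proj₁ (at (∑ _+ᶜ_ n s -ᶜ w) j)
    y n j = proj₂ (at (∑ _+ᶜ_ n s -ᶜ w) j)
    close : ∀ n j → N₁ ℕ.≤ n → n ℕ.≤ j → M ℕ.≤ j → ‖ at (∑ _+ᶜ_ n s -ᶜ w) j ‖ ≤ δ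
    close n j N≤n n≤j M≤j = begin
      ‖ at (∑ _+ᶜ_ n s -ᶜ w) j ‖                ≡⟨ cong (λ y → ‖ y -ᴳ value j ‖) (at-partial {s} {z} h n j) ⟩
      ‖ eval f n (u j) -ᴳ value j ‖              ≤⟨ ⊑⇒‖‖≤ (⊑-sym (value j) (eval f n (u j)) (⊑-tail (at⊑R j M≤j) n≤j)) ⟩
      C * 1 /1+ n + C * 1 /1+ n                  ≡⟨ *-distribʳ-+ (1 /1+ n) C C ⟨
      (C + C) * 1 /1+ n                          ≤⟨ small n N≤n ⟩
      δ                                          ∎

-- The summands enter only through their approximations fₙ uⁿ, so the explicit Stirling sum stays
-- folded.
HasSum-√ : ∀ (s : ℂ → ℕ → ℂ) → (∀ z n j → at (s z n) j ≡ f n • at z j ^ᴳ n) → (z : ℂ) → ∣ z ∣ᶜ <ᴿ ln2 →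
           ∃ λ w → w IsPrincipal√Of (fromℚᶜ 2ℚ *ᶜ exp (-ᶜ z) -ᶜ fromℚᶜ 1ℚ) × s z HasSum w
HasSum-√ s at-s z ∣z∣<ln2 = Limit.w z disk , Limit.isPrincipal√ z disk , Limit.hasSum z disk {s z} (at-s z)
  where
  disk : Disk z
  disk = inDisk z ∣z∣<ln2

theorem3p3 : (z : ℂ) → ∣ z ∣ᶜ <ᴿ ln2 →
  ∃ λ w →
    w IsPrincipal√Of (fromℚᶜ 2ℚ *ᶜ exp (-ᶜ z) -ᶜ fromℚᶜ 1ℚ) ×
    (λ n → fromℚᶜ ((ℚ.- 1ℚ) ^ suc n ℚ.* ∑ ℚ._+_ n (λ k → (ℚ.- 1ℚ) ^ k ℚ.* S n k ℚ.* [2 + k ℤ.- + 1 -1]!!))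
           *ᶜ (fromℚᶜ (1/! n) *ᶜ z ^ᶜ n))
      HasSum w
theorem3p3 = HasSum-√ _ at-summand
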